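{- Let $\varepsilon>0$, $0<\delta<1$, $s\ge 0$ and $k\ge 1$ be given, and let $c$ be a positive integer with $c\ge (s+2)/(\delta k)$. For $n\ge 1$ let $m\ge(1+\varepsilon)n$ and $\ell=n^\delta$. Let $S\subseteq U$ with $|S|=n$. Then for $(h_1,h_2)$ chosen uniformly at random from $\mathcal{Z}^{2k,c}_{\ell,m}$, $$\Pr\bigl(\mathrm{ex}(G(S,h_1,h_2))\ge s+1\bigr)=O(1/n^{s+1}).$$
   Context: $U$ is a finite set (the universe). For integers $\kappa\ge 2$, $r\ge1$, $\mathcal{H}^\kappa_r$ denotes an arbitrary $\kappa$-wise independent family of hash functions $U\to[r]=\{0,\dots,r-1\}$, i.e. for all distinct $x_1,\dots,x_\kappa\in U$ and all $j_1,\dots,j_\kappa\in[r]$, $\Pr_{h\in\mathcal{H}^\kappa_r}(h(x_1)=j_1\wedge\dots\wedge h(x_\kappa)=j_\kappa)=r^{ -\kappa}$. The family $\mathcal{Z}^{2k,c}_{\ell,m}$ consists of all pairs $(h_1,h_2)$ determined by $f_1,f_2\in\mathcal{H}^{2k}_m$, $g_1,\dots,g_c\in\mathcal{H}^{2k}_\ell$ and vectors $z^{(i)}_j\in[m]^\ell$ ($1\le j\le c$, $i\in\{1,2\}$) via $h_i(x)=\bigl(f_i(x)+\sum_{j=1}^c z^{(i)}_j[g_j(x)]\bigr)\bmod m$; choosing uniformly from this family means choosing all components independently and uniformly. For $T\subseteq U$, the cuckoo graph $G(T,h_1,h_2)$ is the bipartite multigraph whose two vertex sides are copies of $[m]$ and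 whose edge multiset consists of the pairs $(h_1(x),h_2(x))$, $x\in T$. The excess $\mathrm{ex}(G)$ of a graph $G$ is the minimum number of edges one has to remove from $G$ so that every connected component of the remaining graph is acyclic or unicyclic. Constants in the $O$-notation may depend on $\varepsilon,\delta,s,k,c$.
   Formalization: The formal theorem takes ε and δ to be rational numbers (harmless for ε; irrational δ is not covered), with ℓ being n^δ rounded down or up to an integer. -}

module Defs where

open import Data.Nat using (ℕ; zero; suc; _+_; _*_; _∸_; _^_; _≤_; _<_; NonZero)
open import Data.Nat.DivMod using (_mod_)
open import Data.Fin using (Fin; toℕ)
open import Data.Fin.Properties using (_≟_)
open import Data.Vec using (Vec; []; _∷_; lookup; map; zipWith; sum)
import Data.Vec.Properties as VecP
open import Data.List using (List; []; _∷_; [_]; length; filter; allFin; cartesianProductWith; concatMap; _++_)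
import Data.List as L
open import Data.List.Membership.Propositional using (_∈_)
open import Data.List.Relation.Unary.Unique.Propositional using (Unique)
open import Data.List.Relation.Binary.Sublist.Propositional using (_⊆_)
open import Data.Product using (Σ; ∃; ∃-syntax; _×_; _,_; proj₁; proj₂)
open import Data.Sum using (_⊎_; inj₁; inj₂)
import Data.Sum.Properties as SumP
open import Data.Integer using (+_; ∣_∣)
open import Data.Rational using (ℚ; ↥_; ↧ₙ_)
open import Relation.Binary.PropositionalEquality using (_≡_)
open import Relation.Binary.Construct.Closure.ReflexiveTransitive using (Star)

-- Hash families.  A hash function U → [r] with U = Fin u is represented
-- by its table Vec (Fin r) u; a family is a duplicate-free nonempty list
-- of such functions ("choosing uniformly" = uniform over the list).

HashFn : ℕ → ℕ → Set
HashFn u r = Vec (Fin r) u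

apply : ∀ {u r} → HashFn u r → Fin u → Fin r
apply h x = lookup h x

KWiseIndependent : ∀ {u r} → ℕ → List (HashFn u r) → Set
KWiseIndependent {u} {r} κ F =
  ∀ (xs : Vec (Fin u) κ) → (∀ i j → lookup xs i ≡ lookup xs j → i ≡ j) →
  ∀ (js : Vec (Fin r) κ) →
  length (filter (λ h → VecP.≡-dec _≟_ (map (apply h) xs) js) F) * r ^ κ ≡ length F

IsHashFamily : ∀ {u r} → ℕ → List (HashFn u r) → Set
IsHashFamily κ F = Unique F × (1 ≤ length F) × KWiseIndependent κ F

-- The family Z^{2k,c}_{ℓ,m}: a sample is (f₁, f₂, (g₁..g_c), (z⁽¹⁾₁..z⁽¹⁾_c), (z⁽²⁾₁..z⁽²⁾_c)).

Sample : (u m ℓ c : ℕ) → Set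
Sample u m ℓ c =
  HashFn u m × HashFn u m × Vec (HashFn u ℓ) c × Vec (Vec (Fin m) ℓ) c × Vec (Vec (Fin m) ℓ) c

vecsOf : ∀ {A : Set} (n : ℕ) → List A → List (Vec A n)
vecsOf zero    xs = [ [] ]
vecsOf (suc n) xs = cartesianProductWith _∷_ xs (vecsOf n xs)

sampleSpace : ∀ {u m ℓ} (c : ℕ) → List (HashFn u m) → List (HashFn u ℓ) → List (Sample u m ℓ c)
sampleSpace {u} {m} {ℓ} c F G =
  concatMap (λ f₁ →
  concatMap (λ f₂ →
  concatMap (λ gs →
  concatMap (λ z₁ →
  L.map (λ z₂ → (f₁ , f₂ , gs , z₁ , z₂))
    (vecsOf c (vecsOf ℓ (allFin m))))
    (vecsOf c (vecsOf ℓ (allFin m))))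
    (vecsOf c G)) F) F

zHash : ∀ {u m ℓ c} .{{_ : NonZero m}} → HashFn u m → Vec (HashFn u ℓ) c → Vec (Vec (Fin m) ℓ) c → Fin u → Fin m
zHash {m = m} f gs zs x =
  (toℕ (apply f x) + sum (zipWith (λ z g → toℕ (lookup z (apply g x))) zs gs)) mod m

h₁ h₂ : ∀ {u m ℓ c} .{{_ : NonZero m}} → Sample u m ℓ c → Fin u → Fin m
h₁ (f₁ , f₂ , gs , z₁ , z₂) = zHash f₁ gs z₁
h₂ (f₁ , f₂ , gs , z₁ , z₂) = zHash f₂ gs z₂

-- Bipartite multigraphs on two copies of [m], given by an edge list.

Vertex : ℕ → Set
Vertex m = Fin m ⊎ Fin m

Edge : ℕ → Set
Edge m = Fin m × Fin m

vertices : (m : ℕ) → List (Vertex m)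
vertices m = L.map inj₁ (allFin m) ++ L.map inj₂ (allFin m)

cuckooEdges : ∀ {u m ℓ c} .{{_ : NonZero m}} → List (Fin u) → Sample u m ℓ c → List (Edge m)
cuckooEdges T σ = L.map (λ x → (h₁ σ x , h₂ σ x)) T

Adj : ∀ {m} → List (Edge m) → Vertex m → Vertex m → Set
Adj E v w = ∃[ a ] ∃[ b ] ((a , b) ∈ E ×
  ((v ≡ inj₁ a × w ≡ inj₂ b) ⊎ (v ≡ inj₂ b × w ≡ inj₁ a)))

Reach : ∀ {m} → List (Edge m) → Vertex m → Vertex m → Set
Reach E = Star (Adj E)

IsComponentLabelling : ∀ {m} → List (Edge m) → (Vertex m → Vertex m) → Set
IsComponentLabelling E comp =
  ∀ v w → (comp v ≡ comp w → Reach E v w) × (Reach E v w → comp v ≡ comp w)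

-- every connected component is acyclic or unicyclic, i.e. has at most as
-- many edges as vertices (cyclomatic number ≤ 1)
AllComponentsAtMostUnicyclic : ∀ {m} → List (Edge m) → Set
AllComponentsAtMostUnicyclic {m} E =
  ∀ comp → IsComponentLabelling E comp → ∀ (w : Vertex m) →
  length (filter (λ e → SumP.≡-dec _≟_ _≟_ (comp (inj₁ (proj₁ e))) w) E)
    ≤ length (filter (λ v → SumP.≡-dec _≟_ _≟_ (comp v) w) (vertices m))

-- ex(G) ≥ t : every way of removing edges (a sub-multiset E' of E) that leaves
-- all components acyclic or unicyclic removes at least t edges
ExcessAtLeast : ∀ {m} → List (Edge m) → ℕ → Set
ExcessAtLeast E t = ∀ E' → E' ⊆ E → AllComponentsAtMostUnicyclic E' → t + length E' ≤ length E

-- ℓ = n^δ (δ = p/q in lowest terms), rounded to a neighbouring integer: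
-- ℓ - 1 < n^δ < ℓ + 1, i.e. ℓ ∈ {⌊n^δ⌋, ⌈n^δ⌉}.
RoundedPow : ℕ → ℚ → ℕ → Set
RoundedPow n δ ℓ = ((ℓ ∸ 1) ^ q < n ^ p) × (n ^ p < (suc ℓ) ^ q)
  where p = ∣ ↥ δ ∣
        q = ↧ₙ δ

{-# OPTIONS --safe #-}

-- Insert the keys by eviction.  If at most s keys remain unplaced, the placement assigns to
-- every other edge one of its endpoints, so removing the unplaced keys leaves only acyclic
-- and unicyclic components.  If s + 1 keys remain that no eviction can place, then from each
-- of their endpoints the walk "go to the other endpoint of the occupant" closes up, and the
-- union of these walks is a graph with s + 1 more edges than vertices, read off key by key.
-- It is described by a template with a bounded number of jumps, so there are only
-- polynomially many templates of length t, and each prefix has at most one more vertex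
-- than edges.
--
-- If some g_j has at most k collisions on a key set T, then (h₁ , h₂) is uniform on T: the at
-- most 2k colliding keys are handled by f₁ and f₂, the others by their own entries of the
-- tables z_j.  A template of length t is then followed with probability m^-(t+s+1), and
-- summing over n^t key sequences leaves Σ poly(t) (n/m)^t m^-(s+1) = O(n^-(s+1)).  Otherwise
-- stop at the first prefix on which every g_j has k collisions: some g_j still has exactly k,
-- so (h₁ , h₂) is uniform there, and the event costs a further (poly(t) / ℓ^k)^c, in total
-- O(n ℓ^-kc) = O(n^-(s+1)).
module Submission where

open import Defs
open import Level using (0ℓ)
open import Data.Bool using (Bool; true; false; if_then_else_; not)
import Data.Bool.Properties as BoolP
open import Data.Empty using (⊥)
open import Data.Fin using (Fin; zero; suc; toℕ; fromℕ<)
open import Data.Fin.Properties using (_≟_; toℕ-fromℕ<; toℕ-injective; toℕ<n; injective⇒≤; all?; any?; ¬∀⟶∃¬)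
open import Data.Integer as ℤ using (-[1+_]; ∣_∣) renaming (+_ to ℤ⁺)
import Data.Integer.Properties as ℤP
open import Data.Integer.Tactic.RingSolver using () renaming (solve-∀ to solveℤ-∀)
open import Data.List using (List; []; _∷_; length; filter; allFin; cartesianProductWith; cartesianProduct; concatMap; _++_; zip; upTo; downFrom; take)
import Data.List as L
import Data.List.Properties as LP
import Data.List.Membership.DecPropositional as DecMem
open import Data.List.Membership.Propositional using (_∈_; _∉_; find; lose)
open import Data.List.Membership.Propositional.Properties
  using (∈-allFin; ∈-lookup; ∈-map⁻; ∈-map⁺; ∈-cartesianProductWith⁺; ∈-cartesianProductWith⁻; ∈-∃++; ∈-++⁺ˡ; ∈-++⁺ʳ; ∈-++⁻;
         ∈-filter⁺; ∈-filter⁻; ∈-upTo⁺; ∈-downFrom⁺; ∈-downFrom⁻)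
open import Data.List.Relation.Binary.Permutation.Propositional using (_↭_; ↭-sym; ↭-refl; ↭-trans; prep; ↭⇒↭ₛ)
open import Data.List.Relation.Binary.Permutation.Propositional.Properties using (All-resp-↭; ↭-length; shift; ++⁺ʳ; shifts)
import Data.List.Relation.Binary.Permutation.Setoid.Properties as PermS
open import Data.List.Relation.Binary.Sublist.Propositional using (_⊆_; []; _∷_; _∷ʳ_; ⊆-refl; minimum)
import Data.List.Relation.Binary.Sublist.Propositional.Properties as SubP
open import Data.List.Relation.Binary.Sublist.Propositional.Properties using (Any-resp-⊆; All-resp-⊆)
open import Data.List.Relation.Unary.All as All using (All; []; _∷_)
import Data.List.Relation.Unary.All.Properties as AllP
open import Data.List.Relation.Unary.AllPairs using (AllPairs; []; _∷_; allPairs?)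
import Data.List.Relation.Unary.AllPairs.Properties as AllPairsP
open import Data.List.Relation.Unary.Any as Any using (Any; here; there)
import Data.List.Relation.Unary.Any.Properties as AnyP
open import Data.List.Relation.Unary.Unique.Propositional using (Unique)
open import Data.List.Relation.Unary.Unique.Propositional.Properties using (allFin⁺; filter⁺; take⁺)
open import Data.Maybe using (Maybe; just; nothing)
import Data.Maybe.Properties as MaybeP
open import Data.Nat using (ℕ; zero; suc; _+_; _*_; _∸_; _^_; _≤_; _<_; z≤n; s≤s; NonZero; >-nonZero; >-nonZero⁻¹)
open import Data.Nat.DivMod using (_mod_; _%_; m≡m%n+[m/n]*n; m%n≤n; m%n<n; m%n%n≡m%n; [m+kn]%n≡m%n; m<n⇒m%n≡m; %-distribˡ-+)
  renaming (_/_ to _ℕ/_)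
open import Data.Nat.Properties hiding (_≟_)
open import Data.Nat.Tactic.RingSolver using (solve-∀)
open import Data.Product using (∃-syntax; _×_; _,_; proj₁; proj₂)
open import Data.Rational as ℚ using (mkℚ; ↥_; ↧ₙ_; toℚᵘ; ℚ; 0ℚ; 1ℚ; _/_) renaming (_<_ to _<ℚ_; _≤_ to _≤ℚ_; _+_ to _+ℚ_; _*_ to _*ℚ_)
import Data.Rational.Properties as ℚP
open import Data.Rational.Unnormalised as ℚᵘ using (mkℚᵘ)
import Data.Rational.Unnormalised.Properties as ℚᵘP
open import Data.Sum using (_⊎_; inj₁; inj₂)
import Data.Sum.Properties as SumP
open import Data.Unit using (⊤; tt)
open import Data.Vec as Vec using (Vec; []; _∷_; lookup; zipWith; sum; fromList)
import Data.Vec.Properties as VecP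
open import Function using (_∘_; id)
open import Relation.Binary using (Symmetric; Rel)
import Relation.Binary.Construct.Closure.ReflexiveTransitive as Star
open import Relation.Nullary using (¬_; Dec; yes; no; does; contradiction)
open import Relation.Nullary.Decidable using (_×-dec_; ¬?; decidable-stable; dec-true; dec-false)
open import Relation.Binary.PropositionalEquality using (_≡_; _≢_; refl; sym; trans; cong; cong₂; subst; setoid; module ≡-Reasoning)

-- Obstructions are read as words of keys and not as subgraphs up to isomorphism, for two reasons.
-- Counting words with prescribed repetitions needs no classification of graphs, and what has been
-- read of such a word at any moment is an object of the same kind, so reading can stop as soon as
-- the collisions reach k; a subgraph offers no such order. The price of stopping early is that t +
-- 1 keys read so far are only known to satisfy t constraints. Then n^(t+1) key sequences meet a
-- probability m^-t and a factor n is left over, which is why the hypothesis on c asks for s + 2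
-- although the result has s + 1. Probabilities are counts over the finite sample space, and an
-- estimate Pr ≤ a / b takes the form count * b ≤ a * total, so no division occurs. Independence on
-- fewer than 2 k keys has to be derived from independence on exactly 2 k keys. This requires 2 k
-- keys to exist, so smaller sets S are absorbed by the constant.

private variable
  A B A′ Idx : Set
  Φ Ψ : Set

-- Finite sums and indicators

⟦_⟧ : Dec Φ → ℕ
⟦ d ⟧ = if does d then 1 else 0

⟦⟧-yes : (d : Dec Φ) → Φ → ⟦ d ⟧ ≡ 1
⟦⟧-yes (yes _) _ = refl
⟦⟧-yes (no ¬p) p = contradiction p ¬p

⟦⟧-no : (d : Dec Φ) → ¬ Φ → ⟦ d ⟧ ≡ 0
⟦⟧-no (yes p) ¬p = contradiction p ¬p
⟦⟧-no (no _) _ = refl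

⟦⟧-mono : (d : Dec Φ) (e : Dec Ψ) → (Φ → Ψ) → ⟦ d ⟧ ≤ ⟦ e ⟧
⟦⟧-mono (yes p) e f = ≤-reflexive (sym (⟦⟧-yes e (f p)))
⟦⟧-mono (no _)  e f = z≤n

⟦⟧-cong : (d : Dec Φ) (e : Dec Ψ) → (Φ → Ψ) → (Ψ → Φ) → ⟦ d ⟧ ≡ ⟦ e ⟧
⟦⟧-cong d e f g = ≤-antisym (⟦⟧-mono d e f) (⟦⟧-mono e d g)

⟦⟧≤1 : (d : Dec Φ) → ⟦ d ⟧ ≤ 1
⟦⟧≤1 (yes _) = ≤-refl
⟦⟧≤1 (no _) = z≤n

⟦⟧-× : (d : Dec Φ) (e : Dec Ψ) → ⟦ d ×-dec e ⟧ ≡ ⟦ d ⟧ * ⟦ e ⟧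
⟦⟧-× (yes _) (yes _) = refl
⟦⟧-× (yes _) (no _)  = refl
⟦⟧-× (no _)  _       = refl

⟦⟧-≤ : (d : Dec Φ) {n : ℕ} → (Φ → 1 ≤ n) → ⟦ d ⟧ ≤ n
⟦⟧-≤ (yes p) h = h p
⟦⟧-≤ (no _)  h = z≤n

⟦⟧-*-≤ : (d : Dec Φ) {x y : ℕ} → (Φ → x ≤ y) → ⟦ d ⟧ * x ≤ y
⟦⟧-*-≤ (yes p) {x} h = ≤-trans (≤-reflexive (*-identityˡ x)) (h p)
⟦⟧-*-≤ (no _)  h = z≤n

∑ : List A → (A → ℕ) → ℕ
∑ []       f = 0
∑ (x ∷ xs) f = f x + ∑ xs f

infix 5 ∑
syntax ∑ xs (λ x → e) = ∑[ x ∈ xs ] e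

∑-mono-∈ : (xs : List A) {f g : A → ℕ} → (∀ {x} → x ∈ xs → f x ≤ g x) → ∑ xs f ≤ ∑ xs g
∑-mono-∈ []       h = z≤n
∑-mono-∈ (x ∷ xs) h = +-mono-≤ (h (here refl)) (∑-mono-∈ xs (h ∘ there))

∑-mono : (xs : List A) {f g : A → ℕ} → (∀ x → f x ≤ g x) → ∑ xs f ≤ ∑ xs g
∑-mono xs h = ∑-mono-∈ xs (λ {x} _ → h x)

∑-cong : (xs : List A) {f g : A → ℕ} → (∀ x → f x ≡ g x) → ∑ xs f ≡ ∑ xs g
∑-cong []       h = refl
∑-cong (x ∷ xs) h = cong₂ _+_ (h x) (∑-cong xs h)

∑-++ : (xs ys : List A) (f : A → ℕ) → ∑ (xs ++ ys) f ≡ ∑ xs f + ∑ ys f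
∑-++ []       ys f = refl
∑-++ (x ∷ xs) ys f = trans (cong (f x +_) (∑-++ xs ys f)) (sym (+-assoc (f x) _ _))

∑-map : (h : A → B) (xs : List A) (f : B → ℕ) → ∑ (L.map h xs) f ≡ ∑ xs (f ∘ h)
∑-map h []       f = refl
∑-map h (x ∷ xs) f = cong (f (h x) +_) (∑-map h xs f)

∑-concatMap : (h : A → List B) (xs : List A) (f : B → ℕ) →
  ∑ (concatMap h xs) f ≡ ∑[ x ∈ xs ] ∑ (h x) f
∑-concatMap h []       f = refl
∑-concatMap h (x ∷ xs) f =
  trans (∑-++ (h x) (concatMap h xs) f) (cong (∑ (h x) f +_) (∑-concatMap h xs f))

∑-cartesian : (h : A → B → A′) (xs : List A) (ys : List B) (f : A′ → ℕ) →
  ∑ (cartesianProductWith h xs ys) f ≡ ∑[ x ∈ xs ] ∑[ y ∈ ys ] f (h x y)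
∑-cartesian h []       ys f = refl
∑-cartesian h (x ∷ xs) ys f =
  trans (∑-++ (L.map (h x) ys) _ f) (cong₂ _+_ (∑-map (h x) ys f) (∑-cartesian h xs ys f))

∑-+ : (xs : List A) (f g : A → ℕ) → ∑[ x ∈ xs ] (f x + g x) ≡ ∑ xs f + ∑ xs g
∑-+ []       f g = refl
∑-+ (x ∷ xs) f g = trans (cong (f x + g x +_) (∑-+ xs f g)) (lem (f x) (g x) (∑ xs f) (∑ xs g))
  where
  lem : ∀ a b c d → a + b + (c + d) ≡ a + c + (b + d)
  lem = solve-∀

∑-zero : (xs : List A) → ∑[ x ∈ xs ] 0 ≡ 0
∑-zero []       = refl
∑-zero (x ∷ xs) = ∑-zero xs

∑-swap : (xs : List A) (ys : List B) (f : A → B → ℕ) →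
  ∑[ x ∈ xs ] ∑[ y ∈ ys ] f x y ≡ ∑[ y ∈ ys ] ∑[ x ∈ xs ] f x y
∑-swap []       ys f = sym (∑-zero ys)
∑-swap (x ∷ xs) ys f =
  trans (cong (∑ ys (f x) +_) (∑-swap xs ys f)) (sym (∑-+ ys (f x) (λ y → ∑[ x ∈ xs ] f x y)))

∑-*ʳ : (xs : List A) (f : A → ℕ) (c : ℕ) → ∑ xs f * c ≡ ∑[ x ∈ xs ] f x * c
∑-*ʳ []       f c = refl
∑-*ʳ (x ∷ xs) f c = trans (*-distribʳ-+ c (f x) (∑ xs f)) (cong (f x * c +_) (∑-*ʳ xs f c))

∑-*ˡ : (xs : List A) (f : A → ℕ) (c : ℕ) → c * ∑ xs f ≡ ∑[ x ∈ xs ] c * f x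
∑-*ˡ xs f c = trans (*-comm c (∑ xs f)) (trans (∑-*ʳ xs f c) (∑-cong xs (λ x → *-comm (f x) c)))

∑-const : (xs : List A) (c : ℕ) → ∑[ x ∈ xs ] c ≡ length xs * c
∑-const []       c = refl
∑-const (x ∷ xs) c = cong (c +_) (∑-const xs c)

∑-1 : (xs : List A) → ∑[ x ∈ xs ] 1 ≡ length xs
∑-1 xs = trans (∑-const xs 1) (*-identityʳ (length xs))

∑-≤-const : (xs : List A) {f : A → ℕ} {c : ℕ} → (∀ x → f x ≤ c) → ∑ xs f ≤ length xs * c
∑-≤-const xs {c = c} h = ≤-trans (∑-mono xs h) (≤-reflexive (∑-const xs c))

∑-∈ : {xs : List A} (f : A → ℕ) {x : A} → x ∈ xs → f x ≤ ∑ xs f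
∑-∈ f (here refl) = m≤m+n _ _
∑-∈ f (there p)   = ≤-trans (∑-∈ f p) (m≤n+m _ _)

∑-⊆ : {xs ys : List A} (f : A → ℕ) → xs ⊆ ys → ∑ xs f ≤ ∑ ys f
∑-⊆ f []         = z≤n
∑-⊆ f (y ∷ʳ p)   = ≤-trans (∑-⊆ f p) (m≤n+m _ _)
∑-⊆ f (refl ∷ p) = +-monoʳ-≤ _ (∑-⊆ f p)

length-cartesianProductWith : (h : A → B → A′) (xs : List A) (ys : List B) →
  length (cartesianProductWith h xs ys) ≡ length xs * length ys
length-cartesianProductWith h xs ys =
  trans (sym (∑-1 (cartesianProductWith h xs ys)))
  (trans (∑-cartesian h xs ys (λ _ → 1)) (trans (∑-const xs _) (cong (length xs *_) (∑-1 ys))))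

length-filter : {P : A → Set} (P? : ∀ x → Dec (P x)) (xs : List A) →
  length (filter P? xs) ≡ ∑[ x ∈ xs ] ⟦ P? x ⟧
length-filter P? []       = refl
length-filter P? (x ∷ xs) with P? x
... | yes _ = cong suc (length-filter P? xs)
... | no _  = length-filter P? xs

∑-unique : {n : ℕ} (a : Fin n) {xs : List (Fin n)} → Unique xs → ∑[ b ∈ xs ] ⟦ b ≟ a ⟧ ≤ 1
∑-unique a []       = z≤n
∑-unique a {x ∷ xs} (px ∷ u) with x ≟ a
... | no _     = ∑-unique a u
... | yes refl = s≤s (≤-trans (∑-mono-∈ xs (λ {y} y∈ → ≤-reflexive (⟦⟧-no (y ≟ a) (λ y≡a → All.lookup px y∈ (sym y≡a)))))
                              (≤-reflexive (∑-zero xs)))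

module _ {A : Set} where

  Unique⇒lookup-injective : {xs : List A} → Unique xs →
    ∀ i j → L.lookup xs i ≡ L.lookup xs j → i ≡ j
  Unique⇒lookup-injective (px ∷ u) zero    zero    eq = refl
  Unique⇒lookup-injective (px ∷ u) zero    (suc j) eq = contradiction eq (All.lookup px (∈-lookup j))
  Unique⇒lookup-injective (px ∷ u) (suc i) zero    eq = contradiction (sym eq) (All.lookup px (∈-lookup i))
  Unique⇒lookup-injective (px ∷ u) (suc i) (suc j) eq = cong suc (Unique⇒lookup-injective u i j eq)

  Unique⇒length≤ : {xs ys : List A} → Unique xs → (∀ {x} → x ∈ xs → x ∈ ys) → length xs ≤ length ys
  Unique⇒length≤ {xs} {ys} u sub = injective⇒≤ {f = pos} pos-injective
    where
    pos : Fin (length xs) → Fin (length ys)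
    pos i = Any.index (sub (∈-lookup i))
    pos-lookup : ∀ i → L.lookup xs i ≡ L.lookup ys (pos i)
    pos-lookup i = AnyP.lookup-index (sub (∈-lookup i))
    pos-injective : ∀ {i j} → pos i ≡ pos j → i ≡ j
    pos-injective {i} {j} eq = Unique⇒lookup-injective u i j
      (trans (pos-lookup i) (trans (cong (L.lookup ys) eq) (sym (pos-lookup j))))

∑-vecsOf-suc : (n : ℕ) (xs : List A) (f : Vec A (suc n) → ℕ) →
  ∑ (vecsOf (suc n) xs) f ≡ ∑[ x ∈ xs ] ∑[ v ∈ vecsOf n xs ] f (x ∷ v)
∑-vecsOf-suc n xs f = ∑-cartesian _∷_ xs (vecsOf n xs) f

length-vecsOf : (n : ℕ) (xs : List A) → length (vecsOf n xs) ≡ length xs ^ n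
length-vecsOf zero    xs = refl
length-vecsOf (suc n) xs = trans (length-cartesianProductWith _∷_ xs (vecsOf n xs)) (cong (length xs *_) (length-vecsOf n xs))

length-allFin : (n : ℕ) → length (allFin n) ≡ n
length-allFin n = LP.length-tabulate id

-- Uniform random words

Matches : {r : ℕ} → (Idx → Fin r) → List (Idx × Fin r) → Set
Matches f = All (λ p → f (proj₁ p) ≡ proj₂ p)

matches? : {r : ℕ} (f : Idx → Fin r) (ps : List (Idx × Fin r)) → Dec (Matches f ps)
matches? f = All.all? (λ p → f (proj₁ p) ≟ proj₂ p)

matches-cong : {r : ℕ} {f f′ : Idx → Fin r} → (∀ x → f x ≡ f′ x) →
  ∀ ps → ⟦ matches? f ps ⟧ ≡ ⟦ matches? f′ ps ⟧
matches-cong {f = f} {f′} eq ps = ⟦⟧-cong (matches? f ps) (matches? f′ ps)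
  (All.map (λ {p} e → trans (sym (eq (proj₁ p))) e)) (All.map (λ {p} e → trans (eq (proj₁ p)) e))

tuples : List A → ℕ → List (List A)
tuples xs zero    = [] ∷ []
tuples xs (suc n) = cartesianProductWith _∷_ xs (tuples xs n)

length-tuples : (xs : List A) (n : ℕ) → length (tuples xs n) ≡ length xs ^ n
length-tuples xs zero    = refl
length-tuples xs (suc n) = trans (length-cartesianProductWith _∷_ xs (tuples xs n)) (cong (length xs *_) (length-tuples xs n))

∈-tuples⁺ : {xs ys : List A} → All (_∈ xs) ys → ys ∈ tuples xs (length ys)
∈-tuples⁺ []       = here refl
∈-tuples⁺ (p ∷ ps) = ∈-cartesianProductWith⁺ _∷_ p (∈-tuples⁺ ps)

∈-tuples-length : (xs : List A) (n : ℕ) {ys : List A} → ys ∈ tuples xs n → length ys ≡ n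
∈-tuples-length xs zero    (here refl) = refl
∈-tuples-length xs (suc n) p with ∈-cartesianProductWith⁻ _∷_ xs (tuples xs n) p
... | _ , _ , _ , q , refl = cong suc (∈-tuples-length xs n q)

words : (r n : ℕ) → List (List (Fin r))
words r = tuples (allFin r)

∑-words-suc : (r n : ℕ) (f : List (Fin r) → ℕ) →
  ∑ (words r (suc n)) f ≡ ∑[ w ∈ allFin r ] ∑[ ws ∈ words r n ] f (w ∷ ws)
∑-words-suc r n f = ∑-cartesian _∷_ (allFin r) (words r n) f

map-∈-words : {r : ℕ} (f : Idx → Fin r) (zs : List Idx) → L.map f zs ∈ words r (length zs)
map-∈-words f []       = here refl
map-∈-words f (z ∷ zs) = ∈-cartesianProductWith⁺ _∷_ (∈-allFin (f z)) (map-∈-words f zs)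

map-proj₁-zip : (zs : List A) (ws : List B) → length ws ≡ length zs → L.map proj₁ (zip zs ws) ≡ zs
map-proj₁-zip []       []       eq = refl
map-proj₁-zip (z ∷ zs) (w ∷ ws) eq = cong (z ∷_) (map-proj₁-zip zs ws (cong Data.Nat.pred eq))

matches-zip-map : {r : ℕ} (f : Idx → Fin r) (zs : List Idx) → Matches f (zip zs (L.map f zs))
matches-zip-map f []       = []
matches-zip-map f (z ∷ zs) = refl ∷ matches-zip-map f zs

-- Pr(X agrees with ps) ≤ r^-|ps|, cross-multiplied. As an inequality it survives estimates that
-- over-count, and an upper bound is what a union bound asks for.
UniformAt : {r : ℕ} → List A → (A → Idx → Fin r) → List (Idx × Fin r) → Set
UniformAt {r = r} Ω X ps = (∑[ ω ∈ Ω ] ⟦ matches? (X ω) ps ⟧) * r ^ length ps ≤ length Ω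

-- Sort Ω by the word of values that X takes on zs: each word is hit with probability at most
-- r^-|zs|. Questions about random hash values thereby become questions about counting words.
∑-uniform : {r : ℕ} (Ω : List A) (X : A → Idx → Fin r) (zs : List Idx) →
  (∀ ps → L.map proj₁ ps ≡ zs → UniformAt Ω X ps) → (ψ : List (Fin r) → ℕ) →
  (∑[ ω ∈ Ω ] ψ (L.map (X ω) zs)) * r ^ length zs ≤ length Ω * ∑ (words r (length zs)) ψ
∑-uniform {r = r} Ω X zs unif ψ = begin
  (∑[ ω ∈ Ω ] ψ (L.map (X ω) zs)) * r ^ t
    ≤⟨ *-monoˡ-≤ (r ^ t) (∑-mono Ω below) ⟩
  (∑[ ω ∈ Ω ] ∑[ ws ∈ W ] ψ ws * I ω ws) * r ^ t
    ≡⟨ cong (_* r ^ t) (∑-swap Ω W _) ⟩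
  (∑[ ws ∈ W ] ∑[ ω ∈ Ω ] ψ ws * I ω ws) * r ^ t
    ≡⟨ ∑-*ʳ W _ (r ^ t) ⟩
  (∑[ ws ∈ W ] (∑[ ω ∈ Ω ] ψ ws * I ω ws) * r ^ t)
    ≤⟨ ∑-mono-∈ W term ⟩
  (∑[ ws ∈ W ] length Ω * ψ ws)
    ≡⟨ sym (∑-*ˡ W ψ (length Ω)) ⟩
  length Ω * ∑ W ψ ∎
  where
  open ≤-Reasoning
  t = length zs
  W = words r t
  I : _ → List (Fin r) → ℕ
  I ω ws = ⟦ matches? (X ω) (zip zs ws) ⟧
  below : ∀ ω → ψ (L.map (X ω) zs) ≤ ∑[ ws ∈ W ] ψ ws * I ω ws
  below ω = begin
    ψ (L.map (X ω) zs)                          ≡⟨ sym (*-identityʳ _) ⟩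
    ψ (L.map (X ω) zs) * 1
      ≡⟨ cong (ψ (L.map (X ω) zs) *_) (sym (⟦⟧-yes (matches? (X ω) _) (matches-zip-map (X ω) zs))) ⟩
    ψ (L.map (X ω) zs) * I ω (L.map (X ω) zs)   ≤⟨ ∑-∈ (λ ws → ψ ws * I ω ws) (map-∈-words (X ω) zs) ⟩
    (∑[ ws ∈ W ] ψ ws * I ω ws) ∎
  term : ∀ {ws} → ws ∈ W → (∑[ ω ∈ Ω ] ψ ws * I ω ws) * r ^ t ≤ length Ω * ψ ws
  term {ws} ws∈ = begin
    (∑[ ω ∈ Ω ] ψ ws * I ω ws) * r ^ t    ≡⟨ cong (_* r ^ t) (sym (∑-*ˡ Ω (λ ω → I ω ws) (ψ ws))) ⟩
    ψ ws * (∑[ ω ∈ Ω ] I ω ws) * r ^ t    ≡⟨ *-assoc (ψ ws) _ _ ⟩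
    ψ ws * ((∑[ ω ∈ Ω ] I ω ws) * r ^ t)  ≡⟨ cong (λ e → ψ ws * ((∑[ ω ∈ Ω ] I ω ws) * r ^ e)) len ⟩
    ψ ws * ((∑[ ω ∈ Ω ] I ω ws) * r ^ length (zip zs ws)) ≤⟨ *-monoʳ-≤ (ψ ws) (unif (zip zs ws) keys) ⟩
    ψ ws * length Ω                       ≡⟨ *-comm (ψ ws) (length Ω) ⟩
    length Ω * ψ ws ∎
    where
    keys : L.map proj₁ (zip zs ws) ≡ zs
    keys = map-proj₁-zip zs ws (∈-tuples-length (allFin r) t ws∈)
    len : t ≡ length (zip zs ws)
    len = trans (cong length (sym keys)) (LP.length-map proj₁ (zip zs ws))

-- Limited independence on fewer keys than its order

Independent≤ : {u r : ℕ} → ℕ → List (HashFn u r) → Set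
Independent≤ κ F = ∀ ps → Unique (L.map proj₁ ps) → length ps ≤ κ → UniformAt F apply ps

private
  lookup-proj₁-∈ : (ps : List (A × B)) (i : Fin (length ps)) →
    lookup (Vec.map proj₁ (fromList ps)) i ∈ L.map proj₁ ps
  lookup-proj₁-∈ (p ∷ ps) zero    = here refl
  lookup-proj₁-∈ (p ∷ ps) (suc i) = there (lookup-proj₁-∈ ps i)

  lookup-proj₁-injective : (ps : List (A × B)) → Unique (L.map proj₁ ps) → ∀ i j →
    lookup (Vec.map proj₁ (fromList ps)) i ≡ lookup (Vec.map proj₁ (fromList ps)) j → i ≡ j
  lookup-proj₁-injective (p ∷ ps) (_ ∷ _)  zero    zero    eq = refl
  lookup-proj₁-injective (p ∷ ps) (px ∷ _) zero    (suc j) eq = contradiction eq (All.lookup px (lookup-proj₁-∈ ps j))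
  lookup-proj₁-injective (p ∷ ps) (px ∷ _) (suc i) zero    eq = contradiction (sym eq) (All.lookup px (lookup-proj₁-∈ ps i))
  lookup-proj₁-injective (p ∷ ps) (_ ∷ u)  (suc i) (suc j) eq = cong suc (lookup-proj₁-injective ps u i j eq)

  matches⇒map≡ : {u r : ℕ} (h : HashFn u r) (ps : List (Fin u × Fin r)) → Matches (apply h) ps →
    Vec.map (apply h) (Vec.map proj₁ (fromList ps)) ≡ Vec.map proj₂ (fromList ps)
  matches⇒map≡ h []       []       = refl
  matches⇒map≡ h (p ∷ ps) (e ∷ es) = cong₂ _∷_ e (matches⇒map≡ h ps es)

fresh-element : {u : ℕ} {S zs : List (Fin u)} → Unique S → length zs < length S → ∃[ y ] y ∉ zs
fresh-element {S = S} {zs} uS lt with Any.any? (λ y → ¬? (DecMem._∈?_ _≟_ y zs)) S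
... | yes p = Any.satisfied p
... | no ¬p = contradiction
  (Unique⇒length≤ uS (λ {x} x∈ →
    decidable-stable (DecMem._∈?_ _≟_ x zs) (All.lookup (AllP.¬Any⇒All¬ S ¬p) x∈)))
  (<⇒≱ lt)

-- A pattern on too few keys is the union of its r extensions by a fresh key, so the bound descends
-- from κ keys. S supplies the fresh keys; in a universe with fewer than κ elements
-- `KWiseIndependent` would hold vacuously.
independent≤ : {u r : ℕ} .{{_ : NonZero r}} (κ : ℕ) (F : List (HashFn u r)) → KWiseIndependent κ F →
  {S : List (Fin u)} → Unique S → κ ≤ length S → Independent≤ κ F
independent≤ {u} {r} κ F kw {S} uS κ≤ ps ups ps≤ = go (κ ∸ length ps) ps ups (m∸n+n≡m ps≤)
  where
  open ≤-Reasoning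
  full : ∀ ps → Unique (L.map proj₁ ps) → length ps ≡ κ → UniformAt F apply ps
  full ps ups refl = begin
    (∑[ h ∈ F ] ⟦ matches? (apply h) ps ⟧) * r ^ length ps
      ≤⟨ *-monoˡ-≤ (r ^ length ps) (∑-mono F (λ h → ⟦⟧-mono (matches? (apply h) ps) (agree? h) (matches⇒map≡ h ps))) ⟩
    (∑[ h ∈ F ] ⟦ agree? h ⟧) * r ^ length ps
      ≡⟨ cong (_* r ^ length ps) (sym (length-filter agree? F)) ⟩
    length (filter agree? F) * r ^ length ps
      ≡⟨ kw (Vec.map proj₁ (fromList ps)) (lookup-proj₁-injective ps ups) (Vec.map proj₂ (fromList ps)) ⟩
    length F ∎
    where
    agree? : ∀ h → Dec (Vec.map (apply h) (Vec.map proj₁ (fromList ps)) ≡ Vec.map proj₂ (fromList ps))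
    agree? h = VecP.≡-dec _≟_ _ _
  go : ∀ d ps → Unique (L.map proj₁ ps) → d + length ps ≡ κ → UniformAt F apply ps
  go zero    ps ups eq = full ps ups eq
  go (suc d) ps ups eq with fresh-element {zs = L.map proj₁ ps} uS
    (begin-strict
      length (L.map proj₁ ps) ≡⟨ LP.length-map proj₁ ps ⟩
      length ps               ≤⟨ m≤n+m (length ps) d ⟩
      d + length ps           <⟨ n<1+n _ ⟩
      suc d + length ps       ≡⟨ eq ⟩
      κ                       ≤⟨ κ≤ ⟩
      length S ∎)
  ... | y , y∉ = *-cancelˡ-≤ r (begin
    r * ((∑[ h ∈ F ] M h) * r ^ length ps)
      ≡⟨ rearrange r (∑ F M) (r ^ length ps) ⟩
    (∑[ h ∈ F ] M h) * r ^ suc (length ps)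
      ≤⟨ *-monoˡ-≤ (r ^ suc (length ps)) (∑-mono F extend) ⟩
    (∑[ h ∈ F ] ∑[ b ∈ allFin r ] M′ h b) * r ^ suc (length ps)
      ≡⟨ cong (_* r ^ suc (length ps)) (∑-swap F (allFin r) M′) ⟩
    (∑[ b ∈ allFin r ] ∑[ h ∈ F ] M′ h b) * r ^ suc (length ps)
      ≡⟨ ∑-*ʳ (allFin r) _ _ ⟩
    (∑[ b ∈ allFin r ] (∑[ h ∈ F ] M′ h b) * r ^ suc (length ps))
      ≤⟨ ∑-≤-const (allFin r) (λ b → go d ((y , b) ∷ ps) (AllP.¬Any⇒All¬ _ y∉ ∷ ups) (trans (+-suc d _) eq)) ⟩
    length (allFin r) * length F
      ≡⟨ cong (_* length F) (length-allFin r) ⟩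
    r * length F ∎)
    where
    M : HashFn u r → ℕ
    M h = ⟦ matches? (apply h) ps ⟧
    M′ : HashFn u r → Fin r → ℕ
    M′ h b = ⟦ matches? (apply h) ((y , b) ∷ ps) ⟧
    extend : ∀ h → M h ≤ ∑[ b ∈ allFin r ] M′ h b
    extend h = ≤-trans (⟦⟧-mono (matches? (apply h) ps) (matches? (apply h) ((y , apply h y) ∷ ps)) (refl ∷_))
                       (∑-∈ (M′ h) (∈-allFin (apply h y)))
    rearrange : ∀ a b c → a * (b * c) ≡ b * (a * c)
    rearrange = solve-∀

-- R stands for an equation on coordinate p with at most one solution and Q for an event that does
-- not see this coordinate. The two are independent, so imposing R costs a factor 1 / |xs|.
∑-coordinate : (xs : List A) {n : ℕ} (p : Fin n) (R : A → ℕ) (Q : Vec A n → ℕ) → ∑ xs R ≤ 1 →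
  (∀ z z′ → (∀ i → i ≢ p → lookup z i ≡ lookup z′ i) → Q z ≡ Q z′) →
  (∑[ z ∈ vecsOf n xs ] R (lookup z p) * Q z) * length xs ≤ ∑ (vecsOf n xs) Q
∑-coordinate xs {suc n} zero R Q R≤1 inv = begin
  (∑[ z ∈ vecsOf (suc n) xs ] R (lookup z zero) * Q z) * length xs
    ≡⟨ cong (_* length xs) (∑-vecsOf-suc n xs _) ⟩
  (∑[ a ∈ xs ] ∑[ v ∈ vecsOf n xs ] R a * Q (a ∷ v)) * length xs
    ≡⟨ *-comm _ (length xs) ⟩
  length xs * (∑[ a ∈ xs ] ∑[ v ∈ vecsOf n xs ] R a * Q (a ∷ v))
    -- The factor |xs| is spent on a second value b, which replaces a inside Q; R is then summed on
    -- its own.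
    ≡⟨ sym (∑-const xs _) ⟩
  (∑[ b ∈ xs ] ∑[ a ∈ xs ] ∑[ v ∈ vecsOf n xs ] R a * Q (a ∷ v))
    ≡⟨ ∑-cong xs (λ b → ∑-cong xs (λ a → trans (∑-cong (vecsOf n xs) (λ v → cong (R a *_) (change a b v)))
                                                (sym (∑-*ˡ (vecsOf n xs) (λ v → Q (b ∷ v)) (R a))))) ⟩
  (∑[ b ∈ xs ] ∑[ a ∈ xs ] R a * (∑[ v ∈ vecsOf n xs ] Q (b ∷ v)))
    ≡⟨ ∑-cong xs (λ b → sym (∑-*ʳ xs R _)) ⟩
  (∑[ b ∈ xs ] ∑ xs R * (∑[ v ∈ vecsOf n xs ] Q (b ∷ v)))
    ≤⟨ ∑-mono xs (λ b → *-monoˡ-≤ _ R≤1) ⟩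
  (∑[ b ∈ xs ] 1 * (∑[ v ∈ vecsOf n xs ] Q (b ∷ v)))
    ≡⟨ ∑-cong xs (λ b → *-identityˡ _) ⟩
  (∑[ b ∈ xs ] ∑[ v ∈ vecsOf n xs ] Q (b ∷ v))
    ≡⟨ sym (∑-vecsOf-suc n xs Q) ⟩
  ∑ (vecsOf (suc n) xs) Q ∎
  where
  open ≤-Reasoning
  change : ∀ a b v → Q (a ∷ v) ≡ Q (b ∷ v)
  change a b v = inv (a ∷ v) (b ∷ v) λ { zero 0≢0 → contradiction refl 0≢0 ; (suc i) _ → refl }
∑-coordinate xs {suc n} (suc p) R Q R≤1 inv = begin
  (∑[ z ∈ vecsOf (suc n) xs ] R (lookup z (suc p)) * Q z) * length xs
    ≡⟨ cong (_* length xs) (∑-vecsOf-suc n xs _) ⟩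
  (∑[ a ∈ xs ] ∑[ v ∈ vecsOf n xs ] R (lookup v p) * Q (a ∷ v)) * length xs
    ≡⟨ ∑-*ʳ xs _ (length xs) ⟩
  (∑[ a ∈ xs ] (∑[ v ∈ vecsOf n xs ] R (lookup v p) * Q (a ∷ v)) * length xs)
    ≤⟨ ∑-mono xs (λ a → ∑-coordinate xs p R (λ v → Q (a ∷ v)) R≤1 (λ v v′ same →
         inv (a ∷ v) (a ∷ v′) λ { zero _ → refl ; (suc i) i≢ → same i (i≢ ∘ cong suc) })) ⟩
  (∑[ a ∈ xs ] ∑[ v ∈ vecsOf n xs ] Q (a ∷ v))
    ≡⟨ sym (∑-vecsOf-suc n xs Q) ⟩
  ∑ (vecsOf (suc n) xs) Q ∎
  where open ≤-Reasoning

-- Subtraction of A modulo m, with `m ∸ A % m` added so that nothing is truncated. It solves a hash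
-- equation for one random summand.
unshift : {m : ℕ} .{{_ : NonZero m}} → ℕ → Fin m → Fin m
unshift {m} A w = (toℕ w + (m ∸ A % m)) mod m

toℕ-mod : (a m : ℕ) .{{_ : NonZero m}} → toℕ (a mod m) ≡ a % m
toℕ-mod a m = toℕ-fromℕ< (m%n<n a m)

unshift-correct : {m : ℕ} .{{_ : NonZero m}} (a : Fin m) (A : ℕ) (w : Fin m) →
  (toℕ a + A) mod m ≡ w → a ≡ unshift A w
unshift-correct {m} a A .((toℕ a + A) mod m) refl = toℕ-injective (sym (begin
  toℕ (unshift A ((toℕ a + A) mod m))
    ≡⟨ toℕ-mod _ m ⟩
  (toℕ ((toℕ a + A) mod m) + (m ∸ A % m)) % m
    ≡⟨ cong (λ e → (e + (m ∸ A % m)) % m) (toℕ-mod (toℕ a + A) m) ⟩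
  ((toℕ a + A) % m + (m ∸ A % m)) % m
    ≡⟨ %-distribˡ-+ ((toℕ a + A) % m) (m ∸ A % m) m ⟩
  ((toℕ a + A) % m % m + (m ∸ A % m) % m) % m
    ≡⟨ cong (λ e → (e + (m ∸ A % m) % m) % m) (m%n%n≡m%n (toℕ a + A) m) ⟩
  ((toℕ a + A) % m + (m ∸ A % m) % m) % m
    ≡⟨ sym (%-distribˡ-+ (toℕ a + A) (m ∸ A % m) m) ⟩
  (toℕ a + A + (m ∸ A % m)) % m
    ≡⟨ cong (λ e → (toℕ a + e + (m ∸ A % m)) % m) (m≡m%n+[m/n]*n A m) ⟩
  (toℕ a + (A % m + A ℕ/ m * m) + (m ∸ A % m)) % m
    ≡⟨ cong (_% m) (regroup (toℕ a) (A % m) (A ℕ/ m * m) (m ∸ A % m)) ⟩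
  (toℕ a + ((A % m + (m ∸ A % m)) + A ℕ/ m * m)) % m
    ≡⟨ cong (λ e → (toℕ a + (e + A ℕ/ m * m)) % m) (m+[n∸m]≡n (m%n≤n A m)) ⟩
  (toℕ a + suc (A ℕ/ m) * m) % m
    ≡⟨ [m+kn]%n≡m%n (toℕ a) (suc (A ℕ/ m)) m ⟩
  toℕ a % m
    ≡⟨ m<n⇒m%n≡m (toℕ<n a) ⟩
  toℕ a ∎))
  where
  open ≡-Reasoning
  regroup : ∀ a b c d → a + (b + c) + d ≡ a + ((b + d) + c)
  regroup = solve-∀

-- Collisions

collides? : {ℓ : ℕ} (g : A → Fin ℓ) (x : A) (xs : List A) → Dec (Any (λ y → g x ≡ g y) xs)
collides? g x = Any.any? (λ y → g x ≟ g y)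

-- Equals |xs| - |g(xs)|: in each fibre of g every key but the last is counted. Hence one more key
-- adds at most one.
collisions : {ℓ : ℕ} → (A → Fin ℓ) → List A → ℕ
collisions g []       = 0
collisions g (x ∷ xs) = ⟦ collides? g x xs ⟧ + collisions g xs

collisions-map : {ℓ : ℕ} (g : B → Fin ℓ) (h : A → B) (xs : List A) →
  collisions g (L.map h xs) ≡ collisions (g ∘ h) xs
collisions-map g h []       = refl
collisions-map g h (x ∷ xs) = cong₂ _+_
  (⟦⟧-cong (collides? g (h x) (L.map h xs)) (collides? (g ∘ h) x xs) AnyP.map⁻ AnyP.map⁺)
  (collisions-map g h xs)

AllPairs-resp-↭ : {R : Rel A 0ℓ} → Symmetric R → {xs ys : List A} → xs ↭ ys → AllPairs R xs → AllPairs R ys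
AllPairs-resp-↭ {A = A} {R} R-sym p =
  PermS.AllPairs-resp-↭ (setoid A) R-sym ((λ { refl → id }) , (λ { refl → id })) (↭⇒↭ₛ p)

AllPairs-++⁻ʳ : {R : Rel A 0ℓ} (xs : List A) {ys : List A} → AllPairs R (xs ++ ys) → AllPairs R ys
AllPairs-++⁻ʳ []       p       = p
AllPairs-++⁻ʳ (x ∷ xs) (_ ∷ p) = AllPairs-++⁻ʳ xs p

-- A fibre of size f ≥ 2 holds f ≤ 2 (f - 1) keys and accounts for f - 1 collisions. Inductively, a
-- colliding key x pulls at most one partner y out of the isolated keys, two places for one
-- collision.
isolate : {ℓ : ℕ} (g : A → Fin ℓ) (xs : List A) → ∃[ us ] ∃[ cs ]
  xs ↭ us ++ cs × AllPairs (λ x y → g x ≢ g y) us × All (λ x → All (λ y → g x ≢ g y) cs) us ×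
  length cs ≤ 2 * collisions g xs
isolate g []       = [] , [] , ↭-refl , [] , [] , z≤n
isolate g (x ∷ xs) with isolate g xs | collides? g x xs
... | us , cs , perm , pu , puc , len | no ¬c =
  x ∷ us , cs , prep x perm , AllP.++⁻ˡ us x∉ ∷ pu , AllP.++⁻ʳ us x∉ ∷ puc , len
  where x∉ = All-resp-↭ perm (AllP.¬Any⇒All¬ xs ¬c)
... | us , cs , perm , pu , puc , len | yes _ with collides? g x us
...   | no ¬c = us , x ∷ cs , ↭-trans (prep x perm) (↭-sym (shift x us cs)) , pu ,
  All.zipWith (λ { (x≢ , rest) → (x≢ ∘ sym) ∷ rest }) (AllP.¬Any⇒All¬ us ¬c , puc) ,
  ≤-trans (s≤s len) (≤-trans (n≤1+n _) (≤-reflexive (sym (*-suc 2 (collisions g xs)))))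
...   | yes c with find c
...     | y , y∈ , gx≡gy with ∈-∃++ y∈
...       | as , bs , refl with AllPairs-resp-↭ (λ ne → ne ∘ sym) (shift y as bs) pu
                                | All-resp-↭ (shift y as bs) puc
...         | y≢ ∷ pu′ | _ ∷ puc′ = as ++ bs , x ∷ y ∷ cs , perm′ , pu′ ,
  All.zipWith (λ { (y≢t , rest) → (λ t≡x → y≢t (sym (trans t≡x gx≡gy))) ∷ (y≢t ∘ sym) ∷ rest }) (y≢ , puc′) ,
  ≤-trans (s≤s (s≤s len)) (≤-reflexive (sym (*-suc 2 (collisions g xs))))
  where
  perm′ : x ∷ xs ↭ (as ++ bs) ++ (x ∷ y ∷ cs)
  perm′ = ↭-trans (prep x (↭-trans perm (++⁺ʳ cs (shift y as bs)))) (shifts (x ∷ y ∷ []) (as ++ bs))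

-- Uniform hash values on keys with few collisions

module _ {u m ℓ : ℕ} .{{_ : NonZero m}} where

  tables : List (Vec (Fin m) ℓ)
  tables = vecsOf ℓ (allFin m)

  -- One table seen in isolation; `b` gathers all other summands of the hash value.
  tableHash : (Fin u → ℕ) → (Fin u → Fin ℓ) → Vec (Fin m) ℓ → Fin u → Fin m
  tableHash b g z x = (toℕ (lookup z (g x)) + b x) mod m

  -- The keys of `us` read pairwise different entries of z, and `cs` reads none of these. Each
  -- equation on `us` thus fixes an entry of its own and costs 1 / m.
  ∑-tables-isolated : (b : Fin u → ℕ) (g : Fin u → Fin ℓ) (us cs : List (Fin u × Fin m)) →
    AllPairs (λ p q → g (proj₁ p) ≢ g (proj₁ q)) us →
    All (λ p → All (λ q → g (proj₁ p) ≢ g (proj₁ q)) cs) us →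
    (∑[ z ∈ tables ] ⟦ matches? (tableHash b g z) (us ++ cs) ⟧) * m ^ length us
      ≤ ∑[ z ∈ tables ] ⟦ matches? (tableHash b g z) cs ⟧
  ∑-tables-isolated b g []             cs pu puc = ≤-reflexive (*-identityʳ _)
  ∑-tables-isolated b g ((x , w) ∷ us) cs (px ∷ pu) (pxc ∷ puc) = begin
    (∑[ z ∈ tables ] ⟦ matches? (tableHash b g z) ((x , w) ∷ us ++ cs) ⟧) * (m * m ^ length us)
      ≡⟨ sym (*-assoc (∑[ z ∈ tables ] ⟦ matches? (tableHash b g z) ((x , w) ∷ us ++ cs) ⟧) m (m ^ length us)) ⟩
    (∑[ z ∈ tables ] ⟦ matches? (tableHash b g z) ((x , w) ∷ us ++ cs) ⟧) * m * m ^ length us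
      ≤⟨ *-monoˡ-≤ (m ^ length us) (*-monoˡ-≤ m (∑-mono tables bound)) ⟩
    (∑[ z ∈ tables ] R (lookup z (g x)) * Q z) * m * m ^ length us
      ≡⟨ cong (λ e → (∑[ z ∈ tables ] R (lookup z (g x)) * Q z) * e * m ^ length us) (sym (length-allFin m)) ⟩
    (∑[ z ∈ tables ] R (lookup z (g x)) * Q z) * length (allFin m) * m ^ length us
      ≤⟨ *-monoˡ-≤ (m ^ length us) (∑-coordinate (allFin m) (g x) R Q (∑-unique (unshift (b x) w) (allFin⁺ m)) inv) ⟩
    ∑ tables Q * m ^ length us
      ≤⟨ ∑-tables-isolated b g us cs pu puc ⟩
    (∑[ z ∈ tables ] ⟦ matches? (tableHash b g z) cs ⟧) ∎
    where
    open ≤-Reasoning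
    R : Fin m → ℕ
    R a = ⟦ a ≟ unshift (b x) w ⟧
    Q : Vec (Fin m) ℓ → ℕ
    Q z = ⟦ matches? (tableHash b g z) (us ++ cs) ⟧
    bound : ∀ z → ⟦ matches? (tableHash b g z) ((x , w) ∷ us ++ cs) ⟧ ≤ R (lookup z (g x)) * Q z
    bound z = ≤-trans
      (⟦⟧-mono (matches? (tableHash b g z) ((x , w) ∷ us ++ cs))
               ((lookup z (g x) ≟ unshift (b x) w) ×-dec matches? (tableHash b g z) (us ++ cs))
               λ { (e ∷ es) → unshift-correct (lookup z (g x)) (b x) w e , es })
      (≤-reflexive (⟦⟧-× (lookup z (g x) ≟ unshift (b x) w) (matches? (tableHash b g z) (us ++ cs))))
    avoid : All (λ p → g (proj₁ p) ≢ g x) (us ++ cs)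
    avoid = AllP.++⁺ (All.map (_∘ sym) px) (All.map (_∘ sym) pxc)
    transfer : ∀ z z′ → (∀ i → i ≢ g x → lookup z i ≡ lookup z′ i) → ∀ {ps} → All (λ p → g (proj₁ p) ≢ g x) ps →
      Matches (tableHash b g z) ps → Matches (tableHash b g z′) ps
    transfer z z′ same []       []       = []
    transfer z z′ same {p ∷ _} (n ∷ ns) (e ∷ es) =
      trans (cong (λ v → (toℕ v + b (proj₁ p)) mod m) (sym (same (g (proj₁ p)) n))) e ∷ transfer z z′ same ns es
    inv : ∀ z z′ → (∀ i → i ≢ g x → lookup z i ≡ lookup z′ i) → Q z ≡ Q z′
    inv z z′ same = ⟦⟧-cong (matches? (tableHash b g z) (us ++ cs)) (matches? (tableHash b g z′) (us ++ cs))
      (transfer z z′ same avoid) (transfer z′ z (λ i i≢ → sym (same i i≢)) avoid)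

  module _ (κ : ℕ) (F : List (HashFn u m)) (ind : Independent≤ κ F) where

    -- Two sources of randomness are used in turn: z for the isolated keys while f is fixed, then f
    -- for the colliding keys while z is fixed. There are at most κ of the latter, within the
    -- independence of F.
    ∑-tables-uniform : (a : Fin u → ℕ) (g : Fin u → Fin ℓ) (ps : List (Fin u × Fin m)) →
      Unique (L.map proj₁ ps) → 2 * collisions g (L.map proj₁ ps) ≤ κ →
      (∑[ f ∈ F ] ∑[ z ∈ tables ] ⟦ matches? (tableHash (λ x → toℕ (apply f x) + a x) g z) ps ⟧) * m ^ length ps
        ≤ length F * length tables
    ∑-tables-uniform a g ps ups few with isolate (g ∘ proj₁) ps
    ... | us , cs , perm , pu , puc , len = begin
      (∑[ f ∈ F ] ∑[ z ∈ tables ] M f z ps) * m ^ length ps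
        ≡⟨ cong₂ _*_ (∑-cong F (λ f → ∑-cong tables (λ z → M-perm f z)))
                     (trans (cong (m ^_) (trans (↭-length perm) (LP.length-++ us))) (^-distribˡ-+-* m (length us) (length cs))) ⟩
      (∑[ f ∈ F ] ∑[ z ∈ tables ] M f z (us ++ cs)) * (m ^ length us * m ^ length cs)
        ≡⟨ sym (*-assoc (∑[ f ∈ F ] ∑[ z ∈ tables ] M f z (us ++ cs)) (m ^ length us) (m ^ length cs)) ⟩
      (∑[ f ∈ F ] ∑[ z ∈ tables ] M f z (us ++ cs)) * m ^ length us * m ^ length cs
        ≡⟨ cong (_* m ^ length cs) (∑-*ʳ F _ (m ^ length us)) ⟩
      (∑[ f ∈ F ] (∑[ z ∈ tables ] M f z (us ++ cs)) * m ^ length us) * m ^ length cs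
        ≤⟨ *-monoˡ-≤ (m ^ length cs) (∑-mono F (λ f → ∑-tables-isolated (b f) g us cs pu puc)) ⟩
      (∑[ f ∈ F ] ∑[ z ∈ tables ] M f z cs) * m ^ length cs
        ≡⟨ cong (_* m ^ length cs) (∑-swap F tables (λ f z → M f z cs)) ⟩
      (∑[ z ∈ tables ] ∑[ f ∈ F ] M f z cs) * m ^ length cs
        ≡⟨ ∑-*ʳ tables _ (m ^ length cs) ⟩
      (∑[ z ∈ tables ] (∑[ f ∈ F ] M f z cs) * m ^ length cs)
        ≤⟨ ∑-≤-const tables colliding ⟩
      length tables * length F
        ≡⟨ *-comm (length tables) (length F) ⟩
      length F * length tables ∎
      where
      open ≤-Reasoning
      b : HashFn u m → Fin u → ℕ
      b f x = toℕ (apply f x) + a x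
      M : HashFn u m → Vec (Fin m) ℓ → List (Fin u × Fin m) → ℕ
      M f z qs = ⟦ matches? (tableHash (b f) g z) qs ⟧
      M-perm : ∀ f z → M f z ps ≡ M f z (us ++ cs)
      M-perm f z = ⟦⟧-cong (matches? (tableHash (b f) g z) ps) (matches? (tableHash (b f) g z) (us ++ cs))
        (All-resp-↭ perm) (All-resp-↭ (↭-sym perm))
      ucs : Unique (L.map proj₁ cs)
      ucs = AllPairsP.map⁺ (AllPairs-++⁻ʳ us (AllPairs-resp-↭ (λ ne → ne ∘ sym) perm (AllPairsP.map⁻ ups)))
      cs≤κ : length cs ≤ κ
      cs≤κ = ≤-trans len (≤-trans (*-monoʳ-≤ 2 (≤-reflexive (sym (collisions-map g proj₁ ps)))) few)
      -- For fixed z everything but `apply f x` moves to the right-hand side, which turns a pattern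
      -- of hash values into a pattern for f on the same keys.
      shiftBy : Vec (Fin m) ℓ → Fin u × Fin m → Fin u × Fin m
      shiftBy z (x , w) = x , unshift (toℕ (lookup z (g x)) + a x) w
      keys : ∀ z qs → L.map proj₁ (L.map (shiftBy z) qs) ≡ L.map proj₁ qs
      keys z qs = sym (LP.map-∘ qs)
      regroup : ∀ p q r → p + (q + r) ≡ q + (p + r)
      regroup = solve-∀
      shifted : ∀ f z qs → Matches (tableHash (b f) g z) qs → Matches (apply f) (L.map (shiftBy z) qs)
      shifted f z []             []       = []
      shifted f z ((x , w) ∷ qs) (e ∷ es) =
        unshift-correct (apply f x) (toℕ (lookup z (g x)) + a x) w
          (trans (cong (_mod m) (regroup (toℕ (apply f x)) (toℕ (lookup z (g x))) (a x))) e)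
        ∷ shifted f z qs es
      colliding : ∀ z → (∑[ f ∈ F ] M f z cs) * m ^ length cs ≤ length F
      colliding z = begin
        (∑[ f ∈ F ] M f z cs) * m ^ length cs
          ≤⟨ *-monoˡ-≤ (m ^ length cs) (∑-mono F (λ f →
               ⟦⟧-mono (matches? (tableHash (b f) g z) cs) (matches? (apply f) (L.map (shiftBy z) cs)) (shifted f z cs))) ⟩
        (∑[ f ∈ F ] ⟦ matches? (apply f) (L.map (shiftBy z) cs) ⟧) * m ^ length cs
          ≡⟨ cong (λ e → (∑[ f ∈ F ] ⟦ matches? (apply f) (L.map (shiftBy z) cs) ⟧) * m ^ e) (sym (LP.length-map (shiftBy z) cs)) ⟩
        (∑[ f ∈ F ] ⟦ matches? (apply f) (L.map (shiftBy z) cs) ⟧) * m ^ length (L.map (shiftBy z) cs)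
          ≤⟨ ind (L.map (shiftBy z) cs) (subst Unique (sym (keys z cs)) ucs)
                 (≤-trans (≤-reflexive (LP.length-map (shiftBy z) cs)) cs≤κ) ⟩
        length F ∎

    tableSum : {c : ℕ} → Vec (HashFn u ℓ) c → Vec (Vec (Fin m) ℓ) c → Fin u → ℕ
    tableSum gs zs x = sum (zipWith (λ z g → toℕ (lookup z (apply g x))) zs gs)

    offsetHash : {c : ℕ} → (Fin u → ℕ) → HashFn u m → Vec (HashFn u ℓ) c → Vec (Vec (Fin m) ℓ) c → Fin u → Fin m
    offsetHash a f gs zs x = (toℕ (apply f x) + (a x + tableSum gs zs x)) mod m

    -- Tables before the j-th are frozen one by one and absorbed by the offset `a`, which is present
    -- for this induction. At j the remaining tables are frozen too, and f with a single table does
    -- the work.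
    ∑-offsetHash-uniform : {c : ℕ} (gs : Vec (HashFn u ℓ) c) (j : Fin c) (a : Fin u → ℕ) (ps : List (Fin u × Fin m)) →
      Unique (L.map proj₁ ps) → 2 * collisions (apply (lookup gs j)) (L.map proj₁ ps) ≤ κ →
      (∑[ f ∈ F ] ∑[ zs ∈ vecsOf c tables ] ⟦ matches? (offsetHash a f gs zs) ps ⟧) * m ^ length ps
        ≤ length F * length (vecsOf c tables)
    ∑-offsetHash-uniform {suc c} (g ∷ gs) zero a ps ups few = begin
      (∑[ f ∈ F ] ∑[ zs ∈ vecsOf (suc c) tables ] ⟦ matches? (offsetHash a f (g ∷ gs) zs) ps ⟧) * m ^ length ps
        ≡⟨ cong (_* m ^ length ps) (trans (∑-cong F (λ f → trans (∑-vecsOf-suc c tables _) (∑-swap tables (vecsOf c tables) _)))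
                                          (∑-swap F (vecsOf c tables) _)) ⟩
      (∑[ zs ∈ vecsOf c tables ] ∑[ f ∈ F ] ∑[ z ∈ tables ] ⟦ matches? (offsetHash a f (g ∷ gs) (z ∷ zs)) ps ⟧) * m ^ length ps
        ≡⟨ trans (cong (_* m ^ length ps) (∑-cong (vecsOf c tables) (λ zs → ∑-cong F (λ f → ∑-cong tables (λ z →
             matches-cong (λ x → cong (_mod m) (regroup (toℕ (apply f x)) (a x) (toℕ (lookup z (apply g x))) (tableSum gs zs x))) ps)))))
             (∑-*ʳ (vecsOf c tables) _ (m ^ length ps)) ⟩
      (∑[ zs ∈ vecsOf c tables ] (∑[ f ∈ F ] ∑[ z ∈ tables ]
        ⟦ matches? (tableHash (λ x → toℕ (apply f x) + (a x + tableSum gs zs x)) (apply g) z) ps ⟧) * m ^ length ps)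
        ≤⟨ ∑-≤-const (vecsOf c tables) (λ zs → ∑-tables-uniform (λ x → a x + tableSum gs zs x) (apply g) ps ups few) ⟩
      length (vecsOf c tables) * (length F * length tables)
        ≡⟨ trans (reorder (length (vecsOf c tables)) (length F) (length tables)) (cong (length F *_) (sym (length-cartesianProductWith _∷_ tables (vecsOf c tables)))) ⟩
      length F * length (vecsOf (suc c) tables) ∎
      where
      open ≤-Reasoning
      regroup : ∀ p q r s → p + (q + (r + s)) ≡ r + (p + (q + s))
      regroup = solve-∀
      reorder : ∀ p q r → p * (q * r) ≡ q * (r * p)
      reorder = solve-∀
    ∑-offsetHash-uniform {suc c} (g ∷ gs) (suc j) a ps ups few = begin
      (∑[ f ∈ F ] ∑[ zs ∈ vecsOf (suc c) tables ] ⟦ matches? (offsetHash a f (g ∷ gs) zs) ps ⟧) * m ^ length ps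
        ≡⟨ cong (_* m ^ length ps) (trans (∑-cong F (λ f → ∑-vecsOf-suc c tables _)) (∑-swap F tables _)) ⟩
      (∑[ z ∈ tables ] ∑[ f ∈ F ] ∑[ zs ∈ vecsOf c tables ] ⟦ matches? (offsetHash a f (g ∷ gs) (z ∷ zs)) ps ⟧) * m ^ length ps
        ≡⟨ trans (cong (_* m ^ length ps) (∑-cong tables (λ z → ∑-cong F (λ f → ∑-cong (vecsOf c tables) (λ zs →
             matches-cong (λ x → cong (λ e → (toℕ (apply f x) + e) mod m)
               (sym (+-assoc (a x) (toℕ (lookup z (apply g x))) (tableSum gs zs x)))) ps)))))
             (∑-*ʳ tables _ (m ^ length ps)) ⟩
      (∑[ z ∈ tables ] (∑[ f ∈ F ] ∑[ zs ∈ vecsOf c tables ]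
        ⟦ matches? (offsetHash (λ x → a x + toℕ (lookup z (apply g x))) f gs zs) ps ⟧) * m ^ length ps)
        ≤⟨ ∑-≤-const tables (λ z → ∑-offsetHash-uniform gs j (λ x → a x + toℕ (lookup z (apply g x))) ps ups few) ⟩
      length tables * (length F * length (vecsOf c tables))
        ≡⟨ trans (reorder (length tables) (length F) (length (vecsOf c tables))) (cong (length F *_) (sym (length-cartesianProductWith _∷_ tables (vecsOf c tables)))) ⟩
      length F * length (vecsOf (suc c) tables) ∎
      where
      open ≤-Reasoning
      reorder : ∀ p q r → p * (q * r) ≡ q * (p * r)
      reorder = solve-∀

    zHash-uniform : {c : ℕ} (gs : Vec (HashFn u ℓ) c) (j : Fin c) (ps : List (Fin u × Fin m)) →
      Unique (L.map proj₁ ps) → 2 * collisions (apply (lookup gs j)) (L.map proj₁ ps) ≤ κ →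
      UniformAt (cartesianProduct F (vecsOf c tables)) (λ (f , zs) → zHash f gs zs) ps
    zHash-uniform {c} gs j ps ups few = begin
      (∑[ ω ∈ cartesianProduct F (vecsOf c tables) ] ⟦ matches? (zHash (proj₁ ω) gs (proj₂ ω)) ps ⟧) * m ^ length ps
        ≡⟨ cong (_* m ^ length ps) (∑-cartesian _,_ F (vecsOf c tables) _) ⟩
      (∑[ f ∈ F ] ∑[ zs ∈ vecsOf c tables ] ⟦ matches? (zHash f gs zs) ps ⟧) * m ^ length ps
        ≤⟨ ∑-offsetHash-uniform gs j (λ _ → 0) ps ups few ⟩
      length F * length (vecsOf c tables)
        ≡⟨ sym (length-cartesianProductWith _,_ F (vecsOf c tables)) ⟩
      length (cartesianProduct F (vecsOf c tables)) ∎
      where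
      open ≤-Reasoning

-- Probability of many collisions

collision-recursion : {r : ℕ} (k : ℕ) (w : Fin r) (ws : List (Fin r)) →
  ⟦ suc k ≤? collisions id (w ∷ ws) ⟧
    ≤ ⟦ suc k ≤? collisions id ws ⟧ + ⟦ collides? id w ws ⟧ * ⟦ k ≤? collisions id ws ⟧
collision-recursion k w ws with collides? id w ws
... | no _  = m≤m+n _ 0
... | yes _ = ≤-trans
  (⟦⟧-mono (suc k ≤? suc (collisions id ws)) (k ≤? collisions id ws) (λ { (s≤s p) → p }))
  (≤-trans (≤-reflexive (sym (*-identityˡ ⟦ k ≤? collisions id ws ⟧))) (m≤n+m _ ⟦ suc k ≤? collisions id ws ⟧))

∑-collides : {r : ℕ} (ws : List (Fin r)) → ∑[ w ∈ allFin r ] ⟦ collides? id w ws ⟧ ≤ length ws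
∑-collides {r} []       = ≤-reflexive (∑-zero (allFin r))
∑-collides {r} (y ∷ ws) = begin
  (∑[ w ∈ allFin r ] ⟦ collides? id w (y ∷ ws) ⟧)
    ≤⟨ ∑-mono (allFin r) either ⟩
  (∑[ w ∈ allFin r ] (⟦ w ≟ y ⟧ + ⟦ collides? id w ws ⟧))
    ≡⟨ ∑-+ (allFin r) _ _ ⟩
  (∑[ w ∈ allFin r ] ⟦ w ≟ y ⟧) + (∑[ w ∈ allFin r ] ⟦ collides? id w ws ⟧)
    ≤⟨ +-mono-≤ (∑-unique y (allFin⁺ r)) (∑-collides ws) ⟩
  suc (length ws) ∎
  where
  open ≤-Reasoning
  either : ∀ w → ⟦ collides? id w (y ∷ ws) ⟧ ≤ ⟦ w ≟ y ⟧ + ⟦ collides? id w ws ⟧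
  either w with w ≟ y
  ... | yes _ = ≤-trans (s≤s z≤n) (m≤m+n 1 _)
  ... | no _  = ≤-refl

-- A letter repeats one of n others with probability at most n / r, so the probability p(n,k) of k
-- collisions obeys p(n+1,k+1) ≤ p(n,k+1) + (n/r) p(n,k). The bound (n²/r)^k is preserved because n²
-- + n ≤ (n+1)².
∑-words-collisions : (r n k : ℕ) →
  (∑[ ws ∈ words r n ] ⟦ k ≤? collisions id ws ⟧) * r ^ k ≤ r ^ n * (n * n) ^ k
∑-words-collisions r n zero = ≤-reflexive (trans (*-identityʳ _) (trans (∑-1 (words r n))
  (trans (length-tuples (allFin r) n) (trans (cong (_^ n) (length-allFin r)) (sym (*-identityʳ (r ^ n)))))))
∑-words-collisions r zero    (suc k) = z≤n
∑-words-collisions r (suc n) (suc k) = begin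
  (∑[ ws ∈ words r (suc n) ] ⟦ suc k ≤? collisions id ws ⟧) * r ^ suc k
    ≡⟨ cong (_* r ^ suc k) (∑-words-suc r n _) ⟩
  (∑[ w ∈ allFin r ] ∑[ ws ∈ words r n ] ⟦ suc k ≤? collisions id (w ∷ ws) ⟧) * r ^ suc k
    ≤⟨ *-monoˡ-≤ (r ^ suc k) (∑-mono (allFin r) (λ w → ∑-mono (words r n) (collision-recursion k w))) ⟩
  (∑[ w ∈ allFin r ] ∑[ ws ∈ words r n ] (N′ ws + C w ws * N ws)) * r ^ suc k
    ≡⟨ cong (_* r ^ suc k) (trans (∑-cong (allFin r) (λ w → ∑-+ (words r n) N′ _))
         (trans (∑-+ (allFin r) _ _) (cong₂ _+_ (trans (∑-const (allFin r) _) (cong (_* ∑ (words r n) N′) (length-allFin r)))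
           (trans (∑-swap (allFin r) (words r n) _) (∑-cong (words r n) (λ ws → sym (∑-*ʳ (allFin r) (λ w → C w ws) (N ws)))))))) ⟩
  (r * ∑ (words r n) N′ + (∑[ ws ∈ words r n ] ((∑[ w ∈ allFin r ] C w ws) * N ws))) * r ^ suc k
    ≤⟨ *-monoˡ-≤ (r ^ suc k) (+-monoʳ-≤ (r * ∑ (words r n) N′) (∑-mono-∈ (words r n) (λ {ws} ws∈ →
         *-monoˡ-≤ (N ws) (≤-trans (∑-collides ws) (≤-reflexive (∈-tuples-length (allFin r) n ws∈)))))) ⟩
  (r * ∑ (words r n) N′ + (∑[ ws ∈ words r n ] n * N ws)) * r ^ suc k
    ≡⟨ cong (λ e → (r * ∑ (words r n) N′ + e) * r ^ suc k) (sym (∑-*ˡ (words r n) N n)) ⟩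
  (r * ∑ (words r n) N′ + n * ∑ (words r n) N) * (r * r ^ k)
    ≡⟨ expand r (∑ (words r n) N′) n (∑ (words r n) N) (r ^ k) ⟩
  r * (∑ (words r n) N′ * (r * r ^ k)) + n * r * (∑ (words r n) N * r ^ k)
    ≤⟨ +-mono-≤ (*-monoʳ-≤ r (∑-words-collisions r n (suc k))) (*-monoʳ-≤ (n * r) (∑-words-collisions r n k)) ⟩
  r * (r ^ n * (n * n * (n * n) ^ k)) + n * r * (r ^ n * (n * n) ^ k)
    ≡⟨ collect r (r ^ n) n ((n * n) ^ k) ⟩
  r * r ^ n * ((n * n + n) * (n * n) ^ k)
    ≤⟨ *-monoʳ-≤ (r * r ^ n) (*-mono-≤ square (^-monoˡ-≤ k (*-mono-≤ (n≤1+n n) (n≤1+n n)))) ⟩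
  r * r ^ n * (suc n * suc n * (suc n * suc n) ^ k) ∎
  where
  open ≤-Reasoning
  N N′ : List (Fin r) → ℕ
  N  ws = ⟦ k ≤? collisions id ws ⟧
  N′ ws = ⟦ suc k ≤? collisions id ws ⟧
  C : Fin r → List (Fin r) → ℕ
  C w ws = ⟦ collides? id w ws ⟧
  expand : ∀ r a n b e → (r * a + n * b) * (r * e) ≡ r * (a * (r * e)) + n * r * (b * e)
  expand = solve-∀
  collect : ∀ r e n f → r * (e * (n * n * f)) + n * r * (e * f) ≡ r * e * ((n * n + n) * f)
  collect = solve-∀
  square : n * n + n ≤ suc n * suc n
  square = ≤-trans (m≤m+n (n * n + n) (suc n)) (≤-reflexive (sq n))
    where
    sq : ∀ n → n * n + n + suc n ≡ suc n * suc n
    sq = solve-∀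

AllPairs-resp-⊆ : {R : Rel A 0ℓ} {xs ys : List A} → xs ⊆ ys → AllPairs R ys → AllPairs R xs
AllPairs-resp-⊆ []         []       = []
AllPairs-resp-⊆ (y ∷ʳ p)   (_ ∷ ps) = AllPairs-resp-⊆ p ps
AllPairs-resp-⊆ (refl ∷ p) (q ∷ ps) = All-resp-⊆ p q ∷ AllPairs-resp-⊆ p ps

sublists : ℕ → List A → List (List A)
sublists zero    _        = [] ∷ []
sublists (suc κ) []       = [] ∷ []
sublists (suc κ) (x ∷ xs) = L.map (x ∷_) (sublists κ xs) ++ sublists (suc κ) xs

length-sublists : (κ : ℕ) (xs : List A) → length (sublists κ xs) ≤ suc (length xs) ^ κ
length-sublists zero    xs       = ≤-refl
length-sublists (suc κ) []       = ≤-reflexive (sym (^-zeroˡ (suc κ)))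
length-sublists (suc κ) (x ∷ xs) = begin
  length (L.map (x ∷_) (sublists κ xs) ++ sublists (suc κ) xs)
    ≡⟨ trans (LP.length-++ (L.map (x ∷_) (sublists κ xs))) (cong (_+ _) (LP.length-map (x ∷_) (sublists κ xs))) ⟩
  length (sublists κ xs) + length (sublists (suc κ) xs)
    ≤⟨ +-mono-≤ (length-sublists κ xs) (length-sublists (suc κ) xs) ⟩
  suc (suc (length xs)) * suc (length xs) ^ κ
    ≤⟨ *-monoʳ-≤ (suc (suc (length xs))) (^-monoˡ-≤ κ (n≤1+n _)) ⟩
  suc (suc (length xs)) ^ suc κ ∎
  where open ≤-Reasoning

∈-sublists⁺ : {κ : ℕ} {xs ys : List A} → ys ⊆ xs → length ys ≤ κ → ys ∈ sublists κ xs
∈-sublists⁺ {κ = zero}  {ys = []} p l = here refl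
∈-sublists⁺ {κ = suc κ} {[]}     []         l       = here refl
∈-sublists⁺ {κ = suc κ} {x ∷ xs} (.x ∷ʳ p)  l       = ∈-++⁺ʳ (L.map (x ∷_) (sublists κ xs)) (∈-sublists⁺ p l)
∈-sublists⁺ {κ = suc κ} {x ∷ xs} (refl ∷ p) (s≤s l) = ∈-++⁺ˡ (∈-map⁺ (x ∷_) (∈-sublists⁺ p l))

∈-sublists⁻ : (κ : ℕ) (xs : List A) {ys : List A} → ys ∈ sublists κ xs → ys ⊆ xs × length ys ≤ κ
∈-sublists⁻ zero    xs       (here refl) = minimum xs , z≤n
∈-sublists⁻ (suc κ) []       (here refl) = [] , z≤n
∈-sublists⁻ (suc κ) (x ∷ xs) p with ∈-++⁻ (L.map (x ∷_) (sublists κ xs)) p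
... | inj₂ q = let s , l = ∈-sublists⁻ (suc κ) xs q in (x ∷ʳ s) , l
... | inj₁ q with ∈-map⁻ (x ∷_) q
...   | _ , q′ , refl = let s , l = ∈-sublists⁻ κ xs q′ in (refl ∷ s) , s≤s l

collisions-⊆ : {ℓ : ℕ} (g : A → Fin ℓ) {xs ys : List A} → xs ⊆ ys → collisions g xs ≤ collisions g ys
collisions-⊆ g []         = z≤n
collisions-⊆ g (y ∷ʳ p)   = ≤-trans (collisions-⊆ g p) (m≤n+m _ _)
collisions-⊆ g {x ∷ xs} {x ∷ ys} (refl ∷ p) = +-mono-≤ (⟦⟧-mono (collides? g x xs) (collides? g x ys) (Any-resp-⊆ p)) (collisions-⊆ g p)

insert-⊆ : {xs ys : List A} {y : A} → ys ⊆ xs → y ∈ xs →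
  ∃[ zs ] zs ⊆ xs × ys ⊆ zs × y ∈ zs × length zs ≤ suc (length ys)
insert-⊆ {ys = ys} (x ∷ʳ p)   (here refl) = x ∷ ys , refl ∷ p , x ∷ʳ ⊆-refl , here refl , ≤-refl
insert-⊆ {ys = ys} (refl ∷ p) (here refl) = ys , refl ∷ p , ⊆-refl , here refl , n≤1+n _
insert-⊆ (x ∷ʳ p)   (there y∈) =
  let zs , s , t , q , l = insert-⊆ p y∈ in zs , x ∷ʳ s , t , q , l
insert-⊆ {xs = x ∷ _} (refl ∷ p) (there y∈) =
  let zs , s , t , q , l = insert-⊆ p y∈ in x ∷ zs , refl ∷ s , refl ∷ t , there q , s≤s l

-- Keep k colliding keys and one partner for each. The resulting 2 k keys are as many as the
-- independence of the g_j can handle.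
colliding-sublist : {ℓ : ℕ} (g : A → Fin ℓ) (k : ℕ) (xs : List A) → k ≤ collisions g xs →
  ∃[ ys ] ys ⊆ xs × length ys ≤ 2 * k × k ≤ collisions g ys
colliding-sublist g zero    xs       _ = [] , minimum xs , z≤n , z≤n
colliding-sublist g (suc k) (x ∷ xs) le with collides? g x xs
... | no _  = let ys , s , l , c = colliding-sublist g (suc k) xs le in ys , x ∷ʳ s , l , c
... | yes p with find p
...   | y , y∈ , gx≡gy with colliding-sublist g k xs (≤-pred le)
...     | ys , s , l , c with insert-⊆ s y∈
...       | zs , s′ , t , y∈zs , l′ = x ∷ zs , refl ∷ s′ ,
  ≤-trans (s≤s (≤-trans l′ (s≤s l))) (≤-reflexive (sym (*-suc 2 k))) ,
  +-mono-≤ (≤-reflexive (sym (⟦⟧-yes (collides? g x zs) (lose y∈zs gx≡gy)))) (≤-trans c (collisions-⊆ g t))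

module _ {u ℓ : ℕ} .{{_ : NonZero ℓ}} (k : ℕ) (G : List (HashFn u ℓ)) (ind : Independent≤ (2 * k) G) where

  -- Bounds ℓ^k times the probability of k collisions on t keys: the first factor is the number of
  -- certifying sublists, the second comes from `∑-words-collisions` for words of length 2 k.
  collisionBound : ℕ → ℕ
  collisionBound t = suc t ^ (2 * k) * (2 * k * (2 * k)) ^ k

  ∑-collisions-short : (ys : List (Fin u)) → Unique ys → length ys ≤ 2 * k →
    (∑[ g ∈ G ] ⟦ k ≤? collisions (apply g) ys ⟧) * ℓ ^ k ≤ length G * (2 * k * (2 * k)) ^ k
  ∑-collisions-short ys uys len = *-cancelʳ-≤ _ _ (ℓ ^ t) {{m^n≢0 ℓ t}} (begin
    (∑[ g ∈ G ] ⟦ k ≤? collisions (apply g) ys ⟧) * ℓ ^ k * ℓ ^ t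
      ≡⟨ cong (λ e → e * ℓ ^ k * ℓ ^ t) (∑-cong G (λ g → cong (λ e → ⟦ k ≤? e ⟧) (sym (collisions-map id (apply g) ys)))) ⟩
    (∑[ g ∈ G ] ψ (L.map (apply g) ys)) * ℓ ^ k * ℓ ^ t
      ≡⟨ swap₂₃ (∑[ g ∈ G ] ψ (L.map (apply g) ys)) (ℓ ^ k) (ℓ ^ t) ⟩
    (∑[ g ∈ G ] ψ (L.map (apply g) ys)) * ℓ ^ t * ℓ ^ k
      ≤⟨ *-monoˡ-≤ (ℓ ^ k) (∑-uniform G apply ys unif ψ) ⟩
    length G * ∑ (words ℓ t) ψ * ℓ ^ k
      ≡⟨ *-assoc (length G) (∑ (words ℓ t) ψ) (ℓ ^ k) ⟩
    length G * (∑ (words ℓ t) ψ * ℓ ^ k)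
      ≤⟨ *-monoʳ-≤ (length G) (∑-words-collisions ℓ t k) ⟩
    length G * (ℓ ^ t * (t * t) ^ k)
      ≤⟨ *-monoʳ-≤ (length G) (*-monoʳ-≤ (ℓ ^ t) (^-monoˡ-≤ k (*-mono-≤ len len))) ⟩
    length G * (ℓ ^ t * (2 * k * (2 * k)) ^ k)
      ≡⟨ rot (length G) (ℓ ^ t) ((2 * k * (2 * k)) ^ k) ⟩
    length G * (2 * k * (2 * k)) ^ k * ℓ ^ t ∎)
    where
    open ≤-Reasoning
    t = length ys
    ψ : List (Fin ℓ) → ℕ
    ψ ws = ⟦ k ≤? collisions id ws ⟧
    swap₂₃ : ∀ a b c → a * b * c ≡ a * c * b
    swap₂₃ = solve-∀
    rot : ∀ a b c → a * (b * c) ≡ a * c * b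
    rot = solve-∀
    unif : ∀ ps → L.map proj₁ ps ≡ ys → UniformAt G apply ps
    unif ps refl = ind ps uys (≤-trans (≤-reflexive (sym (LP.length-map proj₁ ps))) len)

  -- The list xs may exceed the independence of g, so the union bound runs over its sublists of at
  -- most 2 k keys.
  ∑-collisions : (xs : List (Fin u)) → Unique xs →
    (∑[ g ∈ G ] ⟦ k ≤? collisions (apply g) xs ⟧) * ℓ ^ k ≤ length G * collisionBound (length xs)
  ∑-collisions xs uxs = begin
    (∑[ g ∈ G ] ⟦ k ≤? collisions (apply g) xs ⟧) * ℓ ^ k
      ≤⟨ *-monoˡ-≤ (ℓ ^ k) (∑-mono G choose) ⟩
    (∑[ g ∈ G ] ∑[ ys ∈ sublists (2 * k) xs ] ⟦ k ≤? collisions (apply g) ys ⟧) * ℓ ^ k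
      ≡⟨ trans (cong (_* ℓ ^ k) (∑-swap G (sublists (2 * k) xs) _)) (∑-*ʳ (sublists (2 * k) xs) _ (ℓ ^ k)) ⟩
    (∑[ ys ∈ sublists (2 * k) xs ] (∑[ g ∈ G ] ⟦ k ≤? collisions (apply g) ys ⟧) * ℓ ^ k)
      ≤⟨ ∑-mono-∈ (sublists (2 * k) xs) (λ {ys} ys∈ → let s , l = ∈-sublists⁻ (2 * k) xs ys∈ in
           ∑-collisions-short ys (AllPairs-resp-⊆ s uxs) l) ⟩
    (∑[ ys ∈ sublists (2 * k) xs ] length G * (2 * k * (2 * k)) ^ k)
      ≡⟨ ∑-const (sublists (2 * k) xs) _ ⟩
    length (sublists (2 * k) xs) * (length G * (2 * k * (2 * k)) ^ k)
      ≤⟨ *-monoˡ-≤ _ (length-sublists (2 * k) xs) ⟩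
    suc (length xs) ^ (2 * k) * (length G * (2 * k * (2 * k)) ^ k)
      ≡⟨ rot (suc (length xs) ^ (2 * k)) (length G) ((2 * k * (2 * k)) ^ k) ⟩
    length G * collisionBound (length xs) ∎
    where
    open ≤-Reasoning
    choose : ∀ g → ⟦ k ≤? collisions (apply g) xs ⟧ ≤ ∑[ ys ∈ sublists (2 * k) xs ] ⟦ k ≤? collisions (apply g) ys ⟧
    choose g = ⟦⟧-≤ (k ≤? collisions (apply g) xs) λ le → let ys , s , l , c = colliding-sublist (apply g) k xs le in
      ≤-trans (≤-reflexive (sym (⟦⟧-yes (k ≤? collisions (apply g) ys) c)))
              (∑-∈ (λ ys → ⟦ k ≤? collisions (apply g) ys ⟧) (∈-sublists⁺ s l))
    rot : ∀ a b c → a * (b * c) ≡ b * (a * c)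
    rot = solve-∀

  ∑-allCollide : (c : ℕ) (xs : List (Fin u)) → Unique xs →
    (∑[ gs ∈ vecsOf c G ] ⟦ all? (λ j → k ≤? collisions (apply (lookup gs j)) xs) ⟧) * (ℓ ^ k) ^ c
      ≤ (length G * collisionBound (length xs)) ^ c
  ∑-allCollide zero    xs uxs = ≤-refl
  ∑-allCollide (suc c) xs uxs = begin
    (∑[ gs ∈ vecsOf (suc c) G ] D gs) * (ℓ ^ k) ^ suc c
      ≡⟨ cong (_* (ℓ ^ k) ^ suc c) (∑-vecsOf-suc c G _) ⟩
    (∑[ g ∈ G ] ∑[ gs ∈ vecsOf c G ] D (g ∷ gs)) * (ℓ ^ k * (ℓ ^ k) ^ c)
      ≤⟨ *-monoˡ-≤ (ℓ ^ k * (ℓ ^ k) ^ c) (∑-mono G (λ g → ∑-mono (vecsOf c G) (factor g))) ⟩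
    (∑[ g ∈ G ] ∑[ gs ∈ vecsOf c G ] d g * D gs) * (ℓ ^ k * (ℓ ^ k) ^ c)
      ≡⟨ cong (_* (ℓ ^ k * (ℓ ^ k) ^ c)) (trans (∑-cong G (λ g → sym (∑-*ˡ (vecsOf c G) D (d g)))) (sym (∑-*ʳ G d _))) ⟩
    ∑ G d * ∑ (vecsOf c G) D * (ℓ ^ k * (ℓ ^ k) ^ c)
      ≡⟨ interchange (∑ G d) (∑ (vecsOf c G) D) (ℓ ^ k) ((ℓ ^ k) ^ c) ⟩
    (∑ G d * ℓ ^ k) * (∑ (vecsOf c G) D * (ℓ ^ k) ^ c)
      ≤⟨ *-mono-≤ (∑-collisions xs uxs) (∑-allCollide c xs uxs) ⟩
    (length G * collisionBound (length xs)) ^ suc c ∎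
    where
    open ≤-Reasoning
    D : {c : ℕ} → Vec (HashFn u ℓ) c → ℕ
    D gs = ⟦ all? (λ j → k ≤? collisions (apply (lookup gs j)) xs) ⟧
    d : HashFn u ℓ → ℕ
    d g = ⟦ k ≤? collisions (apply g) xs ⟧
    factor : ∀ g gs → D (g ∷ gs) ≤ d g * D gs
    factor g gs = ≤-trans
      (⟦⟧-mono (all? (λ j → k ≤? collisions (apply (lookup (g ∷ gs) j)) xs))
               ((k ≤? collisions (apply g) xs) ×-dec all? (λ j → k ≤? collisions (apply (lookup gs j)) xs))
               (λ all → all zero , all ∘ suc))
      (≤-reflexive (⟦⟧-× (k ≤? collisions (apply g) xs) (all? (λ j → k ≤? collisions (apply (lookup gs j)) xs))))
    interchange : ∀ a b e f → a * b * (e * f) ≡ (a * e) * (b * f)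
    interchange = solve-∀

-- Words are read from the newest entry to the oldest.  A pin "just j" forces an entry
-- to repeat the j-th older one, j = 0 being the entry right after it in the list.

Pins : Set
Pins = List (Maybe ℕ)

pinCount : Pins → ℕ
pinCount []             = 0
pinCount (nothing ∷ ps) = pinCount ps
pinCount (just _ ∷ ps)  = suc (pinCount ps)

Sat : {r : ℕ} → Pins → List (Fin r) → Set
Sat []             []       = ⊤
Sat []             (_ ∷ _)  = ⊥
Sat (_ ∷ _)        []       = ⊥
Sat (nothing ∷ ps) (w ∷ ws) = Sat ps ws
Sat (just j ∷ ps)  (w ∷ ws) = L.head (L.drop j ws) ≡ just w × Sat ps ws

sat? : {r : ℕ} (ps : Pins) (ws : List (Fin r)) → Dec (Sat ps ws)
sat? []             []       = yes tt
sat? []             (_ ∷ _)  = no λ ()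
sat? (_ ∷ _)        []       = no λ ()
sat? (nothing ∷ ps) (w ∷ ws) = sat? ps ws
sat? (just j ∷ ps)  (w ∷ ws) = MaybeP.≡-dec _≟_ (L.head (L.drop j ws)) (just w) ×-dec sat? ps ws

∑-just : {r : ℕ} (v : Maybe (Fin r)) → ∑[ w ∈ allFin r ] ⟦ MaybeP.≡-dec _≟_ v (just w) ⟧ ≤ 1
∑-just {r} nothing  = ≤-trans (≤-reflexive (∑-zero (allFin r))) z≤n
∑-just {r} (just v) = ≤-trans
  (∑-mono (allFin r) (λ w → ⟦⟧-mono (MaybeP.≡-dec _≟_ (just v) (just w)) (w ≟ v) (λ { refl → refl })))
  (∑-unique v (allFin⁺ r))

-- Pins point to older letters only. Once these are chosen, a pinned letter has at most one
-- admissible value, so every pin divides the count by r, however the pins are interlaced.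
∑-words-sat : (r n : ℕ) (ps : Pins) → (∑[ ws ∈ words r n ] ⟦ sat? ps ws ⟧) * r ^ pinCount ps ≤ r ^ n
∑-words-sat r zero    []       = ≤-refl
∑-words-sat r zero    (_ ∷ _)  = z≤n
∑-words-sat r (suc n) []       = ≤-trans (≤-reflexive (cong (_* 1) (trans (∑-words-suc r n _)
  (trans (∑-cong (allFin r) (λ _ → ∑-zero (words r n))) (∑-zero (allFin r)))))) z≤n
∑-words-sat r (suc n) (nothing ∷ ps) = begin
  (∑[ ws ∈ words r (suc n) ] ⟦ sat? (nothing ∷ ps) ws ⟧) * r ^ pinCount ps
    ≡⟨ cong (_* r ^ pinCount ps) (trans (∑-words-suc r n _) (trans (∑-const (allFin r) _) (cong (_* s) (length-allFin r)))) ⟩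
  r * s * r ^ pinCount ps    ≡⟨ *-assoc r s _ ⟩
  r * (s * r ^ pinCount ps)  ≤⟨ *-monoʳ-≤ r (∑-words-sat r n ps) ⟩
  r ^ suc n ∎
  where
  open ≤-Reasoning
  s = ∑[ ws ∈ words r n ] ⟦ sat? ps ws ⟧
∑-words-sat r (suc n) (just j ∷ ps) = begin
  (∑[ ws ∈ words r (suc n) ] ⟦ sat? (just j ∷ ps) ws ⟧) * (r * r ^ pinCount ps)
    ≡⟨ cong (_* (r * r ^ pinCount ps)) (trans (∑-words-suc r n _) (trans (∑-swap (allFin r) (words r n) _)
         (∑-cong (words r n) (λ ws → trans (∑-cong (allFin r) (λ w → ⟦⟧-× (pin? ws w) (sat? ps ws)))
           (sym (∑-*ʳ (allFin r) (λ w → ⟦ pin? ws w ⟧) ⟦ sat? ps ws ⟧)))))) ⟩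
  (∑[ ws ∈ words r n ] (∑[ w ∈ allFin r ] ⟦ pin? ws w ⟧) * ⟦ sat? ps ws ⟧) * (r * r ^ pinCount ps)
    ≤⟨ *-monoˡ-≤ (r * r ^ pinCount ps) (∑-mono (words r n) (λ ws → ≤-trans
         (*-monoˡ-≤ ⟦ sat? ps ws ⟧ (∑-just (L.head (L.drop j ws)))) (≤-reflexive (*-identityˡ ⟦ sat? ps ws ⟧)))) ⟩
  s * (r * r ^ pinCount ps)
    ≡⟨ rot s r (r ^ pinCount ps) ⟩
  r * (s * r ^ pinCount ps)
    ≤⟨ *-monoʳ-≤ r (∑-words-sat r n ps) ⟩
  r ^ suc n ∎
  where
  open ≤-Reasoning
  s = ∑[ ws ∈ words r n ] ⟦ sat? ps ws ⟧
  pin? : (ws : List (Fin r)) (w : Fin r) → Dec (L.head (L.drop j ws) ≡ just w)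
  pin? ws w = MaybeP.≡-dec _≟_ (L.head (L.drop j ws)) (just w)
  rot : ∀ a b c → a * (b * c) ≡ b * (a * c)
  rot = solve-∀

-- Templates

-- "cont" continues the current walk: the new key shares the exit endpoint of the
-- previous key and leaves through its other endpoint.  "jump p q a" pins the two
-- endpoints as told by p and q and leaves through side a (false for h₁, true for h₂).
data Step : Set where
  cont : Step
  jump : Maybe ℕ → Maybe ℕ → Bool → Step

-- The value at `[]` is a dummy, since traces append `cont` only to a nonempty template.
exit : List Step → Bool
exit []               = false
exit (cont ∷ τ)       = not (exit τ)
exit (jump _ _ a ∷ τ) = a

pin : Bool → Step → List Step → Maybe ℕ
pin a cont         τ = if does (exit τ BoolP.≟ a) then just 0 else nothing
pin a (jump p q _) τ = if a then q else p

-- One list per side, because h₁ and h₂ are independent for fixed g_j and their constraints are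
-- counted separately.
pins : Bool → List Step → Pins
pins a []      = []
pins a (s ∷ τ) = pin a s τ ∷ pins a τ

totalPins : List Step → ℕ
totalPins τ = pinCount (pins false τ) + pinCount (pins true τ)

jumpCount : List Step → ℕ
jumpCount []               = 0
jumpCount (cont ∷ τ)       = jumpCount τ
jumpCount (jump _ _ _ ∷ τ) = suc (jumpCount τ)

-- A template of length t leaves 2t - totalPins vertices: in every suffix of a thin
-- template there is at most one more vertex than there are edges.
Thin : List Step → Set
Thin []      = ⊤
Thin (s ∷ τ) = length (s ∷ τ) ≤ suc (totalPins (s ∷ τ)) × Thin τ

PinBelow : ℕ → Maybe ℕ → Set
PinBelow T nothing  = ⊤
PinBelow T (just j) = j < T

StepBelow : ℕ → Step → Set
StepBelow T cont         = ⊤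
StepBelow T (jump p q _) = PinBelow T p × PinBelow T q

pointers : ℕ → List (Maybe ℕ)
pointers T = nothing ∷ L.map just (upTo T)

jumps : ℕ → List Step
jumps T = cartesianProductWith (λ (p , q) → jump p q) (cartesianProduct (pointers T) (pointers T)) (false ∷ true ∷ [])

templates : (T R t : ℕ) → List (List Step)
templates T R       zero    = [] ∷ []
templates T zero    (suc t) = L.map (cont ∷_) (templates T zero t)
templates T (suc R) (suc t) =
  L.map (cont ∷_) (templates T (suc R) t) ++ cartesianProductWith _∷_ (jumps T) (templates T R t)

∈-pointers : {T : ℕ} (p : Maybe ℕ) → PinBelow T p → p ∈ pointers T
∈-pointers nothing  _  = here refl
∈-pointers (just j) lt = there (∈-map⁺ just (∈-upTo⁺ lt))

∈-jumps : {T : ℕ} {p q : Maybe ℕ} (a : Bool) → PinBelow T p → PinBelow T q → jump p q a ∈ jumps T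
∈-jumps {p = p} {q} a bp bq = ∈-cartesianProductWith⁺ (λ (p , q) → jump p q)
  (∈-cartesianProductWith⁺ _,_ (∈-pointers p bp) (∈-pointers q bq)) (side a)
  where
  side : ∀ a → a ∈ (false ∷ true ∷ [])
  side false = here refl
  side true  = there (here refl)

∈-templates : {T R : ℕ} (τ : List Step) → All (StepBelow T) τ → jumpCount τ ≤ R → τ ∈ templates T R (length τ)
∈-templates             []               _               _       = here refl
∈-templates {R = zero}  (cont ∷ τ)       (_ ∷ bs)        le      = ∈-map⁺ (cont ∷_) (∈-templates τ bs le)
∈-templates {R = suc R} (cont ∷ τ)       (_ ∷ bs)        le      = ∈-++⁺ˡ (∈-map⁺ (cont ∷_) (∈-templates τ bs le))
∈-templates {T} {suc R} (jump p q a ∷ τ) ((bp , bq) ∷ bs) (s≤s le) =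
  ∈-++⁺ʳ (L.map (cont ∷_) (templates T (suc R) (length τ)))
    (∈-cartesianProductWith⁺ _∷_ (∈-jumps a bp bq) (∈-templates τ bs le))

-- With a the number of jumps, the counts satisfy N(R+1,t+1) = N(R+1,t) + a N(R,t), since `cont`
-- offers no choice. The power (1 + a t)^R dominates this recursion.
length-templates : (T R t : ℕ) → length (templates T R t) ≤ (1 + length (jumps T) * t) ^ R
length-templates T R       zero    = ≤-reflexive (sym (trans (cong (λ e → (1 + e) ^ R) (*-zeroʳ (length (jumps T)))) (^-zeroˡ R)))
length-templates T zero    (suc t) = ≤-trans (≤-reflexive (LP.length-map (cont ∷_) (templates T zero t))) (length-templates T zero t)
length-templates T (suc R) (suc t) = begin
  length (L.map (cont ∷_) (templates T (suc R) t) ++ cartesianProductWith _∷_ (jumps T) (templates T R t))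
    ≡⟨ trans (LP.length-++ (L.map (cont ∷_) (templates T (suc R) t)))
         (cong₂ _+_ (LP.length-map (cont ∷_) (templates T (suc R) t)) (length-cartesianProductWith _∷_ (jumps T) (templates T R t))) ⟩
  length (templates T (suc R) t) + a * length (templates T R t)
    ≤⟨ +-mono-≤ (length-templates T (suc R) t) (*-monoʳ-≤ a (length-templates T R t)) ⟩
  (1 + a * t) * (1 + a * t) ^ R + a * (1 + a * t) ^ R
    ≡⟨ collect a t ((1 + a * t) ^ R) ⟩
  (1 + a * suc t) * (1 + a * t) ^ R
    ≤⟨ *-monoʳ-≤ (1 + a * suc t) (^-monoˡ-≤ R (s≤s (*-monoʳ-≤ a (n≤1+n t)))) ⟩
  (1 + a * suc t) ^ suc R ∎
  where
  open ≤-Reasoning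
  a = length (jumps T)
  collect : ∀ a t e → (1 + a * t) * e + a * e ≡ (1 + a * suc t) * e
  collect = solve-∀

-- Degree three per jump: its position in the template and its two pointers.
length-templates-cubic : (R t : ℕ) → length (templates t R t) ≤ (2 * (suc t * (suc t * suc t))) ^ R
length-templates-cubic R t = ≤-trans (length-templates t R t) (^-monoˡ-≤ R (begin
  1 + length (jumps t) * t                 ≡⟨ cong (λ e → 1 + e * t) length-jumps ⟩
  1 + suc t * suc t * 2 * t                ≤⟨ +-monoˡ-≤ (suc t * suc t * 2 * t) (s≤s (z≤n {t + t + t * t + suc t * suc t})) ⟩
  1 + (t + t + t * t + suc t * suc t) + suc t * suc t * 2 * t ≡⟨ expand t ⟩
  2 * (suc t * (suc t * suc t)) ∎))
  where
  open ≤-Reasoning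
  length-pointers : length (pointers t) ≡ suc t
  length-pointers = cong suc (trans (LP.length-map just (upTo t)) (LP.length-upTo t))
  length-jumps : length (jumps t) ≡ suc t * suc t * 2
  length-jumps = trans (length-cartesianProductWith (λ (p , q) → jump p q) (cartesianProduct (pointers t) (pointers t)) (false ∷ true ∷ []))
    (cong (_* 2) (trans (length-cartesianProductWith _,_ (pointers t) (pointers t)) (cong₂ _*_ length-pointers length-pointers)))
  expand : ∀ t → 1 + (t + t + t * t + suc t * suc t) + suc t * suc t * 2 * t ≡ 2 * (suc t * (suc t * suc t))
  expand = solve-∀

-- Probability of following a template

gsOf : {u m ℓ c : ℕ} → Sample u m ℓ c → Vec (HashFn u ℓ) c
gsOf (_ , _ , gs , _ , _) = gs

-- With the g_j outermost, the pairs (f₁ , z₁) and (f₂ , z₂) range over a product, which is the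
-- conditional independence of h₁ and h₂.
∑-sampleSpace : {u m ℓ c : ℕ} (F : List (HashFn u m)) (G : List (HashFn u ℓ)) (φ : Sample u m ℓ c → ℕ) →
  ∑ (sampleSpace c F G) φ ≡
  (∑[ gs ∈ vecsOf c G ] ∑[ (f₁ , z₁) ∈ cartesianProduct F (vecsOf c (vecsOf ℓ (allFin m))) ]
                        ∑[ (f₂ , z₂) ∈ cartesianProduct F (vecsOf c (vecsOf ℓ (allFin m))) ] φ (f₁ , f₂ , gs , z₁ , z₂))
∑-sampleSpace {m = m} {ℓ} {c} F G φ = begin
  ∑ (sampleSpace c F G) φ
    ≡⟨ trans (∑-concatMap _ F φ) (∑-cong F (λ f₁ → trans (∑-concatMap _ F φ) (∑-cong F (λ f₂ →
         trans (∑-concatMap _ (vecsOf c G) φ) (∑-cong (vecsOf c G) (λ gs →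
         trans (∑-concatMap _ Z φ) (∑-cong Z (λ z₁ → ∑-map _ Z φ)))))))) ⟩
  (∑[ f₁ ∈ F ] ∑[ f₂ ∈ F ] ∑[ gs ∈ vecsOf c G ] ∑[ z₁ ∈ Z ] ∑[ z₂ ∈ Z ] φ (f₁ , f₂ , gs , z₁ , z₂))
    ≡⟨ trans (∑-cong F (λ f₁ → ∑-swap F (vecsOf c G) _)) (∑-swap F (vecsOf c G) _) ⟩
  (∑[ gs ∈ vecsOf c G ] ∑[ f₁ ∈ F ] ∑[ f₂ ∈ F ] ∑[ z₁ ∈ Z ] ∑[ z₂ ∈ Z ] φ (f₁ , f₂ , gs , z₁ , z₂))
    ≡⟨ ∑-cong (vecsOf c G) (λ gs → trans (∑-cong F (λ f₁ → trans (∑-swap F Z _)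
         (∑-cong Z (λ z₁ → sym (∑-cartesian _,_ F Z _))))) (sym (∑-cartesian _,_ F Z _))) ⟩
  _ ∎
  where
  open ≡-Reasoning
  Z = vecsOf c (vecsOf ℓ (allFin m))

module _ {u ℓ c : ℕ} (k : ℕ) where

  -- Not the complement of `Bad`: both hold when the smallest number of collisions is exactly k, and
  -- the bad case is counted on this overlap.
  Good : Vec (HashFn u ℓ) c → List (Fin u) → Set
  Good gs xs = ∃[ j ] collisions (apply (lookup gs j)) xs ≤ k

  good? : ∀ gs xs → Dec (Good gs xs)
  good? gs xs = any? (λ j → collisions (apply (lookup gs j)) xs ≤? k)

  Bad : Vec (HashFn u ℓ) c → List (Fin u) → Set
  Bad gs xs = ∀ j → k ≤ collisions (apply (lookup gs j)) xs

  bad? : ∀ gs xs → Dec (Bad gs xs)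
  bad? gs xs = all? (λ j → k ≤? collisions (apply (lookup gs j)) xs)

  ¬bad⇒few : ∀ gs xs → ¬ Bad gs xs → ∃[ j ] collisions (apply (lookup gs j)) xs < k
  ¬bad⇒few gs xs ¬bad =
    let j , ¬le = ¬∀⟶∃¬ c (λ j → k ≤ collisions (apply (lookup gs j)) xs) (λ j → k ≤? collisions (apply (lookup gs j)) xs) ¬bad
    in j , ≰⇒> ¬le

module _ {u m ℓ c : ℕ} .{{_ : NonZero m}} where

  Follows : List Step → List (Fin u) → Sample u m ℓ c → Set
  Follows τ xs σ = Sat (pins false τ) (L.map (h₁ σ) xs) × Sat (pins true τ) (L.map (h₂ σ) xs)

  follows? : ∀ τ xs σ → Dec (Follows τ xs σ)
  follows? τ xs σ = sat? (pins false τ) (L.map (h₁ σ) xs) ×-dec sat? (pins true τ) (L.map (h₂ σ) xs)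

  module _ (k : ℕ) (F : List (HashFn u m)) (ind : Independent≤ (2 * k) F) where

    private
      Ω : List (HashFn u m × Vec (Vec (Fin m) ℓ) c)
      Ω = cartesianProduct F (vecsOf c (vecsOf ℓ (allFin m)))

    ∑-zHash-sat : (gs : Vec (HashFn u ℓ) c) (xs : List (Fin u)) → Unique xs → Good k gs xs → (ps : Pins) →
      (∑[ (f , zs) ∈ Ω ] ⟦ sat? ps (L.map (zHash f gs zs) xs) ⟧) * m ^ pinCount ps ≤ length Ω
    ∑-zHash-sat gs xs uxs (j , few) ps = *-cancelʳ-≤ _ _ (m ^ t) {{m^n≢0 m t}} (begin
      S * m ^ pinCount ps * m ^ t
        ≡⟨ swap₂₃ S (m ^ pinCount ps) (m ^ t) ⟩
      S * m ^ t * m ^ pinCount ps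
        ≤⟨ *-monoˡ-≤ (m ^ pinCount ps) (∑-uniform Ω (λ (f , zs) → zHash f gs zs) xs unif (λ ws → ⟦ sat? ps ws ⟧)) ⟩
      length Ω * (∑[ ws ∈ words m t ] ⟦ sat? ps ws ⟧) * m ^ pinCount ps
        ≡⟨ *-assoc (length Ω) _ (m ^ pinCount ps) ⟩
      length Ω * ((∑[ ws ∈ words m t ] ⟦ sat? ps ws ⟧) * m ^ pinCount ps)
        ≤⟨ *-monoʳ-≤ (length Ω) (∑-words-sat m t ps) ⟩
      length Ω * m ^ t ∎)
      where
      open ≤-Reasoning
      t = length xs
      S = ∑[ (f , zs) ∈ Ω ] ⟦ sat? ps (L.map (zHash f gs zs) xs) ⟧
      swap₂₃ : ∀ a b c → a * b * c ≡ a * c * b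
      swap₂₃ = solve-∀
      unif : ∀ qs → L.map proj₁ qs ≡ xs → UniformAt Ω (λ (f , zs) → zHash f gs zs) qs
      unif qs refl = zHash-uniform (2 * k) F ind gs j qs uxs (*-monoʳ-≤ 2 few)

    -- The estimate holds for each good choice of the g_j separately, so a further condition D on
    -- them factors out. D is trivial in the good case and `Bad` in the other.
    ∑-follows : (G : List (HashFn u ℓ)) (xs : List (Fin u)) → Unique xs → (τ : List Step) →
      {D : Vec (HashFn u ℓ) c → Set} (D? : ∀ gs → Dec (D gs)) →
      (∑[ σ ∈ sampleSpace c F G ] ⟦ follows? τ xs σ ×-dec (good? k (gsOf σ) xs ×-dec D? (gsOf σ)) ⟧) * m ^ totalPins τ
        ≤ length Ω * length Ω * (∑[ gs ∈ vecsOf c G ] ⟦ D? gs ⟧)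
    ∑-follows G xs uxs τ D? = begin
      (∑[ σ ∈ sampleSpace c F G ] event σ) * m ^ totalPins τ
        ≡⟨ trans (cong (_* m ^ totalPins τ) (∑-sampleSpace F G event)) (∑-*ʳ (vecsOf c G) _ (m ^ totalPins τ)) ⟩
      (∑[ gs ∈ vecsOf c G ] (∑[ (f₁ , z₁) ∈ Ω ] ∑[ (f₂ , z₂) ∈ Ω ] event (f₁ , f₂ , gs , z₁ , z₂)) * m ^ totalPins τ)
        ≤⟨ ∑-mono (vecsOf c G) fixed ⟩
      (∑[ gs ∈ vecsOf c G ] length Ω * length Ω * ⟦ D? gs ⟧)
        ≡⟨ sym (∑-*ˡ (vecsOf c G) (λ gs → ⟦ D? gs ⟧) (length Ω * length Ω)) ⟩
      length Ω * length Ω * (∑[ gs ∈ vecsOf c G ] ⟦ D? gs ⟧) ∎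
      where
      open ≤-Reasoning
      event : Sample u m ℓ c → ℕ
      event σ = ⟦ follows? τ xs σ ×-dec (good? k (gsOf σ) xs ×-dec D? (gsOf σ)) ⟧
      I : Bool → Vec (HashFn u ℓ) c → HashFn u m × Vec (Vec (Fin m) ℓ) c → ℕ
      I a gs (f , zs) = ⟦ sat? (pins a τ) (L.map (zHash f gs zs) xs) ⟧
      split : ∀ gs ω₁ ω₂ → event (proj₁ ω₁ , proj₁ ω₂ , gs , proj₂ ω₁ , proj₂ ω₂) ≡
        I false gs ω₁ * I true gs ω₂ * (⟦ good? k gs xs ⟧ * ⟦ D? gs ⟧)
      split gs (f₁ , z₁) (f₂ , z₂) =
        trans (⟦⟧-× (follows? τ xs (f₁ , f₂ , gs , z₁ , z₂)) (good? k gs xs ×-dec D? gs))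
        (cong₂ _*_ (⟦⟧-× (sat? (pins false τ) (L.map (zHash f₁ gs z₁) xs)) (sat? (pins true τ) (L.map (zHash f₂ gs z₂) xs)))
                   (⟦⟧-× (good? k gs xs) (D? gs)))
      product : ∀ gs → (∑[ ω₁ ∈ Ω ] ∑[ ω₂ ∈ Ω ] event (proj₁ ω₁ , proj₁ ω₂ , gs , proj₂ ω₁ , proj₂ ω₂)) ≡
        ∑ Ω (I false gs) * ∑ Ω (I true gs) * (⟦ good? k gs xs ⟧ * ⟦ D? gs ⟧)
      product gs = trans
        (∑-cong Ω (λ ω₁ → trans (∑-cong Ω (split gs ω₁)) (sym (trans (cong (_* (⟦ good? k gs xs ⟧ * ⟦ D? gs ⟧)) (∑-*ˡ Ω (I true gs) (I false gs ω₁)))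
           (∑-*ʳ Ω _ _)))))
        (trans (sym (∑-*ʳ Ω _ (⟦ good? k gs xs ⟧ * ⟦ D? gs ⟧)))
               (cong (_* (⟦ good? k gs xs ⟧ * ⟦ D? gs ⟧)) (sym (∑-*ʳ Ω (I false gs) (∑ Ω (I true gs))))))
      regroup : ∀ a b e p q → a * b * e * (p * q) ≡ (a * p) * (b * q) * e
      regroup = solve-∀
      fixed : ∀ gs → (∑[ (f₁ , z₁) ∈ Ω ] ∑[ (f₂ , z₂) ∈ Ω ] event (f₁ , f₂ , gs , z₁ , z₂)) * m ^ totalPins τ
        ≤ length Ω * length Ω * ⟦ D? gs ⟧
      fixed gs with good? k gs xs | product gs
      ... | no _     | eq = ≤-trans (≤-reflexive (cong (_* m ^ totalPins τ) (trans eq (*-zeroʳ (∑ Ω (I false gs) * ∑ Ω (I true gs)))))) z≤n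
      ... | yes good | eq = ≤-trans (≤-reflexive
        (cong₂ _*_ (trans eq (cong (∑ Ω (I false gs) * ∑ Ω (I true gs) *_) (*-identityˡ ⟦ D? gs ⟧)))
                   (^-distribˡ-+-* m (pinCount (pins false τ)) (pinCount (pins true τ))))) (begin
        ∑ Ω (I false gs) * ∑ Ω (I true gs) * ⟦ D? gs ⟧ * (m ^ pinCount (pins false τ) * m ^ pinCount (pins true τ))
          ≡⟨ regroup (∑ Ω (I false gs)) (∑ Ω (I true gs)) ⟦ D? gs ⟧ (m ^ pinCount (pins false τ)) (m ^ pinCount (pins true τ)) ⟩
        (∑ Ω (I false gs) * m ^ pinCount (pins false τ)) * (∑ Ω (I true gs) * m ^ pinCount (pins true τ)) * ⟦ D? gs ⟧
          ≤⟨ *-monoˡ-≤ ⟦ D? gs ⟧ (*-mono-≤ (∑-zHash-sat gs xs uxs good (pins false τ)) (∑-zHash-sat gs xs uxs good (pins true τ))) ⟩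
        length Ω * length Ω * ⟦ D? gs ⟧ ∎)

-- Placements and evictions

Unique-map : {f : A → B} {xs : List A} → (∀ {x y} → x ∈ xs → y ∈ xs → f x ≡ f y → x ≡ y) →
  Unique xs → Unique (L.map f xs)
Unique-map inj []       = []
Unique-map {f = f} inj (px ∷ u) =
  AllP.map⁺ (All.tabulate (λ {y} y∈ fx≡fy → All.lookup px y∈ (inj (here refl) (there y∈) fx≡fy)))
  ∷ Unique-map (λ x∈ y∈ → inj (there x∈) (there y∈)) u

∈⇒head-drop : {x : A} {xs : List A} → x ∈ xs → ∃[ j ] L.head (L.drop j xs) ≡ just x
∈⇒head-drop (here refl) = 0 , refl
∈⇒head-drop (there p)   = let j , e = ∈⇒head-drop p in suc j , e

not≢ : ∀ a → not a ≢ a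
not≢ true  ()
not≢ false ()

module Placements {u m : ℕ} (S : List (Fin u)) (uS : Unique S) (val : Bool → Fin u → Fin m) where

  edge : Fin u → Edge m
  edge x = val false x , val true x

  -- A partial matching of keys to their endpoints, in other words a cuckoo table that stores some
  -- of the keys.
  record Placement : Set where
    field
      pos : Fin u → Maybe Bool
      placed∈S : ∀ {x a} → pos x ≡ just a → x ∈ S
      injective : ∀ {x y a} → pos x ≡ just a → pos y ≡ just a → val a x ≡ val a y → x ≡ y
  open Placement

  Empty : Placement → Bool → Fin m → Set
  Empty P a v = ∀ y → pos P y ≡ just a → val a y ≢ v

  occupied? : (P : Placement) (a : Bool) (v : Fin m) → (∃[ y ] pos P y ≡ just a × val a y ≡ v) ⊎ Empty P a v
  occupied? P a v with any? (λ y → MaybeP.≡-dec BoolP._≟_ (pos P y) (just a) ×-dec (val a y ≟ v))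
  ... | yes occ = inj₁ occ
  ... | no ¬occ = inj₂ (λ y p q → ¬occ (y , p , q))

  -- An alternating path of the matching. Being inductive, it admits only chains of evictions that
  -- end at an empty vertex.
  data Free (P : Placement) (a : Bool) : Fin m → Set where
    empty : ∀ {v} → Empty P a v → Free P a v
    evict : ∀ {y} → pos P y ≡ just a → Free P (not a) (val (not a) y) → Free P a (val a y)

  move : (P : Placement) {y : Fin u} {b : Bool} → y ∈ S → Empty P b (val b y) →
    ∃[ P′ ] pos P′ y ≡ just b × (∀ z → z ≢ y → pos P′ z ≡ pos P z)
  move P {y} {b} y∈ emp = record { pos = pos′ ; placed∈S = placed ; injective = inj } , at-y , off-y
    where
    pos′ : Fin u → Maybe Bool
    pos′ z = if does (z ≟ y) then just b else pos P z
    at-y : pos′ y ≡ just b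
    at-y rewrite dec-true (y ≟ y) refl = refl
    off-y : ∀ z → z ≢ y → pos′ z ≡ pos P z
    off-y z z≢y rewrite dec-false (z ≟ y) z≢y = refl
    placed : ∀ {x a} → pos′ x ≡ just a → x ∈ S
    placed {x} e with x ≟ y
    ... | yes refl = y∈
    ... | no _     = placed∈S P e
    inj : ∀ {x z a} → pos′ x ≡ just a → pos′ z ≡ just a → val a x ≡ val a z → x ≡ z
    inj {x} {z} ex ez eq with x ≟ y | z ≟ y
    ... | yes refl | yes refl = refl
    inj {x} {z} refl ez eq | yes refl | no _ = contradiction (sym eq) (emp z ez)
    inj {x} {z} ex refl eq | no _ | yes refl = contradiction eq (emp x ex)
    ... | no _ | no _ = injective P ex ez eq

  SamePlaced : Placement → Placement → Set
  SamePlaced P P′ = ∀ x → (pos P x ≡ nothing → pos P′ x ≡ nothing) × (pos P′ x ≡ nothing → pos P x ≡ nothing)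

  -- The evictions beyond y are carried out first. They may have moved any key, but y is still
  -- placed and its other endpoint is now empty, so y sits on side a as before. Moving y then frees
  -- its vertex, by injectivity.
  vacate : (P : Placement) {a : Bool} {v : Fin m} → Free P a v → ∃[ P′ ] SamePlaced P P′ × Empty P′ a v
  vacate P (empty emp) = P , (λ _ → id , id) , emp
  vacate P {a} (evict {y} py fr) with vacate P fr
  ... | P′ , same , emp with pos P′ y in py′
  ...   | nothing = contradiction (trans (sym py) (proj₂ (same y) py′)) λ ()
  ...   | just b with b BoolP.≟ not a
  ...     | yes refl = contradiction refl (emp y py′)
  ...     | no b≢ with move P′ (placed∈S P py) emp
  ...       | P″ , at-y , off-y = P″ , same″ , emp″
    where
    b≡a : b ≡ a
    b≡a = trans (BoolP.¬-not b≢) (BoolP.not-involutive a)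
    same″ : SamePlaced P P″
    same″ x with x ≟ y
    ... | yes refl = (λ e → contradiction (trans (sym py) e) λ ()) , (λ e → contradiction (trans (sym at-y) e) λ ())
    ... | no x≢y rewrite off-y x x≢y = same x
    emp″ : Empty P″ a (val a y)
    emp″ z pz eq with z ≟ y
    ... | yes refl = contradiction (MaybeP.just-injective (trans (sym at-y) pz)) (not≢ a)
    ... | no z≢y = z≢y (injective P′ (trans (sym (off-y z z≢y)) pz) (trans py′ (cong just b≡a)) eq)

  unplaced? : (P : Placement) (x : Fin u) → Dec (pos P x ≡ nothing)
  unplaced? P x = MaybeP.≡-dec BoolP._≟_ (pos P x) nothing

  unplaced : Placement → List (Fin u)
  unplaced P = filter (unplaced? P) S

  augment : (P : Placement) {x : Fin u} {a : Bool} → x ∈ unplaced P → Free P a (val a x) →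
    ∃[ P′ ] length (unplaced P′) < length (unplaced P)
  augment P {x} {a} x∈ fr with vacate P fr
  ... | P′ , same , emp with move P′ {x} {a} (proj₁ (∈-filter⁻ (unplaced? P) x∈)) emp
  ...   | P″ , at-x , off-x = P″ , Unique⇒length≤ {xs = x ∷ unplaced P″}
    (All.tabulate (λ {y} y∈ x≡y → placed-x (trans (cong (pos P″) x≡y) (proj₂ (∈-filter⁻ (unplaced? P″) {xs = S} y∈))))
      ∷ filter⁺ (unplaced? P″) uS)
    λ { (here refl) → x∈ ; (there y∈) → keep y∈ }
    where
    placed-x : pos P″ x ≢ nothing
    placed-x e = contradiction (trans (sym at-x) e) λ ()
    keep : ∀ {y} → y ∈ unplaced P″ → y ∈ unplaced P
    keep {y} y∈ = let y∈S , e = ∈-filter⁻ (unplaced? P″) {xs = S} y∈ in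
      ∈-filter⁺ (unplaced? P) y∈S
        (proj₂ (same y) (trans (sym (off-x y (λ { refl → placed-x e }))) e))

  placed : Placement → List (Fin u)
  placed P = filter (λ x → ¬? (unplaced? P x)) S

  vertex : Bool → Fin m → Vertex m
  vertex false = inj₁
  vertex true  = inj₂

  vertex-injective : ∀ {a b v w} → vertex a v ≡ vertex b w → a ≡ b × v ≡ w
  vertex-injective {false} {false} refl = refl , refl
  vertex-injective {true}  {true}  refl = refl , refl

  vertex-∈ : ∀ a v → vertex a v ∈ vertices m
  vertex-∈ false v = ∈-++⁺ˡ (∈-map⁺ inj₁ (∈-allFin v))
  vertex-∈ true  v = ∈-++⁺ʳ (L.map inj₁ (allFin m)) (∈-map⁺ inj₂ (∈-allFin v))

  -- Each placed key owns the endpoint it sits in, so no component has more edges than vertices.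
  placed-unicyclic : (P : Placement) → AllComponentsAtMostUnicyclic (L.map edge (placed P))
  placed-unicyclic P comp lab w = begin
    length (filter E? (L.map edge (placed P)))
      ≡⟨ trans (length-filter E? (L.map edge (placed P))) (trans (∑-map edge (placed P) _) (sym (length-filter (E? ∘ edge) (placed P)))) ⟩
    length keys
      ≡⟨ sym (LP.length-map home keys) ⟩
    length (L.map home keys)
      ≤⟨ Unique⇒length≤ (Unique-map home-injective (filter⁺ (E? ∘ edge) (filter⁺ (λ x → ¬? (unplaced? P x)) uS))) home-∈ ⟩
    length (filter (λ v → SumP.≡-dec _≟_ _≟_ (comp v) w) (vertices m)) ∎
    where
    open ≤-Reasoning
    E? : (e : Edge m) → Dec (comp (inj₁ (proj₁ e)) ≡ w)
    E? e = SumP.≡-dec _≟_ _≟_ (comp (inj₁ (proj₁ e))) w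
    keys : List (Fin u)
    keys = filter (E? ∘ edge) (placed P)
    homeAt : Maybe Bool → Fin u → Vertex m
    homeAt (just a) x = vertex a (val a x)
    -- A dummy value: `home` is applied to placed keys.
    homeAt nothing  x = inj₁ (val false x)
    home : Fin u → Vertex m
    home x = homeAt (pos P x) x
    side : ∀ {x} → x ∈ keys → ∃[ a ] pos P x ≡ just a
    side {x} x∈ with pos P x | proj₂ (∈-filter⁻ (λ x → ¬? (unplaced? P x)) {xs = S} (proj₁ (∈-filter⁻ (E? ∘ edge) {xs = placed P} x∈)))
    ... | just a  | _ = a , refl
    ... | nothing | ne = contradiction refl ne
    home-injective : ∀ {x y} → x ∈ keys → y ∈ keys → home x ≡ home y → x ≡ y
    home-injective {x} {y} x∈ y∈ eq with side x∈ | side y∈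
    ... | a , px | b , py rewrite px | py with vertex-injective {a} {b} eq
    ...   | refl , e = injective P px py e
    -- An edge is attributed to a component by its left endpoint, whereas its key may sit in the
    -- right one.
    comp-vertex : ∀ {x} → x ∈ keys → ∀ a → comp (vertex a (val a x)) ≡ comp (inj₁ (val false x))
    comp-vertex x∈ false = refl
    comp-vertex {x} x∈ true  = proj₂ (lab _ _)
      ((val false x , val true x , ∈-map⁺ edge (proj₁ (∈-filter⁻ (E? ∘ edge) {xs = placed P} x∈)) , inj₂ (refl , refl)) Star.◅ Star.ε)
    home-∈ : ∀ {v} → v ∈ L.map home keys → v ∈ filter (λ v → SumP.≡-dec _≟_ _≟_ (comp v) w) (vertices m)
    home-∈ v∈ with ∈-map⁻ home v∈
    ... | x , x∈ , refl with side x∈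
    ...   | a , px rewrite px = ∈-filter⁺ (λ v → SumP.≡-dec _≟_ _≟_ (comp v) w) (vertex-∈ a (val a x))
      (trans (comp-vertex x∈ a) (proj₂ (∈-filter⁻ (E? ∘ edge) {xs = placed P} x∈)))

  length-placed : (P : Placement) (xs : List (Fin u)) →
    length (filter (λ x → ¬? (unplaced? P x)) xs) + length (filter (unplaced? P) xs) ≡ length xs
  length-placed P []       = refl
  length-placed P (x ∷ xs) with pos P x
  ... | just _  = cong suc (length-placed P xs)
  ... | nothing = trans (+-suc _ _) (cong suc (length-placed P xs))

  excess⇒unplaced : {s : ℕ} → ExcessAtLeast (L.map edge S) (suc s) → (P : Placement) → suc s ≤ length (unplaced P)
  excess⇒unplaced {s} ex P = +-cancelʳ-≤ (length (placed P)) (suc s) (length (unplaced P)) (begin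
    suc s + length (placed P)
      ≡⟨ cong (suc s +_) (sym (LP.length-map edge (placed P))) ⟩
    suc s + length (L.map edge (placed P))
      ≤⟨ ex (L.map edge (placed P)) (SubP.map⁺ edge (SubP.filter-⊆ (λ x → ¬? (unplaced? P x)) S)) (placed-unicyclic P) ⟩
    length (L.map edge S)
      ≡⟨ LP.length-map edge S ⟩
    length S
      ≡⟨ sym (length-placed P S) ⟩
    length (placed P) + length (unplaced P)
      ≡⟨ +-comm (length (placed P)) (length (unplaced P)) ⟩
    length (unplaced P) + length (placed P) ∎)
    where open ≤-Reasoning

-- Walks in the functional graph of a placement

pinWeight : Maybe ℕ → ℕ
pinWeight nothing  = 0
pinWeight (just _) = 1

pinCount-∷ : ∀ p ps → pinCount (p ∷ ps) ≡ pinWeight p + pinCount ps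
pinCount-∷ nothing  ps = refl
pinCount-∷ (just _) ps = refl

totalPins-cont : ∀ τ → totalPins (cont ∷ τ) ≡ suc (totalPins τ)
totalPins-cont τ with exit τ
... | false = refl
... | true  = +-suc (pinCount (pins false τ)) (pinCount (pins true τ))

totalPins-jump : ∀ p q b τ → totalPins (jump p q b ∷ τ) ≡ pinWeight p + pinWeight q + totalPins τ
totalPins-jump p q b τ = trans (cong₂ _+_ (pinCount-∷ p (pins false τ)) (pinCount-∷ q (pins true τ)))
  (interchange (pinWeight p) (pinCount (pins false τ)) (pinWeight q) (pinCount (pins true τ)))
  where
  interchange : ∀ a b c d → a + b + (c + d) ≡ a + c + (b + d)
  interchange = solve-∀

jumpAt : Bool → Maybe ℕ → Maybe ℕ → Bool → Step
jumpAt false p q b = jump p q b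
jumpAt true  p q b = jump q p b

module Extraction {u m : ℕ} (S : List (Fin u)) (uS : Unique S) (val : Bool → Fin u → Fin m) where

  open Placements S uS val
  open Placement

  Pinned : Bool → Maybe ℕ → List (Fin u) → Fin u → Set
  Pinned c nothing  xs y = ⊤
  Pinned c (just j) xs y = L.head (L.drop j (L.map (val c) xs)) ≡ just (val c y)

  Visited : List (Fin u) → Bool → Fin m → Set
  Visited xs c v = v ∈ L.map (val c) xs

  visited? : ∀ xs c v → Dec (Visited xs c v)
  visited? xs c v = DecMem._∈?_ _≟_ v (L.map (val c) xs)

  visited-pin : ∀ {xs c y} → Visited xs c (val c y) → ∃[ j ] Pinned c (just j) xs y
  visited-pin = ∈⇒head-drop

  -- The graph on the keys xs has at least e - 1 more edges than vertices.
  record Trace (xs : List (Fin u)) (τ : List Step) (e J : ℕ) : Set where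
    field
      unique  : Unique xs
      inS     : All (_∈ S) xs
      sat     : ∀ c → Sat (pins c τ) (L.map (val c) xs)
      thin    : Thin τ
      excess  : length τ + e ≤ suc (totalPins τ)
      few     : jumpCount τ ≤ J
      length≡ : length τ ≡ length xs
  open Trace

  trace-[] : Trace [] [] 1 0
  trace-[] = record { unique = [] ; inS = [] ; sat = λ _ → tt ; thin = tt
                    ; excess = s≤s z≤n ; few = z≤n ; length≡ = refl }

  trace-weaken : ∀ {xs τ e J J′} → J ≤ J′ → Trace xs τ e J → Trace xs τ e J′
  trace-weaken le t = record
    { unique = unique t ; inS = inS t ; sat = sat t ; thin = thin t
    ; excess = excess t ; few = ≤-trans (few t) le ; length≡ = length≡ t }

  sat-∷ : ∀ c r {xs y ps} → Pinned c r xs y → Sat ps (L.map (val c) xs) → Sat (r ∷ ps) (L.map (val c) (y ∷ xs))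
  sat-∷ c nothing  _       s = s
  sat-∷ c (just j) e s = e , s

  -- A key with w pins brings one edge and 2 - w new vertices, which changes edges minus vertices by
  -- w - 1.
  trace-jump : ∀ {xs τ e J y p q e′} b → Trace xs τ e J → y ∈ S → y ∉ xs →
    Pinned false p xs y → Pinned true q xs y → suc e′ ≤ pinWeight p + pinWeight q + e →
    Trace (y ∷ xs) (jump p q b ∷ τ) e′ (suc J)
  trace-jump {xs} {τ} {e} {J} {y} {p} {q} {e′} b t y∈ y∉ pp pq le = record
    { unique = AllP.¬Any⇒All¬ xs y∉ ∷ unique t
    ; inS = y∈ ∷ inS t
    ; sat = λ { false → sat-∷ false p pp (sat t false) ; true → sat-∷ true q pq (sat t true) }
    ; thin = ≤-trans (m≤m+n _ e′) bound , thin t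
    ; excess = bound
    ; few = s≤s (few t)
    ; length≡ = cong suc (length≡ t) }
    where
    open ≤-Reasoning
    shuffle : ∀ w e l → l + (w + e) ≡ w + (l + e)
    shuffle = solve-∀
    bound : suc (length τ) + e′ ≤ suc (totalPins (jump p q b ∷ τ))
    bound = begin
      suc (length τ) + e′       ≡⟨ sym (+-suc (length τ) e′) ⟩
      length τ + suc e′         ≤⟨ +-monoʳ-≤ (length τ) le ⟩
      length τ + (pinWeight p + pinWeight q + e) ≡⟨ shuffle (pinWeight p + pinWeight q) e (length τ) ⟩
      pinWeight p + pinWeight q + (length τ + e) ≤⟨ +-monoʳ-≤ (pinWeight p + pinWeight q) (excess t) ⟩
      pinWeight p + pinWeight q + suc (totalPins τ) ≡⟨ +-suc _ (totalPins τ) ⟩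
      suc (pinWeight p + pinWeight q + totalPins τ) ≡⟨ cong suc (sym (totalPins-jump p q b τ)) ⟩
      suc (totalPins (jump p q b ∷ τ)) ∎

  trace-jumpAt : ∀ {xs τ e J y p q e′} a b → Trace xs τ e J → y ∈ S → y ∉ xs →
    Pinned a p xs y → Pinned (not a) q xs y → suc e′ ≤ pinWeight p + pinWeight q + e →
    Trace (y ∷ xs) (jumpAt a p q b ∷ τ) e′ (suc J)
  trace-jumpAt false b t y∈ y∉ pp pq le = trace-jump b t y∈ y∉ pp pq le
  trace-jumpAt {e = e} {p = p} {q} true b t y∈ y∉ pp pq le = trace-jump b t y∈ y∉ pq pp
    (≤-trans le (≤-reflexive (cong (_+ e) (+-comm (pinWeight p) (pinWeight q)))))

  trace-cont : ∀ {x xs τ e J y} → Trace (x ∷ xs) τ e J → y ∈ S → y ∉ x ∷ xs →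
    val (exit τ) x ≡ val (exit τ) y → Trace (y ∷ x ∷ xs) (cont ∷ τ) e J
  trace-cont {x} {xs} {τ} {e} t y∈ y∉ eq = record
    { unique = AllP.¬Any⇒All¬ (x ∷ xs) y∉ ∷ unique t
    ; inS = y∈ ∷ inS t
    ; sat = sat′
    ; thin = ≤-trans (m≤m+n _ e) bound , thin t
    ; excess = bound
    ; few = few t
    ; length≡ = cong suc (length≡ t) }
    where
    bound : suc (length τ) + e ≤ suc (totalPins (cont ∷ τ))
    bound = s≤s (≤-trans (excess t) (≤-reflexive (sym (totalPins-cont τ))))
    sat′ : ∀ c → Sat (pins c (cont ∷ τ)) (L.map (val c) (_ ∷ x ∷ xs))
    sat′ c with exit τ BoolP.≟ c
    ... | yes refl = cong just eq , sat t c
    ... | no _     = sat t c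

  module _ (P : Placement) where

    -- The condition for starting a walk at v: the occupant of v, if any, is a key that has not been
    -- read.
    Unoccupied : List (Fin u) → Bool → Fin m → Set
    Unoccupied xs a v = ∀ {y} → y ∈ xs → pos P y ≡ just a → val a y ≢ v

    -- What a walk from v leaves intact: it reads placed keys only, and apart from v it reads no
    -- occupant of a vertex visited before. Thus `keeps` allows a second walk from the other
    -- endpoint of an unplaced key.
    record Extends (xs : List (Fin u)) (a : Bool) (v : Fin m) (ys : List (Fin u)) : Set where
      field
        ⊇       : ∀ {y} → y ∈ xs → y ∈ ys
        stashed : ∀ {y} → y ∈ ys → pos P y ≡ nothing → y ∈ xs
        keeps   : ∀ b w → Visited xs b w → ¬ (b ≡ a × w ≡ v) → Unoccupied xs b w → Unoccupied ys b w
    open Extends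

    extends-∷ : ∀ {xs a y} → pos P y ≡ just a → Extends xs a (val a y) (y ∷ xs)
    extends-∷ {xs} {a} {y} py = record
      { ⊇ = there
      ; stashed = λ { (here refl) e → contradiction (trans (sym py) e) λ () ; (there p) _ → p }
      ; keeps = λ { b w vis ne un (here refl) pz eq → ne (MaybeP.just-injective (trans (sym pz) py) , trans (sym eq) (side pz))
                  ; b w vis ne un (there p) pz eq → un p pz eq } }
      where
      side : ∀ {b} → pos P y ≡ just b → val b y ≡ val a y
      side pz = cong (λ c → val c y) (MaybeP.just-injective (trans (sym pz) py))

    extends-trans : ∀ {xs a y b ys} → pos P y ≡ just a → ¬ Visited xs b (val b y) →
      Extends (y ∷ xs) b (val b y) ys → Extends xs a (val a y) ys
    extends-trans {xs} {a} {y} {b} py new ext = record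
      { ⊇ = ⊇ ext ∘ there
      ; stashed = λ p e → stashed (extends-∷ py) (stashed ext p e) e
      ; keeps = λ c w vis ne un → keeps ext c w (there vis) (λ { (refl , refl) → new vis })
                                    (keeps (extends-∷ py) c w vis ne un) }

    -- Abstracts how the template takes in the next key, because the first key of a walk needs a
    -- jump and later ones a `cont`. In `finish` both endpoints are pinned, which gains one edge
    -- over the vertices.
    record Next (xs : List (Fin u)) (a : Bool) (y : Fin u) (e J : ℕ) : Set where
      field
        proceed : ∃[ τ ] exit τ ≡ not a × Trace (y ∷ xs) τ e J
        finish  : Visited xs (not a) (val (not a) y) → ∃[ τ ] Trace (y ∷ xs) τ (suc e) (suc J)
    open Next

    -- Follows v ↦ "other endpoint of the occupant of v": either the walk reaches an empty
    -- vertex, and its keys can be shifted to free v, or it closes at a visited vertex and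
    -- has added one more edge than vertices.
    walk : ∀ (fuel : ℕ) {xs a v e J} → Unique xs → All (_∈ S) xs → length S ≤ fuel + length xs → Unoccupied xs a v →
      (∀ {y} → y ∈ S → y ∉ xs → val a y ≡ v → Next xs a y e J) →
      Free P a v ⊎ (∃[ ys ] ∃[ τ ] Extends xs a v ys × Trace ys τ (suc e) (suc J))
    walk fuel {xs} {a} {v} uxs xs∈S bound un next with occupied? P a v
    ... | inj₂ emp = inj₁ (empty emp)
    ... | inj₁ (y , py , refl) = dispatch fuel bound
      where
      y∈S : y ∈ S
      y∈S = placed∈S P py
      y∉xs : y ∉ xs
      y∉xs y∈ = un y∈ py refl
      v′ : Fin m
      v′ = val (not a) y
      unique′ : Unique (y ∷ xs)
      unique′ = AllP.¬Any⇒All¬ xs y∉xs ∷ uxs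
      dispatch : ∀ fuel → length S ≤ fuel + length xs →
        Free P a (val a y) ⊎ (∃[ ys ] ∃[ τ ] Extends xs a (val a y) ys × Trace ys τ (suc _) (suc _))
      -- Fuel bounds the number of unread keys of S; at zero, y would be one key too many.
      dispatch zero bound = contradiction bound (<⇒≱ (Unique⇒length≤ unique′ λ
        { (here refl) → y∈S ; (there p) → All.lookup xs∈S p }))
      dispatch (suc fuel) bound with visited? xs (not a) v′
      ... | yes vis = let τ , t = finish (next y∈S y∉xs refl) vis in inj₂ (y ∷ xs , τ , extends-∷ py , t)
      ... | no new with proceed (next y∈S y∉xs refl)
      ...   | τ , ex , t with walk fuel {y ∷ xs} {not a} {v′} unique′ (y∈S ∷ xs∈S)
                (≤-trans bound (≤-reflexive (sym (+-suc fuel (length xs))))) un′ next′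
        where
        -- The key y sits on side a, and an older key sitting at v′ would have made v′ visited.
        un′ : Unoccupied (y ∷ xs) (not a) v′
        un′ (here refl) pz _  = contradiction (MaybeP.just-injective (trans (sym pz) py)) (not≢ a)
        un′ (there z∈)  pz eq = new (subst (_∈ L.map (val (not a)) xs) eq (∈-map⁺ (val (not a)) z∈))
        next′ : ∀ {z} → z ∈ S → z ∉ y ∷ xs → val (not a) z ≡ v′ → Next (y ∷ xs) (not a) z _ _
        next′ {z} z∈S z∉ eq = record
          { proceed = cont ∷ τ , cong not ex , trace-cont t z∈S z∉ (trans (cong (λ c → val c y) ex) (trans (sym eq) (cong (λ c → val c z) (sym ex))))
          ; finish = λ vis → let j , pin = visited-pin vis in
              -- `just 0` is the pin that `cont` would set; a jump is needed to set the second pin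
              -- as well. The exit side is arbitrary, since the walk ends here.
              jumpAt (not a) (just 0) (just j) false ∷ τ ,
              trace-jumpAt (not a) false t z∈S z∉ (cong just (sym eq)) pin ≤-refl }
      ...     | inj₁ fr = inj₁ (evict py fr)
      ...     | inj₂ (ys , τ′ , ext , t′) = inj₂ (ys , τ′ , extends-trans py new ext , t′)

    -- The two additional jumps are the one that resumes reading at v and the one that closes the
    -- walk.
    startWalk : ∀ {xs τ e J a v} → Trace xs τ e J → Visited xs a v → Unoccupied xs a v →
      Free P a v ⊎ (∃[ ys ] ∃[ τ′ ] Extends xs a v ys × Trace ys τ′ (suc e) (2 + J))
    startWalk {xs} {τ} {e} {J} {a} {v} t vis un =
      walk (length S) (unique t) (inS t) (m≤m+n (length S) (length xs)) un next
      where
      next : ∀ {y} → y ∈ S → y ∉ xs → val a y ≡ v → Next xs a y e (suc J)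
      next {y} y∈S y∉ refl = let i , pin = visited-pin vis in record
        { proceed = jumpAt a (just i) nothing (not a) ∷ τ , exit-jumpAt a , trace-jumpAt a (not a) t y∈S y∉ pin tt ≤-refl
        ; finish = λ vis′ → let j , pin′ = visited-pin vis′ in
            jumpAt a (just i) (just j) false ∷ τ ,
            trace-weaken (n≤1+n _) (trace-jumpAt a false t y∈S y∉ pin pin′ ≤-refl) }
        where
        exit-jumpAt : ∀ a {i} → exit (jumpAt a (just i) nothing (not a) ∷ τ) ≡ not a
        exit-jumpAt false = refl
        exit-jumpAt true  = refl

    Augmenting : List (Fin u) → Set
    Augmenting rs = ∃[ x ] x ∈ rs × ∃[ a ] Free P a (val a x)

    -- Reading an unplaced key x costs one unit of surplus, and each endpoint returns one: a visited
    -- endpoint through a pin, a new one through the walk that starts there. The net gain is one per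
    -- key. The 5 counts one jump for x and two for each walk. The last component ensures that the
    -- next unplaced key is unread.
    build : (rs : List (Fin u)) → Unique rs → All (λ x → x ∈ S × pos P x ≡ nothing) rs →
      Augmenting rs ⊎
      (∃[ xs ] ∃[ τ ] Trace xs τ (suc (length rs)) (length rs * 5) × (∀ {y} → y ∈ xs → pos P y ≡ nothing → y ∈ rs))
    build []       urs         ars = inj₂ ([] , [] , trace-[] , λ ())
    build (x ∷ rs) (px ∷ urs) ((x∈S , px≡) ∷ ars) with build rs urs ars
    ... | inj₁ (y , y∈ , fr) = inj₁ (y , there y∈ , fr)
    ... | inj₂ (xs , τ , t , stash) = add (visited? xs false (val false x)) (visited? xs true (val true x))
      where
      x∉xs : x ∉ xs
      x∉xs x∈ = All.lookup px (stash x∈ px≡) refl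
      stash-x : ∀ {y} → y ∈ x ∷ xs → pos P y ≡ nothing → y ∈ x ∷ rs
      stash-x (here refl) _ = here refl
      stash-x (there p)   e = there (stash p e)
      fresh : ∀ a → ¬ Visited xs a (val a x) → Unoccupied (x ∷ xs) a (val a x)
      fresh a new (here refl) pz eq = contradiction (trans (sym px≡) pz) λ ()
      fresh a new (there z∈)  pz eq = new (subst (_∈ L.map (val a) xs) eq (∈-map⁺ (val a) z∈))
      Goal : Set
      Goal = Augmenting (x ∷ rs) ⊎
        (∃[ xs ] ∃[ τ ] Trace xs τ (suc (suc (length rs))) (suc (length rs) * 5) ×
          (∀ {y} → y ∈ xs → pos P y ≡ nothing → y ∈ x ∷ rs))
      one : ∀ a {τ} → ¬ Visited xs a (val a x) → Trace (x ∷ xs) τ (suc (length rs)) (suc (length rs * 5)) → Goal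
      one a new t′ with startWalk t′ (here refl) (fresh a new)
      ... | inj₁ fr = inj₁ (x , here refl , a , fr)
      ... | inj₂ (ys , τ′ , ext , t″) = inj₂ (ys , τ′ , trace-weaken (+-monoˡ-≤ (length rs * 5) (s≤s (s≤s (s≤s (z≤n {2}))))) t″ ,
        λ y∈ e → stash-x (stashed ext y∈ e) e)
      add : Dec (Visited xs false (val false x)) → Dec (Visited xs true (val true x)) → Goal
      add (yes v₁) (yes v₂) = let i , p = visited-pin v₁ ; j , q = visited-pin v₂ in
        inj₂ (x ∷ xs , _ , trace-weaken (+-monoˡ-≤ (length rs * 5) (s≤s (z≤n {4}))) (trace-jump {p = just i} {just j} false t x∈S x∉xs p q ≤-refl) , stash-x)
      add (yes v₁) (no n₂) = let i , p = visited-pin v₁ in one true n₂ (trace-jump {p = just i} false t x∈S x∉xs p tt ≤-refl)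
      add (no n₁) (yes v₂) = let j , q = visited-pin v₂ in one false n₁ (trace-jump {q = just j} false t x∈S x∉xs tt q ≤-refl)
      add (no n₁) (no n₂) with startWalk {τ = jump nothing nothing false ∷ τ} {e = length rs} (trace-jump false t x∈S x∉xs tt tt ≤-refl) (here refl) (fresh false n₁)
      ... | inj₁ fr = inj₁ (x , here refl , false , fr)
      ... | inj₂ (ys , τ′ , ext , t′) with startWalk t′ (∈-map⁺ (val true) (⊇ ext (here refl)))
                                            (keeps ext true (val true x) (here refl) (λ ()) (fresh true n₂))
      ...   | inj₁ fr = inj₁ (x , here refl , true , fr)
      ...   | inj₂ (zs , τ″ , ext′ , t″) = inj₂ (zs , τ″ , t″ , λ y∈ e → stash-x (stashed ext (stashed ext′ y∈ e) e) e)

  -- Every placement leaves at least s keys out, while each augmentation reduces their number. Hence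
  -- augmentation must fail at some point, and `build` then returns a trace.
  extract : (s : ℕ) → ExcessAtLeast (L.map edge S) s → ∃[ xs ] ∃[ τ ] Trace xs τ (suc s) (s * 5)
  extract zero    ex = [] , [] , trace-[]
  extract (suc s) ex = go (length (unplaced start)) start ≤-refl
    where
    start : Placement
    start = record { pos = λ _ → nothing ; placed∈S = λ () ; injective = λ () }
    go : ∀ fuel P → length (unplaced P) ≤ fuel → ∃[ xs ] ∃[ τ ] Trace xs τ (suc (suc s)) (suc s * 5)
    go zero       P le = contradiction (≤-trans (excess⇒unplaced ex P) le) λ ()
    go (suc fuel) P le with build P (take (suc s) (unplaced P)) (take⁺ (suc s) (filter⁺ (unplaced? P) uS))
           (AllP.take⁺ (suc s) (All.tabulate (∈-filter⁻ (unplaced? P) {xs = S})))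
    ... | inj₁ (x , x∈ , a , fr) with augment P (SubP.Any-resp-⊆ (SubP.take-⊆ (suc s) (unplaced P)) x∈) fr
    ...   | P′ , lt = go fuel P′ (≤-pred (≤-trans lt le))
    go (suc fuel) P le | inj₂ (xs , τ , t , _) = xs , τ ,
      subst (λ n → Trace xs τ (suc n) (n * 5)) (trans (LP.length-take (suc s) (unplaced P)) (m≤n⇒m⊓n≡m (excess⇒unplaced ex P))) t

-- Arithmetic-geometric series

-- m^N times the partial sum of (t+1)^D (n/m)^t, cleared of denominators.
series : (n m D N : ℕ) → ℕ
series n m D N = ∑[ t ∈ downFrom N ] suc t ^ D * n ^ t * m ^ (N ∸ t)

-- This is K^(D+1) D!, where K bounds m / (m - n).
seriesBound : ℕ → ℕ → ℕ
seriesBound K zero    = K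
seriesBound K (suc D) = K * suc D * seriesBound K D

series-suc : ∀ n m D N → series n m D (suc N) ≡ suc N ^ D * n ^ N * m + m * series n m D N
series-suc n m D N = cong₂ _+_
  (cong (suc N ^ D * n ^ N *_) (trans (cong (m ^_) (m+n∸n≡m 1 N)) (*-identityʳ m)))
  (trans (≤-antisym (∑-mono-∈ (downFrom N) (λ t∈ → ≤-reflexive (term (∈-downFrom⁻ t∈))))
                    (∑-mono-∈ (downFrom N) (λ t∈ → ≤-reflexive (sym (term (∈-downFrom⁻ t∈))))))
         (sym (∑-*ˡ (downFrom N) _ m)))
  where
  rot : ∀ a b c → a * (b * c) ≡ b * (a * c)
  rot = solve-∀
  term : ∀ {t} → t < N → suc t ^ D * n ^ t * m ^ (suc N ∸ t) ≡ m * (suc t ^ D * n ^ t * m ^ (N ∸ t))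
  term {t} t<N = trans (cong (λ e → suc t ^ D * n ^ t * m ^ e) (+-∸-assoc 1 (<⇒≤ t<N))) (rot (suc t ^ D * n ^ t) m (m ^ (N ∸ t)))

-- A discrete derivative: the difference of consecutive (D+1)-st powers is at most (D+1) times the
-- larger base to the D.
power-step : ∀ D N → suc N ^ suc D ≤ N ^ suc D + suc D * suc N ^ D
power-step zero    N = ≤-reflexive (lem N)
  where
  lem : ∀ N → suc N * 1 ≡ N * 1 + 1 * 1
  lem = solve-∀
power-step (suc D) N = begin
  suc N * suc N ^ suc D                            ≡⟨⟩
  suc N ^ suc D + N * suc N ^ suc D                ≤⟨ +-monoʳ-≤ (suc N ^ suc D) (*-monoʳ-≤ N (power-step D N)) ⟩
  suc N ^ suc D + N * (N ^ suc D + suc D * suc N ^ D)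
    ≡⟨ expand (suc N ^ suc D) N (N ^ suc D) (suc D) (suc N ^ D) ⟩
  N * N ^ suc D + (suc N ^ suc D + suc D * (N * suc N ^ D))
    ≤⟨ +-monoʳ-≤ (N * N ^ suc D) (+-monoʳ-≤ (suc N ^ suc D) (*-monoʳ-≤ (suc D) (*-monoˡ-≤ (suc N ^ D) (n≤1+n N)))) ⟩
  N * N ^ suc D + suc (suc D) * suc N ^ suc D ∎
  where
  open ≤-Reasoning
  expand : ∀ a n b d e → a + n * (b + d * e) ≡ n * b + (a + d * (n * e))
  expand = solve-∀

-- (1 - n/m) Σ (t+1)^D (n/m)^t telescopes; both sides are kept free of subtraction.
series-telescope₀ : ∀ n m N → m * series n m 0 N + m * n ^ N ≤ n * series n m 0 N + m * m ^ N
series-telescope₀ n m zero    = ≤-reflexive (cong₂ _+_ (trans (*-zeroʳ m) (sym (*-zeroʳ n))) refl)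
series-telescope₀ n m (suc N) = begin
  m * series n m 0 (suc N) + m * (n * n ^ N)
    ≡⟨ cong (λ e → m * e + m * (n * n ^ N)) (series-suc n m 0 N) ⟩
  m * (1 * n ^ N * m + m * series n m 0 N) + m * (n * n ^ N)
    ≡⟨ regroup m n (n ^ N) (series n m 0 N) ⟩
  m * (m * series n m 0 N + m * n ^ N) + n * (1 * n ^ N * m)
    ≤⟨ +-monoˡ-≤ (n * (1 * n ^ N * m)) (*-monoʳ-≤ m (series-telescope₀ n m N)) ⟩
  m * (n * series n m 0 N + m * m ^ N) + n * (1 * n ^ N * m)
    ≡⟨ regroup′ m n (n ^ N) (series n m 0 N) (m ^ N) ⟩
  n * (1 * n ^ N * m + m * series n m 0 N) + m * (m * m ^ N)
    ≡⟨ cong (λ e → n * e + m * (m * m ^ N)) (sym (series-suc n m 0 N)) ⟩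
  n * series n m 0 (suc N) + m * (m * m ^ N) ∎
  where
  open ≤-Reasoning
  regroup : ∀ m n p s → m * (1 * p * m + m * s) + m * (n * p) ≡ m * (m * s + m * p) + n * (1 * p * m)
  regroup = solve-∀
  regroup′ : ∀ m n p s q → m * (n * s + m * q) + n * (1 * p * m) ≡ n * (1 * p * m + m * s) + m * (m * q)
  regroup′ = solve-∀

-- Summation by parts: by `power-step`, differences of the coefficients lower the degree by one. The
-- boundary term on the left is what carries the induction on N.
series-telescope : ∀ n m D N →
  m * series n m (suc D) N + m * (N ^ suc D * n ^ N) ≤ n * series n m (suc D) N + suc D * (m * series n m D N)
series-telescope n m D zero    = ≤-trans (≤-reflexive (cong₂ _+_ (*-zeroʳ m) (*-zeroʳ m))) z≤n
series-telescope n m D (suc N) = begin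
  m * series n m (suc D) (suc N) + m * (suc N ^ suc D * (n * n ^ N))
    ≡⟨ cong (λ e → m * e + m * (suc N ^ suc D * (n * n ^ N))) (series-suc n m (suc D) N) ⟩
  m * (suc N ^ suc D * n ^ N * m + m * s) + m * (suc N ^ suc D * (n * n ^ N))
    ≡⟨ regroup m n (n ^ N) s (suc N ^ suc D) ⟩
  m * (m * s + m * (suc N ^ suc D * n ^ N)) + n * (suc N ^ suc D * n ^ N * m)
    ≤⟨ +-monoˡ-≤ (n * (suc N ^ suc D * n ^ N * m)) (*-monoʳ-≤ m (+-monoʳ-≤ (m * s) (*-monoʳ-≤ m (*-monoˡ-≤ (n ^ N) (power-step D N))))) ⟩
  m * (m * s + m * ((N ^ suc D + suc D * suc N ^ D) * n ^ N)) + n * (suc N ^ suc D * n ^ N * m)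
    ≡⟨ regroup₂ m n (n ^ N) s (suc N ^ suc D) (N ^ suc D) (suc D) (suc N ^ D) ⟩
  m * (m * s + m * (N ^ suc D * n ^ N)) + (n * (suc N ^ suc D * n ^ N * m) + suc D * (m * (suc N ^ D * n ^ N * m)))
    ≤⟨ +-monoˡ-≤ (n * (suc N ^ suc D * n ^ N * m) + suc D * (m * (suc N ^ D * n ^ N * m))) (*-monoʳ-≤ m (series-telescope n m D N)) ⟩
  m * (n * s + suc D * (m * s′)) + (n * (suc N ^ suc D * n ^ N * m) + suc D * (m * (suc N ^ D * n ^ N * m)))
    ≡⟨ regroup₃ m n s s′ (suc N ^ suc D * n ^ N * m) (suc N ^ D * n ^ N * m) (suc D) ⟩
  n * (suc N ^ suc D * n ^ N * m + m * s) + suc D * (m * (suc N ^ D * n ^ N * m + m * s′))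
    ≡⟨ cong₂ (λ e f → n * e + suc D * (m * f)) (sym (series-suc n m (suc D) N)) (sym (series-suc n m D N)) ⟩
  n * series n m (suc D) (suc N) + suc D * (m * series n m D (suc N)) ∎
  where
  open ≤-Reasoning
  s  = series n m (suc D) N
  s′ = series n m D N
  regroup : ∀ m n p s q → m * (q * p * m + m * s) + m * (q * (n * p)) ≡ m * (m * s + m * (q * p)) + n * (q * p * m)
  regroup = solve-∀
  regroup₂ : ∀ m n p s q a d b → m * (m * s + m * ((a + d * b) * p)) + n * (q * p * m) ≡
    m * (m * s + m * (a * p)) + (n * (q * p * m) + d * (m * (b * p * m)))
  regroup₂ = solve-∀
  regroup₃ : ∀ m n s s′ a b d → m * (n * s + d * (m * s′)) + (n * a + d * (m * b)) ≡ n * (a + m * s) + d * (m * (b + m * s′))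
  regroup₃ = solve-∀

module _ {n m K : ℕ} .{{_ : NonZero m}} (gap : m + K * n ≤ K * m) where

  -- The hypothesis gap says m ≤ K (m - n).
  gap-bound : ∀ x y → m * x ≤ n * x + m * y → x ≤ K * y
  gap-bound x y le = *-cancelˡ-≤ m (+-cancelʳ-≤ (K * n * x) (m * x) (m * (K * y)) (begin
    m * x + K * n * x          ≡⟨ sym (*-distribʳ-+ x m (K * n)) ⟩
    (m + K * n) * x            ≤⟨ *-monoˡ-≤ x gap ⟩
    K * m * x                  ≡⟨ *-assoc K m x ⟩
    K * (m * x)                ≤⟨ *-monoʳ-≤ K le ⟩
    K * (n * x + m * y)        ≡⟨ regroup K n x m y ⟩
    m * (K * y) + K * n * x ∎))
    where
    open ≤-Reasoning
    regroup : ∀ K n x m y → K * (n * x + m * y) ≡ m * (K * y) + K * n * x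
    regroup = solve-∀

  series-bound : ∀ D N → series n m D N ≤ seriesBound K D * m ^ N
  series-bound zero    N = gap-bound (series n m 0 N) (m ^ N) (≤-trans (m≤m+n _ _) (series-telescope₀ n m N))
  series-bound (suc D) N = begin
    series n m (suc D) N
      ≤⟨ gap-bound (series n m (suc D) N) (suc D * series n m D N)
           (≤-trans (m≤m+n _ _) (≤-trans (series-telescope n m D N)
             (≤-reflexive (cong (n * series n m (suc D) N +_) (rot (suc D) m (series n m D N)))))) ⟩
    K * (suc D * series n m D N)              ≤⟨ *-monoʳ-≤ K (*-monoʳ-≤ (suc D) (series-bound D N)) ⟩
    K * (suc D * (seriesBound K D * m ^ N))   ≡⟨ assoc K (suc D) (seriesBound K D) (m ^ N) ⟩
    seriesBound K (suc D) * m ^ N ∎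
    where
    open ≤-Reasoning
    rot : ∀ a b c → a * (b * c) ≡ b * (a * c)
    rot = solve-∀
    assoc : ∀ a b c d → a * (b * (c * d)) ≡ a * b * c * d
    assoc = solve-∀

-- Rational hypotheses over the natural numbers

private
  toℚᵘ-nat : ∀ n → toℚᵘ ((ℤ⁺ n) ℚ./ 1) ℚᵘ.≃ mkℚᵘ (ℤ⁺ n) 0
  toℚᵘ-nat n = ℚP.toℚᵘ-fromℚᵘ (mkℚᵘ (ℤ⁺ n) 0)

exponent-condition : (δ : ℚ) (s k c : ℕ) → 0ℚ ℚ.< δ →
  (ℤ⁺ (s + 2)) ℚ./ 1 ℚ.≤ (δ ℚ.* ((ℤ⁺ k) ℚ./ 1)) ℚ.* ((ℤ⁺ c) ℚ./ 1) →
  (s + 2) * ↧ₙ δ ≤ ∣ ↥ δ ∣ * (k * c)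
exponent-condition (mkℚ -[1+ _ ] _ _) s k c (ℚ.*<* ()) le
exponent-condition δ@(mkℚ (ℤ⁺ p) d _) s k c _ le = ℤP.drop‿+≤+ (begin
  ℤ⁺ ((s + 2) * suc d)                        ≡⟨ cong (λ e → ℤ⁺ ((s + 2) * e)) (sym (trans (*-identityʳ (suc d * 1)) (*-identityʳ (suc d)))) ⟩
  ℤ⁺ ((s + 2) * (suc d * 1 * 1))              ≡⟨ ℤP.pos-* (s + 2) (suc d * 1 * 1) ⟩
  ℤ⁺ (s + 2) ℤ.* ℤ⁺ (suc d * 1 * 1)            ≤⟨ ℚᵘP.drop-*≤* ineq ⟩
  (ℤ⁺ p ℤ.* ℤ⁺ k) ℤ.* ℤ⁺ c ℤ.* ℤ⁺ 1              ≡⟨ trans (ℤP.*-identityʳ ((ℤ⁺ p ℤ.* ℤ⁺ k) ℤ.* ℤ⁺ c)) (cong (ℤ._* ℤ⁺ c) (sym (ℤP.pos-* p k))) ⟩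
  ℤ⁺ (p * k) ℤ.* ℤ⁺ c                          ≡⟨ sym (ℤP.pos-* (p * k) c) ⟩
  ℤ⁺ (p * k * c)                              ≡⟨ cong ℤ⁺ (*-assoc p k c) ⟩
  ℤ⁺ (p * (k * c)) ∎)
  where
  open ℤP.≤-Reasoning
  ineq : mkℚᵘ (ℤ⁺ (s + 2)) 0 ℚᵘ.≤ (mkℚᵘ (ℤ⁺ p) d ℚᵘ.* mkℚᵘ (ℤ⁺ k) 0) ℚᵘ.* mkℚᵘ (ℤ⁺ c) 0
  ineq = ℚᵘP.≤-respˡ-≃ (toℚᵘ-nat (s + 2)) (ℚᵘP.≤-respʳ-≃
    (ℚᵘP.≃-trans (ℚP.toℚᵘ-homo-* (δ ℚ.* ((ℤ⁺ k) ℚ./ 1)) ((ℤ⁺ c) ℚ./ 1))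
      (ℚᵘP.*-cong (ℚᵘP.≃-trans (ℚP.toℚᵘ-homo-* δ ((ℤ⁺ k) ℚ./ 1)) (ℚᵘP.*-cong ℚᵘP.≃-refl (toℚᵘ-nat k))) (toℚᵘ-nat c)))
    (ℚP.toℚᵘ-mono-≤ le))

-- For ε = a / b, the bound m ≥ (1 + ε) n gives m / (m - n) ≤ (1 + ε) / ε = (a + b) / a ≤ a + b.
gapConstant : ℚ → ℕ
gapConstant ε = ∣ ↥ ε ∣ + ↧ₙ ε

gap-condition : (ε : ℚ) → 0ℚ ℚ.< ε → (n m : ℕ) → (1ℚ ℚ.+ ε) ℚ.* ((ℤ⁺ n) ℚ./ 1) ℚ.≤ (ℤ⁺ m) ℚ./ 1 →
  m + gapConstant ε * n ≤ gapConstant ε * m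
gap-condition (mkℚ -[1+ _ ] _ _) (ℚ.*<* ()) n m le
gap-condition (mkℚ (ℤ⁺ zero) _ _) (ℚ.*<* (ℤ.+<+ ())) n m le
gap-condition ε@(mkℚ (ℤ⁺ (suc a)) b _) _ n m le = begin
  m + (suc a + suc b) * n    ≤⟨ +-monoʳ-≤ m cross ⟩
  m + m * suc b              ≤⟨ m≤m+n (m + m * suc b) (a * m) ⟩
  m + m * suc b + a * m      ≡⟨ regroup m (suc b) a ⟩
  (suc a + suc b) * m ∎
  where
  open ≤-Reasoning
  regroup : ∀ m b a → m + m * b + a * m ≡ (suc a + b) * m
  regroup = solve-∀
  ineq : (mkℚᵘ (ℤ⁺ 1) 0 ℚᵘ.+ mkℚᵘ (ℤ⁺ (suc a)) b) ℚᵘ.* mkℚᵘ (ℤ⁺ n) 0 ℚᵘ.≤ mkℚᵘ (ℤ⁺ m) 0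
  ineq = ℚᵘP.≤-respʳ-≃ (toℚᵘ-nat m) (ℚᵘP.≤-respˡ-≃
    (ℚᵘP.≃-trans (ℚP.toℚᵘ-homo-* (1ℚ ℚ.+ ε) ((ℤ⁺ n) ℚ./ 1))
      (ℚᵘP.*-cong (ℚP.toℚᵘ-homo-+ 1ℚ ε) (toℚᵘ-nat n)))
    (ℚP.toℚᵘ-mono-≤ le))
  cross : (suc a + suc b) * n ≤ m * suc b
  cross = ℤP.drop‿+≤+ (ℤP.≤-trans (ℤP.≤-reflexive lhs) (ℤP.≤-trans (ℚᵘP.drop-*≤* ineq) (ℤP.≤-reflexive rhs)))
    where
    solveL : ∀ x y z → (x ℤ.+ y) ℤ.* z ≡ (ℤ⁺ 1 ℤ.* y ℤ.+ x ℤ.* ℤ⁺ 1) ℤ.* z ℤ.* ℤ⁺ 1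
    solveL = solveℤ-∀
    lhs : ℤ⁺ ((suc a + suc b) * n) ≡ (ℤ⁺ 1 ℤ.* ℤ⁺ (suc b) ℤ.+ ℤ⁺ (suc a) ℤ.* ℤ⁺ 1) ℤ.* ℤ⁺ n ℤ.* ℤ⁺ 1
    lhs = trans (ℤP.pos-* (suc a + suc b) n) (solveL (ℤ⁺ (suc a)) (ℤ⁺ (suc b)) (ℤ⁺ n))
    rhs : ℤ⁺ m ℤ.* ℤ⁺ (1 * suc b * 1) ≡ ℤ⁺ (m * suc b)
    rhs = trans (sym (ℤP.pos-* m (1 * suc b * 1))) (cong (λ e → ℤ⁺ (m * e)) (trans (*-identityʳ (1 * suc b)) (*-identityˡ (suc b))))

^-distribʳ-* : ∀ m n o → (m * n) ^ o ≡ m ^ o * n ^ o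
^-distribʳ-* m n zero    = refl
^-distribʳ-* m n (suc o) = trans (cong (m * n *_) (^-distribʳ-* m n o)) (interchange m n (m ^ o) (n ^ o))
  where
  interchange : ∀ a b c d → a * b * (c * d) ≡ a * c * (b * d)
  interchange = solve-∀

^-cancelʳ-≤ : ∀ q .{{_ : NonZero q}} {x y} → x ^ q ≤ y ^ q → x ≤ y
^-cancelʳ-≤ q {x} {y} le with x ≤? y
... | yes x≤y = x≤y
... | no x≰y = contradiction le (<⇒≱ (^-monoˡ-< q (≰⇒> x≰y)))

rounded-positive : (δ : ℚ) {n ℓ : ℕ} → 1 ≤ n → RoundedPow n δ ℓ → 1 ≤ ℓ
rounded-positive δ {n} {suc ℓ} _ _ = s≤s z≤n
rounded-positive δ {suc n} {zero} _ (_ , lt) =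
  contradiction (m^n>0 (suc n) ∣ ↥ δ ∣) (<⇒≱ (≤-trans lt (≤-reflexive (^-zeroˡ (↧ₙ δ)))))

-- The condition on c gives n^(s+2) ≤ (n^δ)^(k c), and n^δ < ℓ + 1 ≤ 2 ℓ whichever way ℓ is rounded.
-- With δ = p / q, the q-th powers are compared to avoid roots.
rounded-power : (δ : ℚ) (s k c : ℕ) {n ℓ : ℕ} → 1 ≤ n → 0ℚ ℚ.< δ →
  (ℤ⁺ (s + 2)) ℚ./ 1 ℚ.≤ (δ ℚ.* ((ℤ⁺ k) ℚ./ 1)) ℚ.* ((ℤ⁺ c) ℚ./ 1) → RoundedPow n δ ℓ →
  n ^ (s + 2) ≤ (2 * ℓ) ^ (k * c)
rounded-power δ@(mkℚ _ d _) s k c {n@(suc _)} {ℓ} n≥1 δ>0 cond r@(_ , lt) = ^-cancelʳ-≤ q (begin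
  (n ^ (s + 2)) ^ q        ≡⟨ ^-*-assoc n (s + 2) q ⟩
  n ^ ((s + 2) * q)        ≤⟨ ^-monoʳ-≤ n (exponent-condition δ s k c δ>0 cond) ⟩
  n ^ (p * (k * c))        ≡⟨ sym (^-*-assoc n p (k * c)) ⟩
  (n ^ p) ^ (k * c)        ≤⟨ ^-monoˡ-≤ (k * c) (<⇒≤ lt) ⟩
  (suc ℓ ^ q) ^ (k * c)    ≤⟨ ^-monoˡ-≤ (k * c) (^-monoˡ-≤ q suc≤double) ⟩
  ((2 * ℓ) ^ q) ^ (k * c)  ≡⟨ trans (^-*-assoc (2 * ℓ) q (k * c)) (trans (cong ((2 * ℓ) ^_) (*-comm q (k * c))) (sym (^-*-assoc (2 * ℓ) (k * c) q))) ⟩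
  ((2 * ℓ) ^ (k * c)) ^ q ∎)
  where
  open ≤-Reasoning
  p = ∣ ↥ δ ∣
  q = ↧ₙ δ
  suc≤double : suc ℓ ≤ 2 * ℓ
  suc≤double = ≤-trans (+-monoˡ-≤ ℓ (rounded-positive δ n≥1 r)) (≤-reflexive (cong (λ e → ℓ + e) (sym (+-identityʳ ℓ))))

-- Key sequences that witness a large excess

sat-tail : ∀ {r} p ps {w : Fin r} {ws} → Sat (p ∷ ps) (w ∷ ws) → Sat ps ws
sat-tail nothing  _ s       = s
sat-tail (just _) _ (_ , s) = s

sat-length : ∀ {r} ps (ws : List (Fin r)) → Sat ps ws → length ps ≡ length ws
sat-length []             []       _       = refl
sat-length (nothing ∷ ps) (_ ∷ ws) s       = cong suc (sat-length ps ws s)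
sat-length (just _ ∷ ps)  (_ ∷ ws) (_ , s) = cong suc (sat-length ps ws s)

length-pins : ∀ c τ → length (pins c τ) ≡ length τ
length-pins c []      = refl
length-pins c (s ∷ τ) = cong suc (length-pins c τ)

head-drop-< : ∀ j {xs : List A} {x} → L.head (L.drop j xs) ≡ just x → j < length xs
head-drop-< zero    {_ ∷ _} _ = s≤s z≤n
head-drop-< (suc j) {_ ∷ _} e = s≤s (head-drop-< j e)

sat-pinBelow : ∀ {r T} p ps {w : Fin r} ws → Sat (p ∷ ps) (w ∷ ws) → length ws ≤ T → PinBelow T p
sat-pinBelow nothing  ps ws _       le = tt
sat-pinBelow (just j) ps ws (e , _) le = ≤-trans (head-drop-< j e) le

-- A pin holds only if its target exists. Following a template therefore bounds its pointers by the
-- length of the word, and places it in a finite list of templates.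
sat-below : ∀ {r T} τ (vs ws : List (Fin r)) → Sat (pins false τ) vs → Sat (pins true τ) ws →
  length vs ≤ T → length ws ≤ T → All (StepBelow T) τ
sat-below []      _        _        _  _  _  _  = []
sat-below (s ∷ τ) (v ∷ vs) (w ∷ ws) s₁ s₂ l₁ l₂ =
  step s s₁ s₂ ∷
  sat-below τ vs ws (sat-tail (pin false s τ) (pins false τ) s₁) (sat-tail (pin true s τ) (pins true τ) s₂) l₁′ l₂′
  where
  l₁′ = ≤-trans (n≤1+n _) l₁
  l₂′ = ≤-trans (n≤1+n _) l₂
  step : ∀ s → Sat (pins false (s ∷ τ)) (v ∷ vs) → Sat (pins true (s ∷ τ)) (w ∷ ws) → StepBelow _ s
  step cont         _  _  = tt
  step (jump p q _) s₁ s₂ = sat-pinBelow p (pins false τ) vs s₁ l₁′ , sat-pinBelow q (pins true τ) ws s₂ l₂′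

module _ {u m ℓ c : ℕ} .{{_ : NonZero m}} (k : ℕ) where

  -- The part of a trace that passes to suffixes. The surplus does not, and `Thin` is what remains
  -- of it there.
  Witness : List (Fin u) → ℕ → List (Fin u) → List Step → Sample u m ℓ c → Set
  Witness S R xs τ σ = Unique xs × All (_∈ S) xs × Follows {c = c} τ xs σ × Thin τ × jumpCount τ ≤ R

  follows-length : ∀ xs τ (σ : Sample u m ℓ c) → Follows {c = c} τ xs σ → length τ ≡ length xs
  follows-length xs τ σ (s₁ , _) = trans (sym (length-pins false τ))
    (trans (sat-length (pins false τ) (L.map (h₁ σ) xs) s₁) (LP.length-map (h₁ σ) xs))

  witness-template : ∀ {S R} xs τ (σ : Sample u m ℓ c) → Witness S R xs τ σ → τ ∈ templates (length xs) R (length xs)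
  witness-template {R = R} xs τ σ (_ , _ , fol@(s₁ , s₂) , _ , few) =
    subst (λ t → τ ∈ templates (length xs) R t) (follows-length xs τ σ fol)
      (∈-templates τ (sat-below τ (L.map (h₁ σ) xs) (L.map (h₂ σ) xs) s₁ s₂
        (≤-reflexive (LP.length-map (h₁ σ) xs)) (≤-reflexive (LP.length-map (h₂ σ) xs))) few)

  jumpCount-tail : ∀ s τ → jumpCount τ ≤ jumpCount (s ∷ τ)
  jumpCount-tail cont         τ = ≤-refl
  jumpCount-tail (jump _ _ _) τ = n≤1+n _

  thin-length : ∀ xs τ (σ : Sample u m ℓ c) → Follows {c = c} τ xs σ → Thin τ → length xs ≤ suc (totalPins τ)
  thin-length xs []      σ fol _       = ≤-trans (≤-reflexive (sym (follows-length xs [] σ fol))) z≤n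
  thin-length xs (s ∷ τ) σ fol (b , _) = ≤-trans (≤-reflexive (sym (follows-length xs (s ∷ τ) σ fol))) b

  -- One more key adds at most one collision per g_j, so the first bad suffix is still good.
  first-bad : Fin c → 1 ≤ k → ∀ {S R} (σ : Sample u m ℓ c) xs τ → Witness S R xs τ σ → Bad k (gsOf σ) xs →
    ∃[ y ] ∃[ ys ] ∃[ τ′ ] Witness S R (y ∷ ys) τ′ σ × Good k (gsOf σ) (y ∷ ys) × Bad k (gsOf σ) (y ∷ ys)
  -- No keys, no collisions: with k ≥ 1 and at least one index j₀ the empty suffix cannot be bad.
  first-bad j₀ k≥1 σ []       τ       w bad = contradiction (≤-trans k≥1 (bad j₀)) λ ()
  first-bad j₀ k≥1 σ (x ∷ xs) []      (_ , _ , (() , _) , _) bad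
  first-bad j₀ k≥1 σ (x ∷ xs) (s ∷ τ) w@(_ ∷ uxs , _ ∷ ins , (s₁ , s₂) , (_ , th) , few) bad with bad? k (gsOf σ) xs
  ... | yes bad′ = first-bad j₀ k≥1 σ xs τ
    (uxs , ins , (sat-tail (pin false s τ) (pins false τ) s₁ , sat-tail (pin true s τ) (pins true τ) s₂) ,
     th , ≤-trans (jumpCount-tail s τ) few) bad′
  ... | no ¬bad  = let j , lt = ¬bad⇒few k (gsOf σ) xs ¬bad in
    x , xs , s ∷ τ , w , (j , ≤-trans (+-monoˡ-≤ (collisions (apply (lookup (gsOf σ) j)) xs) (⟦⟧≤1 (collides? (apply (lookup (gsOf σ) j)) x xs))) lt) , bad

  module _ (F : List (HashFn u m)) (indF : Independent≤ (2 * k) F) (G : List (HashFn u ℓ)) where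

    private
      Ω : List (HashFn u m × Vec (Vec (Fin m) ℓ) c)
      Ω = cartesianProduct F (vecsOf c (vecsOf ℓ (allFin m)))

    unique? : (xs : List (Fin u)) → Dec (Unique xs)
    unique? = allPairs? (λ x y → ¬? (x ≟ y))

    -- Distinctness of the keys and the number of pins do not depend on σ. As part of the event they
    -- let the union bound run over all tuples and templates of a given length.
    event? : {D : Vec (HashFn u ℓ) c → Set} (D? : ∀ gs → Dec (D gs)) (a : ℕ) (xs : List (Fin u)) (τ : List Step) (σ : Sample u m ℓ c) →
      Dec ((Unique xs × a ≤ totalPins τ) × Follows τ xs σ × Good k (gsOf σ) xs × D (gsOf σ))
    event? D? a xs τ σ = (unique? xs ×-dec a ≤? totalPins τ) ×-dec (follows? τ xs σ ×-dec (good? k (gsOf σ) xs ×-dec D? (gsOf σ)))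

    ∑-event : {D : Vec (HashFn u ℓ) c → Set} (D? : ∀ gs → Dec (D gs)) (w a : ℕ) {q : ℕ} (xs : List (Fin u)) (τ : List Step) →
      (Unique xs → (∑[ gs ∈ vecsOf c G ] ⟦ D? gs ⟧) * w ≤ q) →
      (∑[ σ ∈ sampleSpace c F G ] ⟦ event? D? a xs τ σ ⟧) * m ^ a * w ≤ length Ω * length Ω * q
    ∑-event D? w a {q} xs τ prob = begin
      (∑[ σ ∈ sampleSpace c F G ] ⟦ event? D? a xs τ σ ⟧) * m ^ a * w
        ≡⟨ cong (λ e → e * m ^ a * w) (trans (∑-cong (sampleSpace c F G) (λ σ → ⟦⟧-× static? (dynamic? σ)))
             (sym (∑-*ˡ (sampleSpace c F G) (λ σ → ⟦ dynamic? σ ⟧) ⟦ static? ⟧))) ⟩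
      ⟦ static? ⟧ * N * m ^ a * w
        ≡⟨ assoc ⟦ static? ⟧ N (m ^ a) w ⟩
      ⟦ static? ⟧ * (N * m ^ a * w)
        ≤⟨ ⟦⟧-*-≤ static? bound ⟩
      length Ω * length Ω * q ∎
      where
      open ≤-Reasoning
      assoc : ∀ a b c d → a * b * c * d ≡ a * (b * c * d)
      assoc = solve-∀
      static? : Dec (Unique xs × a ≤ totalPins τ)
      static? = unique? xs ×-dec a ≤? totalPins τ
      dynamic? : ∀ σ → Dec (Follows τ xs σ × Good k (gsOf σ) xs × _)
      dynamic? σ = follows? τ xs σ ×-dec (good? k (gsOf σ) xs ×-dec D? (gsOf σ))
      N : ℕ
      N = ∑[ σ ∈ sampleSpace c F G ] ⟦ dynamic? σ ⟧
      bound : Unique xs × a ≤ totalPins τ → N * m ^ a * w ≤ length Ω * length Ω * q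
      bound (uxs , a≤) = begin
        N * m ^ a * w
          ≤⟨ *-monoˡ-≤ w (*-monoʳ-≤ N (^-monoʳ-≤ m a≤)) ⟩
        N * m ^ totalPins τ * w
          ≤⟨ *-monoˡ-≤ w (∑-follows k F indF G xs uxs τ D?) ⟩
        length Ω * length Ω * (∑[ gs ∈ vecsOf c G ] ⟦ D? gs ⟧) * w
          ≡⟨ *-assoc (length Ω * length Ω) _ w ⟩
        length Ω * length Ω * ((∑[ gs ∈ vecsOf c G ] ⟦ D? gs ⟧) * w)
          ≤⟨ *-monoʳ-≤ (length Ω * length Ω) (prob uxs) ⟩
        length Ω * length Ω * q ∎

    length-sampleSpace : length (sampleSpace c F G) ≡ length Ω * length Ω * length G ^ c
    length-sampleSpace = trans (sym (∑-1 (sampleSpace c F G))) (trans (∑-sampleSpace F G (λ _ → 1))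
      (trans (∑-const (vecsOf c G) _) (trans (*-comm (length (vecsOf c G)) _)
        (cong₂ _*_ (trans (∑-const Ω _) (cong (length Ω *_) (∑-1 Ω))) (length-vecsOf c G)))))

    module _ (S : List (Fin u)) (R : ℕ) where

      private
        n = length S
        indices : ℕ → List (List (Fin u) × List Step)
        indices t = cartesianProduct (tuples S t) (templates t R t)

      occurrences : {D : Vec (HashFn u ℓ) c → List (Fin u) → Set} (D? : ∀ gs xs → Dec (D gs xs)) (a t : ℕ) → Sample u m ℓ c → ℕ
      occurrences D? a t σ = ∑[ (xs , τ) ∈ indices t ] ⟦ event? (λ gs → D? gs xs) a xs τ σ ⟧

      occurrence : {D : Vec (HashFn u ℓ) c → List (Fin u) → Set} (D? : ∀ gs xs → Dec (D gs xs)) {a : ℕ} (xs : List (Fin u)) (τ : List Step) (σ : Sample u m ℓ c) →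
        Witness S R xs τ σ → a ≤ totalPins τ → Good k (gsOf σ) xs → D (gsOf σ) xs → 1 ≤ occurrences D? a (length xs) σ
      occurrence D? {a} xs τ σ w@(uxs , ins , fol , _) a≤ good d = ≤-trans
        (≤-reflexive (sym (⟦⟧-yes (event? (λ gs → D? gs xs) a xs τ σ) ((uxs , a≤) , fol , good , d))))
        (∑-∈ (λ (xs , τ) → ⟦ event? (λ gs → D? gs xs) a xs τ σ ⟧) (∈-cartesianProductWith⁺ _,_ (∈-tuples⁺ ins) (witness-template xs τ σ w)))

      -- A first-moment bound: n^t key sequences, the number of templates, probability m^-a for the
      -- pins, and q / w as a bound on the probability of D.
      ∑-occurrences : {D : Vec (HashFn u ℓ) c → List (Fin u) → Set} (D? : ∀ gs xs → Dec (D gs xs)) (w a t q : ℕ) →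
        (∀ xs → Unique xs → length xs ≡ t → (∑[ gs ∈ vecsOf c G ] ⟦ D? gs xs ⟧) * w ≤ length G ^ c * q) →
        (∑[ σ ∈ sampleSpace c F G ] occurrences D? a t σ) * m ^ a * w
          ≤ n ^ t * (2 * (suc t * (suc t * suc t))) ^ R * (length (sampleSpace c F G) * q)
      ∑-occurrences D? w a t q prob = begin
        (∑[ σ ∈ sampleSpace c F G ] occurrences D? a t σ) * m ^ a * w
          ≡⟨ trans (*-assoc (∑ (sampleSpace c F G) (occurrences D? a t)) (m ^ a) w) (trans (cong (_* (m ^ a * w)) (∑-swap (sampleSpace c F G) (indices t) (λ σ i → ⟦ event? (λ gs → D? gs (proj₁ i)) a (proj₁ i) (proj₂ i) σ ⟧)))
               (∑-*ʳ (indices t) _ (m ^ a * w))) ⟩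
        (∑[ (xs , τ) ∈ indices t ] (∑[ σ ∈ sampleSpace c F G ] ⟦ event? (λ gs → D? gs xs) a xs τ σ ⟧) * (m ^ a * w))
          ≤⟨ ∑-mono-∈ (indices t) (λ {i} i∈ → term i i∈) ⟩
        (∑[ i ∈ indices t ] length (sampleSpace c F G) * q)
          ≡⟨ trans (∑-const (indices t) _) (cong (_* (length (sampleSpace c F G) * q))
               (trans (length-cartesianProductWith _,_ (tuples S t) (templates t R t)) (cong (_* length (templates t R t)) (length-tuples S t)))) ⟩
        n ^ t * length (templates t R t) * (length (sampleSpace c F G) * q)
          ≤⟨ *-monoˡ-≤ (length (sampleSpace c F G) * q) (*-monoʳ-≤ (n ^ t) (length-templates-cubic R t)) ⟩
        n ^ t * (2 * (suc t * (suc t * suc t))) ^ R * (length (sampleSpace c F G) * q) ∎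
        where
        open ≤-Reasoning
        term : ∀ i → i ∈ indices t → (∑[ σ ∈ sampleSpace c F G ] ⟦ event? (λ gs → D? gs (proj₁ i)) a (proj₁ i) (proj₂ i) σ ⟧) * (m ^ a * w)
          ≤ length (sampleSpace c F G) * q
        term (xs , τ) i∈ with ∈-cartesianProductWith⁻ _,_ (tuples S t) (templates t R t) i∈
        ... | _ , _ , xs∈ , _ , refl = begin
          (∑[ σ ∈ sampleSpace c F G ] ⟦ event? (λ gs → D? gs xs) a xs τ σ ⟧) * (m ^ a * w)
            ≡⟨ sym (*-assoc (∑[ σ ∈ sampleSpace c F G ] ⟦ event? (λ gs → D? gs xs) a xs τ σ ⟧) (m ^ a) w) ⟩
          (∑[ σ ∈ sampleSpace c F G ] ⟦ event? (λ gs → D? gs xs) a xs τ σ ⟧) * m ^ a * w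
            ≤⟨ ∑-event (λ gs → D? gs xs) w a xs τ (λ uxs → prob xs uxs (∈-tuples-length S t xs∈)) ⟩
          length Ω * length Ω * (length G ^ c * q)
            ≡⟨ trans (sym (*-assoc (length Ω * length Ω) (length G ^ c) q)) (cong (_* q) (sym length-sampleSpace)) ⟩
          length (sampleSpace c F G) * q ∎

-- Union bound

module _ {n m K : ℕ} .{{_ : NonZero m}} (gap : m + K * n ≤ K * m) where

  -- The geometric decay in n / m beats the polynomial factor, so the total does not depend on the
  -- cut-off N.
  ∑-lengths : (X : ℕ → ℕ) (b c₀ D N : ℕ) → (∀ t → X t * m ^ t * b ≤ n ^ t * (c₀ * suc t ^ D)) →
    ∑ (downFrom N) X * b ≤ c₀ * seriesBound K D
  ∑-lengths X b c₀ D N bound = *-cancelʳ-≤ _ _ (m ^ N) {{m^n≢0 m N}} (begin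
    ∑ (downFrom N) X * b * m ^ N
      ≡⟨ trans (*-assoc (∑ (downFrom N) X) b (m ^ N)) (∑-*ʳ (downFrom N) X (b * m ^ N)) ⟩
    (∑[ t ∈ downFrom N ] X t * (b * m ^ N))
      ≤⟨ ∑-mono-∈ (downFrom N) (λ {t} t∈ → term t (∈-downFrom⁻ t∈)) ⟩
    (∑[ t ∈ downFrom N ] c₀ * (suc t ^ D * n ^ t * m ^ (N ∸ t)))
      ≡⟨ sym (∑-*ˡ (downFrom N) (λ t → suc t ^ D * n ^ t * m ^ (N ∸ t)) c₀) ⟩
    c₀ * series n m D N
      ≤⟨ *-monoʳ-≤ c₀ (series-bound {K = K} gap D N) ⟩
    c₀ * (seriesBound K D * m ^ N)
      ≡⟨ sym (*-assoc c₀ (seriesBound K D) (m ^ N)) ⟩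
    c₀ * seriesBound K D * m ^ N ∎)
    where
    open ≤-Reasoning
    regroup : ∀ x b p q → x * (b * (p * q)) ≡ x * p * b * q
    regroup = solve-∀
    regroup′ : ∀ a c d q → a * (c * d) * q ≡ c * (d * a * q)
    regroup′ = solve-∀
    term : ∀ t → t < N → X t * (b * m ^ N) ≤ c₀ * (suc t ^ D * n ^ t * m ^ (N ∸ t))
    term t t<N = begin
      X t * (b * m ^ N)
        ≡⟨ cong (λ e → X t * (b * e)) (trans (cong (m ^_) (sym (m+[n∸m]≡n (<⇒≤ t<N)))) (^-distribˡ-+-* m t (N ∸ t))) ⟩
      X t * (b * (m ^ t * m ^ (N ∸ t)))
        ≡⟨ regroup (X t) b (m ^ t) (m ^ (N ∸ t)) ⟩
      X t * m ^ t * b * m ^ (N ∸ t)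
        ≤⟨ *-monoˡ-≤ (m ^ (N ∸ t)) (bound t) ⟩
      n ^ t * (c₀ * suc t ^ D) * m ^ (N ∸ t)
        ≡⟨ regroup′ (n ^ t) c₀ (suc t ^ D) (m ^ (N ∸ t)) ⟩
      c₀ * (suc t ^ D * n ^ t * m ^ (N ∸ t)) ∎

  gap⇒≤ : n ≤ m
  gap⇒≤ with n ≤? m
  ... | yes n≤m = n≤m
  ... | no n≰m  = contradiction
    (+-cancelʳ-≤ (K * n) m 0 (≤-trans gap (*-monoʳ-≤ K (<⇒≤ (≰⇒> n≰m)))))
    (<⇒≱ (>-nonZero⁻¹ m))

templateFactor : ∀ R y → (2 * (y * (y * y))) ^ R ≡ 2 ^ R * y ^ (3 * R)
templateFactor R y = trans (^-distribʳ-* 2 (y * (y * y)) R)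
  (cong (2 ^ R *_) (trans (cong (λ e → (y * (y * e)) ^ R) (sym (*-identityʳ y))) (^-*-assoc y 3 R)))

goodConstant : (K R : ℕ) → ℕ
goodConstant K R = 2 ^ R * seriesBound K (3 * R)

-- 3 R from the templates, 2 k c from the c-th power of `collisionBound`.
badDegree : (R k c : ℕ) → ℕ
badDegree R k c = 3 * R + 2 * k * c

-- The last factor pays for t + 2 ≤ 2 (t + 1), as a bad suffix indexed by t has t + 1 keys.
badFactor : (R k c : ℕ) → ℕ
badFactor R k c = 2 ^ R * ((2 * k * (2 * k)) ^ k) ^ c * 2 ^ badDegree R k c

badConstant : (K R k c : ℕ) → ℕ
badConstant K R k c = badFactor R k c * seriesBound K (badDegree R k c)

bad-factor-bound : ∀ R k c t →
  (2 * (suc (suc t) * (suc (suc t) * suc (suc t)))) ^ R * (suc (suc t) ^ (2 * k) * (2 * k * (2 * k)) ^ k) ^ c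
    ≤ badFactor R k c * suc t ^ badDegree R k c
bad-factor-bound R k c t = begin
  (2 * (y * (y * y))) ^ R * (y ^ (2 * k) * E) ^ c
    ≡⟨ cong₂ _*_ (templateFactor R y) (trans (^-distribʳ-* (y ^ (2 * k)) E c) (cong (_* E ^ c) (^-*-assoc y (2 * k) c))) ⟩
  2 ^ R * y ^ (3 * R) * (y ^ (2 * k * c) * E ^ c)
    ≡⟨ regroup (2 ^ R) (y ^ (3 * R)) (y ^ (2 * k * c)) (E ^ c) ⟩
  2 ^ R * E ^ c * (y ^ (3 * R) * y ^ (2 * k * c))
    ≡⟨ cong (2 ^ R * E ^ c *_) (sym (^-distribˡ-+-* y (3 * R) (2 * k * c))) ⟩
  2 ^ R * E ^ c * y ^ D
    ≤⟨ *-monoʳ-≤ (2 ^ R * E ^ c) (^-monoˡ-≤ D double) ⟩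
  2 ^ R * E ^ c * (2 * suc t) ^ D
    ≡⟨ trans (cong (2 ^ R * E ^ c *_) (^-distribʳ-* 2 (suc t) D)) (sym (*-assoc (2 ^ R * E ^ c) (2 ^ D) (suc t ^ D))) ⟩
  badFactor R k c * suc t ^ D ∎
  where
  open ≤-Reasoning
  y = suc (suc t)
  E = (2 * k * (2 * k)) ^ k
  D = badDegree R k c
  regroup : ∀ a b c d → a * b * (c * d) ≡ a * d * (b * c)
  regroup = solve-∀
  double : y ≤ 2 * suc t
  double = ≤-trans (s≤s (s≤s (m≤m+n t t))) (≤-reflexive (lem t))
    where
    lem : ∀ t → suc (suc (t + t)) ≡ 2 * suc t
    lem = solve-∀

module _ {u m ℓ c : ℕ} .{{_ : NonZero m}} .{{_ : NonZero ℓ}} (k s K : ℕ) (k≥1 : 1 ≤ k) (c≥1 : 1 ≤ c)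
  (S : List (Fin u)) (uS : Unique S) (gap : m + K * length S ≤ K * m)
  (F : List (HashFn u m)) (indF : Independent≤ (2 * k) F)
  (G : List (HashFn u ℓ)) (indG : Independent≤ (2 * k) G) where

  private
    n = length S
    R = suc s * 5
    Ω = sampleSpace c F G

    always : (gs : Vec (HashFn u ℓ) c) (xs : List (Fin u)) → Dec ⊤
    always _ _ = yes tt

    bads : (gs : Vec (HashFn u ℓ) c) (xs : List (Fin u)) → Dec (Bad k gs xs)
    bads = bad? k

    -- A whole trace of t keys has t + s + 1 pins. A bad suffix is only `Thin`, with t pins for t +
    -- 1 keys, and is indexed by its length minus one.
    goodCount badCount : ℕ → Sample u m ℓ c → ℕ
    goodCount t = occurrences k F indF G S R always (t + suc s) t
    badCount  t = occurrences k F indF G S R bads t (suc t)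

  ∑-goodCount : (∑[ t ∈ downFrom (suc n) ] ∑[ σ ∈ Ω ] goodCount t σ) * m ^ suc s ≤ length Ω * goodConstant K R
  ∑-goodCount = ≤-trans (∑-lengths {K = K} gap (λ t → ∑ Ω (goodCount t)) (m ^ suc s) (2 ^ R * length Ω) (3 * R) (suc n) term)
    (≤-reflexive (rot (2 ^ R) (length Ω) (seriesBound K (3 * R))))
    where
    open ≤-Reasoning
    rot : ∀ a b c → a * b * c ≡ b * (a * c)
    rot = solve-∀
    regroup : ∀ a b d l → a * (b * d) * (l * 1) ≡ a * (b * l * d)
    regroup = solve-∀
    prob : ∀ xs → (∑[ gs ∈ vecsOf c G ] ⟦ always gs xs ⟧) * 1 ≤ length G ^ c * 1
    prob xs = *-monoˡ-≤ 1 (≤-reflexive (trans (∑-1 (vecsOf c G)) (length-vecsOf c G)))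
    term : ∀ t → ∑ Ω (goodCount t) * m ^ t * m ^ suc s ≤ n ^ t * (2 ^ R * length Ω * suc t ^ (3 * R))
    term t = begin
      ∑ Ω (goodCount t) * m ^ t * m ^ suc s
        ≡⟨ trans (*-assoc (∑ Ω (goodCount t)) (m ^ t) (m ^ suc s)) (cong (∑ Ω (goodCount t) *_) (sym (^-distribˡ-+-* m t (suc s)))) ⟩
      ∑ Ω (goodCount t) * m ^ (t + suc s)
        ≡⟨ sym (*-identityʳ _) ⟩
      ∑ Ω (goodCount t) * m ^ (t + suc s) * 1
        ≤⟨ ∑-occurrences k F indF G S R always 1 (t + suc s) t 1 (λ xs _ _ → prob xs) ⟩
      n ^ t * (2 * (suc t * (suc t * suc t))) ^ R * (length Ω * 1)
        ≡⟨ cong (λ e → n ^ t * e * (length Ω * 1)) (templateFactor R (suc t)) ⟩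
      n ^ t * (2 ^ R * suc t ^ (3 * R)) * (length Ω * 1)
        ≡⟨ regroup (n ^ t) (2 ^ R) (suc t ^ (3 * R)) (length Ω) ⟩
      n ^ t * (2 ^ R * length Ω * suc t ^ (3 * R)) ∎

  ∑-badCount : (∑[ t ∈ downFrom n ] ∑[ σ ∈ Ω ] badCount t σ) * (ℓ ^ k) ^ c ≤ n * (length Ω * badConstant K R k c)
  ∑-badCount = ≤-trans (∑-lengths {K = K} gap (λ t → ∑ Ω (badCount t)) ((ℓ ^ k) ^ c) (n * length Ω * badFactor R k c) (badDegree R k c) n term)
    (≤-reflexive (assoc n (length Ω) (badFactor R k c) (seriesBound K (badDegree R k c))))
    where
    open ≤-Reasoning
    assoc : ∀ a b c d → a * b * c * d ≡ a * (b * (c * d))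
    assoc = solve-∀
    regroup : ∀ n p b l a → n * p * b * (l * a) ≡ p * (n * l * (b * a))
    regroup = solve-∀
    regroup′ : ∀ p a b d → p * (a * (b * d)) ≡ p * (a * b * d)
    regroup′ = solve-∀
    α : ℕ → ℕ
    α = collisionBound k G indG
    prob : ∀ t xs → Unique xs → length xs ≡ suc t →
      (∑[ gs ∈ vecsOf c G ] ⟦ bads gs xs ⟧) * (ℓ ^ k) ^ c ≤ length G ^ c * α (suc t) ^ c
    prob t xs uxs len = ≤-trans (∑-allCollide k G indG c xs uxs)
      (≤-reflexive (trans (^-distribʳ-* (length G) (α (length xs)) c) (cong (λ t → length G ^ c * α t ^ c) len)))
    term : ∀ t → ∑ Ω (badCount t) * m ^ t * (ℓ ^ k) ^ c ≤ n ^ t * (n * length Ω * badFactor R k c * suc t ^ badDegree R k c)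
    term t = begin
      ∑ Ω (badCount t) * m ^ t * (ℓ ^ k) ^ c
        ≤⟨ ∑-occurrences k F indF G S R bads ((ℓ ^ k) ^ c) t (suc t) (α (suc t) ^ c) (prob t) ⟩
      n * n ^ t * (2 * (suc (suc t) * (suc (suc t) * suc (suc t)))) ^ R * (length Ω * α (suc t) ^ c)
        ≡⟨ regroup n (n ^ t) ((2 * (suc (suc t) * (suc (suc t) * suc (suc t)))) ^ R) (length Ω) (α (suc t) ^ c) ⟩
      n ^ t * (n * length Ω * ((2 * (suc (suc t) * (suc (suc t) * suc (suc t)))) ^ R * α (suc t) ^ c))
        ≤⟨ *-monoʳ-≤ (n ^ t) (*-monoʳ-≤ (n * length Ω) (bad-factor-bound R k c t)) ⟩
      n ^ t * (n * length Ω * (badFactor R k c * suc t ^ badDegree R k c))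
        ≡⟨ regroup′ (n ^ t) (n * length Ω) (badFactor R k c) (suc t ^ badDegree R k c) ⟩
      n ^ t * (n * length Ω * badFactor R k c * suc t ^ badDegree R k c) ∎

  excess-counted : (σ : Sample u m ℓ c) → ExcessAtLeast (cuckooEdges S σ) (suc s) →
    1 ≤ (∑[ t ∈ downFrom (suc n) ] goodCount t σ) + (∑[ t ∈ downFrom n ] badCount t σ)
  excess-counted σ ex with Extraction.extract S uS (λ b → if b then h₂ σ else h₁ σ) (suc s) ex
  ... | xs , τ , t = count (bads (gsOf σ) xs)
    where
    open Extraction.Trace t
    follows : Follows {c = c} τ xs σ
    follows = sat false , sat true
    bound : {ys : List (Fin u)} → Unique ys → All (_∈ S) ys → length ys ≤ n
    bound uys ins = Unique⇒length≤ uys (All.lookup ins)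
    -- The trace carries s + 2, one more than its edges exceed its vertices; the unit on the right
    -- of `excess` cancels the difference.
    pinned : length xs + suc s ≤ totalPins τ
    pinned = ≤-pred (≤-trans (≤-reflexive (trans (cong (λ e → suc (e + suc s)) (sym length≡)) (sym (+-suc (length τ) (suc s))))) excess)
    count : Dec (Bad k (gsOf σ) xs) → _
    count (no ¬bad) = let j , lt = ¬bad⇒few k (gsOf σ) xs ¬bad in ≤-trans
      (≤-trans (occurrence k F indF G S R always xs τ σ (unique , inS , follows , thin , few) pinned (j , <⇒≤ lt) tt)
               (∑-∈ (λ t → goodCount t σ) (∈-downFrom⁺ (s≤s (bound unique inS)))))
      (m≤m+n _ _)
    count (yes bad) with first-bad k (fromℕ< c≥1) k≥1 σ xs τ (unique , inS , follows , thin , few) bad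
    ... | y , ys , τ′ , w@(uys , ins , fol , th , _) , good , bad′ = ≤-trans
      (≤-trans (occurrence k F indF G S R bads (y ∷ ys) τ′ σ w (≤-pred (thin-length k (y ∷ ys) τ′ σ fol th)) good bad′)
               (∑-∈ (λ t → badCount t σ) (∈-downFrom⁺ (bound uys ins))))
      (m≤n+m _ _)

  excess-samples : (B : List (Sample u m ℓ c)) → B ⊆ Ω → All (λ σ → ExcessAtLeast (cuckooEdges S σ) (suc s)) B →
    n ^ (s + 2) ≤ (2 * ℓ) ^ (k * c) → 1 ≤ n →
    length B * n ^ suc s ≤ (goodConstant K R + 2 ^ (k * c) * badConstant K R k c) * length Ω
  excess-samples B B⊆Ω exs n≤ℓ n≥1 = begin
    length B * n ^ suc s
      ≤⟨ *-monoˡ-≤ (n ^ suc s) counted ⟩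
    (X₁ + X₂) * n ^ suc s
      ≡⟨ *-distribʳ-+ (n ^ suc s) X₁ X₂ ⟩
    X₁ * n ^ suc s + X₂ * n ^ suc s
      ≤⟨ +-mono-≤ (≤-trans (*-monoʳ-≤ X₁ (^-monoˡ-≤ (suc s) (gap⇒≤ {K = K} gap))) ∑-goodCount) bad-part ⟩
    length Ω * goodConstant K R + length Ω * (2 ^ (k * c) * badConstant K R k c)
      ≡⟨ trans (sym (*-distribˡ-+ (length Ω) (goodConstant K R) (2 ^ (k * c) * badConstant K R k c))) (*-comm (length Ω) _) ⟩
    (goodConstant K R + 2 ^ (k * c) * badConstant K R k c) * length Ω ∎
    where
    open ≤-Reasoning
    X₁ = ∑[ t ∈ downFrom (suc n) ] ∑[ σ ∈ Ω ] goodCount t σ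
    X₂ = ∑[ t ∈ downFrom n ] ∑[ σ ∈ Ω ] badCount t σ
    counted : length B ≤ X₁ + X₂
    counted = begin
      length B
        ≡⟨ sym (∑-1 B) ⟩
      (∑[ σ ∈ B ] 1)
        ≤⟨ ∑-mono-∈ B (λ {σ} σ∈ → excess-counted σ (All.lookup exs σ∈)) ⟩
      (∑[ σ ∈ B ] ((∑[ t ∈ downFrom (suc n) ] goodCount t σ) + (∑[ t ∈ downFrom n ] badCount t σ)))
        ≤⟨ ∑-⊆ _ B⊆Ω ⟩
      (∑[ σ ∈ Ω ] ((∑[ t ∈ downFrom (suc n) ] goodCount t σ) + (∑[ t ∈ downFrom n ] badCount t σ)))
        ≡⟨ trans (∑-+ Ω _ _) (cong₂ _+_ (∑-swap Ω (downFrom (suc n)) (λ σ t → goodCount t σ)) (∑-swap Ω (downFrom n) (λ σ t → badCount t σ))) ⟩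
      X₁ + X₂ ∎
    regroup : ∀ x n p → n * (x * p) ≡ x * (n * p)
    regroup = solve-∀
    regroup′ : ∀ x a b → x * (a * b) ≡ a * (x * b)
    regroup′ = solve-∀
    regroup″ : ∀ a n l b → a * (n * (l * b)) ≡ n * (l * (a * b))
    regroup″ = solve-∀
    bad-part : X₂ * n ^ suc s ≤ length Ω * (2 ^ (k * c) * badConstant K R k c)
    -- Multiplying by n produces n^(s+2), the power that ℓ controls. This n cancels the one left
    -- over in `∑-badCount`.
    bad-part = *-cancelˡ-≤ n {{>-nonZero n≥1}} (begin
      n * (X₂ * n ^ suc s)                      ≡⟨ regroup X₂ n (n ^ suc s) ⟩
      X₂ * n ^ (2 + s)                          ≡⟨ cong (λ e → X₂ * n ^ e) (+-comm 2 s) ⟩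
      X₂ * n ^ (s + 2)                          ≤⟨ *-monoʳ-≤ X₂ n≤ℓ ⟩
      X₂ * (2 * ℓ) ^ (k * c)                    ≡⟨ cong (X₂ *_) (trans (^-distribʳ-* 2 ℓ (k * c)) (cong (2 ^ (k * c) *_) (sym (^-*-assoc ℓ k c)))) ⟩
      X₂ * (2 ^ (k * c) * (ℓ ^ k) ^ c)          ≡⟨ regroup′ X₂ (2 ^ (k * c)) ((ℓ ^ k) ^ c) ⟩
      2 ^ (k * c) * (X₂ * (ℓ ^ k) ^ c)          ≤⟨ *-monoʳ-≤ (2 ^ (k * c)) ∑-badCount ⟩
      2 ^ (k * c) * (n * (length Ω * badConstant K R k c)) ≡⟨ regroup″ (2 ^ (k * c)) n (length Ω) (badConstant K R k c) ⟩
      n * (length Ω * (2 ^ (k * c) * badConstant K R k c)) ∎)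

open import Data.Integer using (+_)

theorem1 : (ε δ : ℚ) (s k c : ℕ) →
    0ℚ <ℚ ε → 0ℚ <ℚ δ → δ <ℚ 1ℚ → 1 ≤ k → 1 ≤ c →
    (+ (s + 2)) / 1 ≤ℚ (δ *ℚ ((+ k) / 1)) *ℚ ((+ c) / 1) →
    ∃[ C ] (∀ (n m ℓ u : ℕ) .{{_ : NonZero m}} →
    1 ≤ n → (1ℚ +ℚ ε) *ℚ ((+ n) / 1) ≤ℚ (+ m) / 1 → RoundedPow n δ ℓ →
    (S : List (Fin u)) → Unique S → length S ≡ n →
    (F : List (HashFn u m)) → IsHashFamily (2 * k) F →
    (G : List (HashFn u ℓ)) → IsHashFamily (2 * k) G →
    (B : List (Sample u m ℓ c)) → B ⊆ sampleSpace c F G →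
    All (λ σ → ExcessAtLeast (cuckooEdges S σ) (suc s)) B →
    length B * n ^ (suc s) ≤ C * length (sampleSpace c F G))
theorem1 ε δ s k c ε>0 δ>0 δ<1 k≥1 c≥1 cond = small + large , bound
  where
  K = gapConstant ε
  small large : ℕ
  -- Covers n < 2 k, where the trivial bound Pr ≤ 1 is already at most (2 k / n)^(s+1).
  small = (2 * k) ^ suc s
  large = goodConstant K (suc s * 5) + 2 ^ (k * c) * badConstant K (suc s * 5) k c
  bound : ∀ (n m ℓ u : ℕ) .{{_ : NonZero m}} →
    1 ≤ n → (1ℚ +ℚ ε) *ℚ ((+ n) / 1) ≤ℚ (+ m) / 1 → RoundedPow n δ ℓ →
    (S : List (Fin u)) → Unique S → length S ≡ n →
    (F : List (HashFn u m)) → IsHashFamily (2 * k) F →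
    (G : List (HashFn u ℓ)) → IsHashFamily (2 * k) G →
    (B : List (Sample u m ℓ c)) → B ⊆ sampleSpace c F G →
    All (λ σ → ExcessAtLeast (cuckooEdges S σ) (suc s)) B →
    length B * n ^ (suc s) ≤ (small + large) * length (sampleSpace c F G)
  bound n m ℓ u n≥1 m≥ rounded S uS refl F (_ , _ , kwF) G (_ , _ , kwG) B B⊆ exs with 2 * k ≤? n
  ... | no n<2k = begin
    length B * n ^ suc s                        ≤⟨ *-mono-≤ (SubP.length-mono-≤ B⊆) (^-monoˡ-≤ (suc s) (<⇒≤ (≰⇒> n<2k))) ⟩
    length (sampleSpace c F G) * small          ≡⟨ *-comm (length (sampleSpace c F G)) small ⟩
    small * length (sampleSpace c F G)          ≤⟨ *-monoˡ-≤ (length (sampleSpace c F G)) (m≤m+n small large) ⟩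
    (small + large) * length (sampleSpace c F G) ∎
    where open ≤-Reasoning
  ... | yes 2k≤n = ≤-trans
    (excess-samples k s K k≥1 c≥1 S uS (gap-condition ε ε>0 n m m≥) F (independent≤ (2 * k) F kwF uS 2k≤n)
       G (independent≤ (2 * k) G kwG uS 2k≤n) B B⊆ exs (rounded-power δ s k c n≥1 δ>0 cond rounded) n≥1)
    (*-monoˡ-≤ (length (sampleSpace c F G)) (m≤n+m large small))
    where
    instance
      ℓ≢0 : NonZero ℓ
      ℓ≢0 = >-nonZero (rounded-positive δ n≥1 rounded)
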